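{- Fix an integer $r\ge 2$. For every constant $C>(2^r e r)^{1/(r-1)}$ there is a constant $A>0$ such that the following holds. Let $(H(n))_n$ be a sequence of linear $r$-uniform hypergraphs, $H(n)$ having $n$ vertices and maximum degree $\Delta=\Delta(n)$, and let $k=k(n)$, $\sigma=\sigma(n)$ be integers with $k\le\sigma$, $k\ge A(\log n)^{1/r}$ and $\sigma\ge C\Delta^{1/(r-1)}$. If $L$ is a random $(k,\sigma)$-list assignment for $H(n)$, then $\mathbb{P}[H(n)\text{ is }L\text{ -colorable}]\to 1$ as $n\to\infty$.
   Context: A hypergraph is linear if any two distinct vertices lie in at most one common edge. A random $(k,\sigma)$-list assignment $L$ for $H$ is obtained by choosing, for each vertex $v$ independently, the list $L(v)$ uniformly at random among all $k$-element subsets of $\{1,\dots,\sigma\}$. $H$ is $L$-colorable if there is a map $\varphi$ with $\varphi(v)\in L(v)$ for all $v$ such that no edge is monochromatic. $\log$ is the natural logarithm. -}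

module Defs where

open import Data.Empty using (⊥)
open import Data.Fin using (Fin)
import Data.Fin.Properties as Fin
open import Data.Fin.Subset using (Subset; inside; outside; _∈_; ∣_∣)
open import Data.Fin.Subset.Properties using (_∈?_)
open import Data.Integer as ℤ using (+_)
import Data.Integer.Properties as ℤ
open import Data.List using (List; []; _∷_; _++_; length; map; filter; foldr; allFin; cartesianProductWith)
open import Data.List.Extrema.Nat using (max)
import Data.List.Membership.Propositional as List
open import Data.List.Relation.Unary.All as All using (All)
open import Data.List.Relation.Unary.Unique.Propositional using (Unique)
open import Data.Nat as ℕ using (ℕ; zero; suc; NonZero; NonTrivial)
import Data.Nat.Properties as ℕ
open import Data.Product using (∃; ∃-syntax; _×_; _,_; proj₁; proj₂)
open import Data.Rational as ℚ using (ℚ; 0ℚ; 1ℚ; ½; _<_; _≤_; _+_; _*_; _-_; -_; _⊓_; _⊔_; _/_)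
open import Data.Rational.Properties as ℚ using (+-*-rawSemiring)
open import Data.Rational.Solver using (module +-*-Solver)
open import Data.Integer.Solver using () renaming (module +-*-Solver to ℤ)
import Data.Rational.Unnormalised as ℚᵘ
import Data.Rational.Unnormalised.Properties as ℚᵘ
open import Data.Sum as Sum using (_⊎_; inj₁; inj₂)
open import Data.Vec using (Vec; []; _∷_; lookup)
open import Relation.Binary.PropositionalEquality using (_≡_; _≢_; refl; sym; trans; cong; subst; subst₂)
open import Relation.Binary.Definitions using (tri<; tri≈; tri>)
open import Relation.Nullary using (¬_; Dec; yes; no; contradiction; map′; ¬?; _→-dec_; _×-dec_)
open import Relation.Unary using (Decidable)
open import Algebra.Definitions.RawSemiring +-*-rawSemiring using (_^_)

open +-*-Solver using (solve; con; _:+_; _:*_; _:-_; :-_; _:=_)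

le : ∀ {p q} → 0ℚ ≤ q - p → p ≤ q
le {p} {q} h = subst₂ _≤_ (solve 1 (λ p → con 0ℚ :+ p := p) refl p)
  (solve 2 (λ p q → (q :- p) :+ p := q) refl p q) (ℚ.+-monoˡ-≤ p h)

el : ∀ {p q} → p ≤ q → 0ℚ ≤ q - p
el {p} {q} h = subst (_≤ q - p) (solve 1 (λ p → p :- p := con 0ℚ) refl p) (ℚ.+-monoˡ-≤ (- p) h)

lt : ∀ {p q} → 0ℚ < q - p → p < q
lt {p} {q} h = subst₂ _<_ (solve 1 (λ p → con 0ℚ :+ p := p) refl p)
  (solve 2 (λ p q → (q :- p) :+ p := q) refl p q) (ℚ.+-monoˡ-< p h)

tl : ∀ {p q} → p < q → 0ℚ < q - p
tl {p} {q} h = subst (_< q - p) (solve 1 (λ p → p :- p := con 0ℚ) refl p) (ℚ.+-monoˡ-< (- p) h)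

0≤+ : ∀ {p q} → 0ℚ ≤ p → 0ℚ ≤ q → 0ℚ ≤ p + q
0≤+ = ℚ.+-mono-≤

0<+ : ∀ {p q} → 0ℚ < p → 0ℚ ≤ q → 0ℚ < p + q
0<+ = ℚ.+-mono-<-≤

0≤* : ∀ {p q} → 0ℚ ≤ p → 0ℚ ≤ q → 0ℚ ≤ p * q
0≤* {p} {q} hp hq = subst (_≤ p * q) (ℚ.*-zeroʳ p)
  (ℚ.*-monoˡ-≤-nonNeg p {{ℚ.nonNegative hp}} hq)

0<* : ∀ {p q} → 0ℚ < p → 0ℚ < q → 0ℚ < p * q
0<* {p} {q} hp hq = subst (_< p * q) (ℚ.*-zeroʳ p)
  (ℚ.*-monoʳ-<-pos p {{ℚ.positive hp}} hq)

0<1 : 0ℚ < 1ℚ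
0<1 = ℚ.positive⁻¹ 1ℚ

0<½ : 0ℚ < ½
0<½ = ℚ.positive⁻¹ ½

-- The right-hand sides of the equations below are sums of quantities already
-- known to be nonnegative (positive), so each inequality becomes a ring identity.
le≡ : ∀ {p q s} → q - p ≡ s → 0ℚ ≤ s → p ≤ q
le≡ e h = le (subst (0ℚ ≤_) (sym e) h)

lt≡ : ∀ {p q s} → q - p ≡ s → 0ℚ < s → p < q
lt≡ e h = lt (subst (0ℚ <_) (sym e) h)

p<p+ : ∀ {p ε} → 0ℚ < ε → p < p + ε
p<p+ {p} {ε} h = lt≡ (solve 2 (λ p ε → (p :+ ε) :- p := ε) refl p ε) h

p-<p : ∀ {p ε} → 0ℚ < ε → p - ε < p
p-<p {p} {ε} h = lt≡ (solve 2 (λ p ε → p :- (p :- ε) := ε) refl p ε) h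

<-⊓ : ∀ {p q s} → p < q → p < s → p < q ⊓ s
<-⊓ {p} {q} {s} h k with ℚ.⊓-sel q s
... | inj₁ e = subst (p <_) (sym e) h
... | inj₂ e = subst (p <_) (sym e) k

⊔-< : ∀ {p q s} → q < p → s < p → q ⊔ s < p
⊔-< {p} {q} {s} h k with ℚ.⊔-sel q s
... | inj₁ e = subst (_< p) (sym e) h
... | inj₂ e = subst (_< p) (sym e) k

≤∣∣ : ∀ p → p ≤ ℚ.∣ p ∣
≤∣∣ p with ℚ.≤-total 0ℚ p
... | inj₁ h = ℚ.≤-reflexive (sym (ℚ.0≤p⇒∣p∣≡p h))
... | inj₂ h = ℚ.≤-trans h (ℚ.0≤∣p∣ p)

-∣∣≤ : ∀ p → - ℚ.∣ p ∣ ≤ p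
-∣∣≤ p = le≡ (solve 2 (λ p a → p :- (:- a) := a :- (:- p)) refl p ℚ.∣ p ∣)
  (el (subst (- p ≤_) (ℚ.∣-p∣≡∣p∣ p) (≤∣∣ (- p))))

fromℕℚ : ℕ → ℚ
fromℕℚ n = + n / 1

fromℕℚ-suc : ∀ n → fromℕℚ (suc n) ≡ 1ℚ + fromℕℚ n
fromℕℚ-suc n = ℚ.toℚᵘ-injective (begin
  ℚ.toℚᵘ (fromℕℚ (suc n))                 ≈⟨ ℚ.toℚᵘ-fromℚᵘ (ℚᵘ.mkℚᵘ (+ suc n) 0) ⟩
  ℚᵘ.mkℚᵘ (+ suc n) 0                     ≈⟨ ℚᵘ.*≡* (ℤ.solve 1 (λ x → (ℤ.con (+ 1) ℤ.:+ x) ℤ.:* ℤ.con (+ 1)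
                                               ℤ.:= (ℤ.con (+ 1) ℤ.:* ℤ.con (+ 1) ℤ.:+ x ℤ.:* ℤ.con (+ 1)) ℤ.:* ℤ.con (+ 1)) refl (+ n)) ⟩
  ℚ.toℚᵘ 1ℚ ℚᵘ.+ ℚᵘ.mkℚᵘ (+ n) 0          ≈⟨ ℚᵘ.+-congʳ (ℚ.toℚᵘ 1ℚ) (ℚ.toℚᵘ-fromℚᵘ (ℚᵘ.mkℚᵘ (+ n) 0)) ⟨
  ℚ.toℚᵘ 1ℚ ℚᵘ.+ ℚ.toℚᵘ (fromℕℚ n)        ≈⟨ ℚ.toℚᵘ-homo-+ 1ℚ (fromℕℚ n) ⟨
  ℚ.toℚᵘ (1ℚ + fromℕℚ n)                  ∎)
  where open ℚᵘ.≃-Reasoning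

0≤fromℕℚ : ∀ n → 0ℚ ≤ fromℕℚ n
0≤fromℕℚ zero    = ℚ.≤-refl
0≤fromℕℚ (suc n) = subst (0ℚ ≤_) (sym (fromℕℚ-suc n)) (0≤+ (ℚ.<⇒≤ 0<1) (0≤fromℕℚ n))

0<fromℕℚ-suc : ∀ n → 0ℚ < fromℕℚ (suc n)
0<fromℕℚ-suc n = subst (0ℚ <_) (sym (fromℕℚ-suc n)) (0<+ 0<1 (0≤fromℕℚ n))

fromℕℚ-mono : ∀ {m n} → m ℕ.≤ n → fromℕℚ m ≤ fromℕℚ n
fromℕℚ-mono {m} {n} m≤n with d , refl ← ℕ.m≤n⇒∃[o]m+o≡n m≤n = go d
  where
  go : ∀ d → fromℕℚ m ≤ fromℕℚ (m ℕ.+ d)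
  go zero    = ℚ.≤-reflexive (cong fromℕℚ (sym (ℕ.+-identityʳ m)))
  go (suc d) = ℚ.≤-trans (go d) (le≡
    (trans (cong (_- fromℕℚ (m ℕ.+ d)) (trans (cong fromℕℚ (ℕ.+-suc m d)) (fromℕℚ-suc (m ℕ.+ d))))
      (solve 1 (λ x → (con 1ℚ :+ x) :- x := con 1ℚ) refl (fromℕℚ (m ℕ.+ d))))
    (ℚ.<⇒≤ 0<1))

1/suc : ℕ → ℚ
1/suc n = + 1 / suc n

1/suc-inverse : ∀ n → fromℕℚ (suc n) * 1/suc n ≡ 1ℚ
1/suc-inverse n = ℚ.toℚᵘ-injective (begin
  ℚ.toℚᵘ (fromℕℚ (suc n) * 1/suc n)                ≈⟨ ℚ.toℚᵘ-homo-* (fromℕℚ (suc n)) (1/suc n) ⟩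
  ℚ.toℚᵘ (fromℕℚ (suc n)) ℚᵘ.* ℚ.toℚᵘ (1/suc n)    ≈⟨ ℚᵘ.*-cong (ℚ.toℚᵘ-fromℚᵘ (ℚᵘ.mkℚᵘ (+ suc n) 0)) (ℚ.toℚᵘ-fromℚᵘ (ℚᵘ.mkℚᵘ (+ 1) n)) ⟩
  ℚᵘ.mkℚᵘ (+ suc n) 0 ℚᵘ.* ℚᵘ.mkℚᵘ (+ 1) n         ≈⟨ ℚᵘ.*≡* (cong (λ k → + suc k) (lemma n)) ⟩
  ℚ.toℚᵘ 1ℚ                                        ∎)
  where
  open ℚᵘ.≃-Reasoning
  lemma : ∀ n → n ℕ.* 1 ℕ.* 1 ≡ n ℕ.+ 0 ℕ.+ 0
  lemma n = trans (ℕ.*-identityʳ _) (trans (ℕ.*-identityʳ n) (sym (trans (ℕ.+-identityʳ _) (ℕ.+-identityʳ n))))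

0<1/suc : ∀ n → 0ℚ < 1/suc n
0<1/suc n = ℚ.positive⁻¹ _ {{ℚ.normalize-pos 1 (suc n)}}

1/suc≤1 : ∀ n → 1/suc n ≤ 1ℚ
1/suc≤1 n = le≡ (trans (cong (_- 1/suc n) (trans (sym (1/suc-inverse n)) (cong (_* 1/suc n) (fromℕℚ-suc n))))
  (solve 2 (λ x y → (con 1ℚ :+ x) :* y :- y := x :* y) refl (fromℕℚ n) (1/suc n)))
  (0≤* (0≤fromℕℚ n) (ℚ.<⇒≤ (0<1/suc n)))

above : ∀ p → ∃[ n ] p ≤ fromℕℚ n
above p@(ℚ.mkℚ n d _) = ℤ.∣ n ∣ , ℚ.toℚᵘ-cancel-≤ (ℚᵘ.≤-respʳ-≃
    (ℚᵘ.≃-sym (ℚ.toℚᵘ-fromℚᵘ (ℚᵘ.mkℚᵘ (+ ℤ.∣ n ∣) 0)))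
    (ℚᵘ.*≤* (bound n)))
  where
  bound : ∀ n → n ℤ.* + 1 ℤ.≤ + ℤ.∣ n ∣ ℤ.* + suc d
  bound (+ n)      = subst₂ ℤ._≤_ (sym (ℤ.*-identityʳ (+ n))) (ℤ.pos-* n (suc d))
                       (ℤ.+≤+ (ℕ.m≤m*n n (suc d)))
  bound ℤ.-[1+ n ] = ℤ.-≤+

archimedean : ∀ p {ε} → 0ℚ < ε → ∃[ n ] p ≤ ε * fromℕℚ n
archimedean p {ε} 0<ε = proj₁ bound , subst (_≤ ε * fromℕℚ (proj₁ bound))
    (trans (solve 3 (λ ε p i → ε :* (p :* i) := p :* (ε :* i)) refl ε p 1/ε)
      (trans (cong (p *_) (ℚ.*-inverseʳ ε {{ε≢0}})) (ℚ.*-identityʳ p)))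
    (ℚ.*-monoˡ-≤-nonNeg ε {{ℚ.nonNegative (ℚ.<⇒≤ 0<ε)}} (proj₂ bound))
  where
  ε≢0 : ℚ.NonZero ε
  ε≢0 = ℚ.>-nonZero 0<ε
  1/ε : ℚ
  1/ε = ℚ.1/_ ε {{ε≢0}}
  bound : ∃[ n ] p * 1/ε ≤ fromℕℚ n
  bound = above (p * 1/ε)

record ℝ : Set₁ where
  field
    Lower Upper     : ℚ → Set
    lower-inhabited : ∃[ q ] Lower q
    upper-inhabited : ∃[ q ] Upper q
    lower-closed    : ∀ {p q} → p < q → Lower q → Lower p
    upper-closed    : ∀ {p q} → p < q → Upper p → Upper q
    lower-open      : ∀ {p} → Lower p → ∃[ q ] p < q × Lower q
    upper-open      : ∀ {q} → Upper q → ∃[ p ] p < q × Upper p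
    disjoint        : ∀ {q} → Lower q → Upper q → ⊥
    located         : ∀ {p q} → p < q → Lower p ⊎ Upper q

open ℝ public

infix 4 _<ℝ_ _≤ℝ_

_<ℝ_ : ℝ → ℝ → Set
x <ℝ y = ∃[ q ] Upper x q × Lower y q

_≤ℝ_ : ℝ → ℝ → Set
x ≤ℝ y = ∀ q → Lower x q → Lower y q

fromℚ : ℚ → ℝ
fromℚ s = record
  { Lower           = _< s
  ; Upper           = s <_
  ; lower-inhabited = s - 1ℚ , p-<p 0<1
  ; upper-inhabited = s + 1ℚ , p<p+ 0<1
  ; lower-closed    = ℚ.<-trans
  ; upper-closed    = λ p<q s<p → ℚ.<-trans s<p p<q
  ; lower-open      = ℚ.<-dense
  ; upper-open      = λ s<q → let m , s<m , m<q = ℚ.<-dense s<q in m , m<q , s<m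
  ; disjoint        = ℚ.<-asym
  ; located         = λ {p} {q} → loc p q
  }
  where
  loc : ∀ p q → p < q → p < s ⊎ s < q
  loc p q p<q with p ℚ.<? s
  ... | yes p<s = inj₁ p<s
  ... | no  p≮s = inj₂ (ℚ.≤-<-trans (ℚ.≮⇒≥ p≮s) p<q)

fromℕ : ℕ → ℝ
fromℕ n = fromℚ (fromℕℚ n)

0ℝ : ℝ
0ℝ = fromℚ 0ℚ

lower<upper : ∀ x {p q} → Lower x p → Upper x q → p < q
lower<upper x {p} {q} lp uq with ℚ.<-cmp p q
... | tri< p<q _ _  = p<q
... | tri≈ _ refl _ = contradiction uq (disjoint x lp)
... | tri> _ _ q<p  = contradiction (upper-closed x q<p uq) (disjoint x lp)

-- A real has rational lower approximations within any ε, all bounded by one M.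
approximate : ∀ x → ∃[ M ] 0ℚ ≤ M × (∀ ε → 0ℚ < ε →
              ∃[ a ] Lower x a × Upper x (a + ε) × - M ≤ a × a ≤ M)
approximate x = M , 0≤M , λ ε 0<ε → finish ε 0<ε
  where
  a₀ b₀ M : ℚ
  a₀ = proj₁ (lower-inhabited x)
  b₀ = proj₁ (upper-inhabited x)
  M  = ℚ.∣ a₀ ∣ + ℚ.∣ b₀ ∣

  La₀ : Lower x a₀
  La₀ = proj₂ (lower-inhabited x)
  Ub₀ : Upper x b₀
  Ub₀ = proj₂ (upper-inhabited x)

  0≤M : 0ℚ ≤ M
  0≤M = 0≤+ (ℚ.0≤∣p∣ a₀) (ℚ.0≤∣p∣ b₀)

  -M≤a₀ : - M ≤ a₀
  -M≤a₀ = le≡ (solve 3 (λ a u v → a :- (:- (u :+ v)) := (a :- (:- u)) :+ v) refl a₀ ℚ.∣ a₀ ∣ ℚ.∣ b₀ ∣)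
    (0≤+ (el (-∣∣≤ a₀)) (ℚ.0≤∣p∣ b₀))

  b₀≤M : b₀ ≤ M
  b₀≤M = le≡ (solve 3 (λ b u v → (u :+ v) :- b := (v :- b) :+ u) refl b₀ ℚ.∣ a₀ ∣ ℚ.∣ b₀ ∣)
    (0≤+ (el (≤∣∣ b₀)) (ℚ.0≤∣p∣ a₀))

  module _ (δ : ℚ) (0<δ : 0ℚ < δ) where
    walk : ∀ n a → Lower x a → a₀ ≤ a → b₀ ≤ a + δ * fromℕℚ n →
           ∃[ a ] Lower x a × Upper x (a + δ + δ) × a₀ ≤ a
    walk zero a La a₀≤a h = contradiction (ℚ.<-≤-trans (lower<upper x La Ub₀) b₀≤a) (ℚ.<-irrefl refl)
      where
      b₀≤a : b₀ ≤ a
      b₀≤a = subst (b₀ ≤_) (trans (cong (λ y → a + y) (ℚ.*-zeroʳ δ)) (ℚ.+-identityʳ a)) h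
    walk (suc n) a La a₀≤a h = step (located x (p<p+ 0<δ))
      where
      shift : a + δ * fromℕℚ (suc n) ≡ (a + δ) + δ * fromℕℚ n
      shift = trans (cong (λ y → a + δ * y) (fromℕℚ-suc n))
        (solve 3 (λ a δ n → a :+ δ :* (con 1ℚ :+ n) := (a :+ δ) :+ δ :* n) refl a δ (fromℕℚ n))

      step : Lower x (a + δ) ⊎ Upper x (a + δ + δ) → ∃[ a ] Lower x a × Upper x (a + δ + δ) × a₀ ≤ a
      step (inj₂ U) = a , La , U , a₀≤a
      step (inj₁ L) = walk n (a + δ) L (ℚ.≤-trans a₀≤a (ℚ.<⇒≤ (p<p+ 0<δ))) (subst (b₀ ≤_) shift h)

  finish : ∀ ε → 0ℚ < ε → ∃[ a ] Lower x a × Upper x (a + ε) × - M ≤ a × a ≤ M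
  finish ε 0<ε =
    let δ     = ½ * ε
        0<δ   = 0<* 0<½ 0<ε
        n , h = archimedean (b₀ - a₀) 0<δ
        a , La , U , a₀≤a = walk δ 0<δ n a₀ La₀ ℚ.≤-refl
          (le≡ (solve 3 (λ a b y → (a :+ y) :- b := y :- (b :- a)) refl a₀ b₀ (δ * fromℕℚ n)) (el h))
    in a , La , subst (Upper x) (solve 2 (λ a ε → a :+ con ½ :* ε :+ con ½ :* ε := a :+ ε) refl a ε) U
       , ℚ.≤-trans -M≤a₀ a₀≤a , ℚ.≤-trans (ℚ.<⇒≤ (lower<upper x La Ub₀)) b₀≤M

cornerMin cornerMax : ℚ → ℚ → ℚ → ℚ → ℚ
cornerMin a b c d = ((a * c) ⊓ (a * d)) ⊓ ((b * c) ⊓ (b * d))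
cornerMax a b c d = ((a * c) ⊔ (a * d)) ⊔ ((b * c) ⊔ (b * d))

-- t ↦ s t is monotone or antitone, so on [c, d] it stays between its end values.
linear-min : ∀ {q s c t d} → c ≤ t → t ≤ d → q < s * c → q < s * d → q < s * t
linear-min {q} {s} {c} {t} {d} c≤t t≤d h k with ℚ.≤-total 0ℚ s
... | inj₁ 0≤s = ℚ.<-≤-trans h (ℚ.*-monoˡ-≤-nonNeg s {{ℚ.nonNegative 0≤s}} c≤t)
... | inj₂ s≤0 = ℚ.<-≤-trans k (ℚ.*-monoˡ-≤-nonPos s {{ℚ.nonPositive s≤0}} t≤d)

linear-max : ∀ {q s c t d} → c ≤ t → t ≤ d → s * c < q → s * d < q → s * t < q
linear-max {q} {s} {c} {t} {d} c≤t t≤d h k with ℚ.≤-total 0ℚ s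
... | inj₁ 0≤s = ℚ.≤-<-trans (ℚ.*-monoˡ-≤-nonNeg s {{ℚ.nonNegative 0≤s}} t≤d) k
... | inj₂ s≤0 = ℚ.≤-<-trans (ℚ.*-monoˡ-≤-nonPos s {{ℚ.nonPositive s≤0}} c≤t) h

<cornerMin : ∀ {q a b c d s t} → a ≤ s → s ≤ b → c ≤ t → t ≤ d → q < cornerMin a b c d → q < s * t
<cornerMin {q} {a} {b} {c} {d} {s} {t} a≤s s≤b c≤t t≤d h =
  subst (q <_) (ℚ.*-comm t s) (linear-min {q} {t} a≤s s≤b
    (subst (q <_) (ℚ.*-comm a t) (linear-min {q} {a} c≤t t≤d
      (ℚ.<-≤-trans hˡ (ℚ.p⊓q≤p (a * c) (a * d))) (ℚ.<-≤-trans hˡ (ℚ.p⊓q≤q (a * c) (a * d)))))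
    (subst (q <_) (ℚ.*-comm b t) (linear-min {q} {b} c≤t t≤d
      (ℚ.<-≤-trans hʳ (ℚ.p⊓q≤p (b * c) (b * d))) (ℚ.<-≤-trans hʳ (ℚ.p⊓q≤q (b * c) (b * d))))))
  where
  hˡ : q < (a * c) ⊓ (a * d)
  hˡ = ℚ.<-≤-trans h (ℚ.p⊓q≤p ((a * c) ⊓ (a * d)) ((b * c) ⊓ (b * d)))
  hʳ : q < (b * c) ⊓ (b * d)
  hʳ = ℚ.<-≤-trans h (ℚ.p⊓q≤q ((a * c) ⊓ (a * d)) ((b * c) ⊓ (b * d)))

cornerMax< : ∀ {q a b c d s t} → a ≤ s → s ≤ b → c ≤ t → t ≤ d → cornerMax a b c d < q → s * t < q
cornerMax< {q} {a} {b} {c} {d} {s} {t} a≤s s≤b c≤t t≤d h =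
  subst (_< q) (ℚ.*-comm t s) (linear-max {q} {t} a≤s s≤b
    (subst (_< q) (ℚ.*-comm a t) (linear-max {q} {a} c≤t t≤d
      (ℚ.≤-<-trans (ℚ.p≤p⊔q (a * c) (a * d)) hˡ) (ℚ.≤-<-trans (ℚ.p≤q⊔p (a * c) (a * d)) hˡ)))
    (subst (_< q) (ℚ.*-comm b t) (linear-max {q} {b} c≤t t≤d
      (ℚ.≤-<-trans (ℚ.p≤p⊔q (b * c) (b * d)) hʳ) (ℚ.≤-<-trans (ℚ.p≤q⊔p (b * c) (b * d)) hʳ))))
  where
  hˡ : (a * c) ⊔ (a * d) < q
  hˡ = ℚ.≤-<-trans (ℚ.p≤p⊔q ((a * c) ⊔ (a * d)) ((b * c) ⊔ (b * d))) h
  hʳ : (b * c) ⊔ (b * d) < q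
  hʳ = ℚ.≤-<-trans (ℚ.p≤q⊔p ((a * c) ⊔ (a * d)) ((b * c) ⊔ (b * d))) h

-- With |a| ≤ M, |c| ≤ N and h ≤ 1, the corner products of [a, a + h] × [c, c + h] all
-- lie within W = (M + N + 1) h of a c; so 2 W < q - p separates them from p or from q.
module Corners
  {p q a c M N h : ℚ} (0≤M : 0ℚ ≤ M) (0≤N : 0ℚ ≤ N)
  (-M≤a : - M ≤ a) (a≤M : a ≤ M) (-N≤c : - N ≤ c) (c≤N : c ≤ N)
  (0≤h : 0ℚ ≤ h) (h≤1 : h ≤ 1ℚ) (W<half : (M + N + 1ℚ) * h < ½ * (q - p))
  where
  b d W m : ℚ
  b = a + h
  d = c + h
  W = (M + N + 1ℚ) * h
  m = ½ * (p + q)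

  0≤M±a : 0ℚ ≤ M - a × 0ℚ ≤ a - - M
  0≤M±a = el a≤M , el -M≤a
  0≤N±c : 0ℚ ≤ N - c × 0ℚ ≤ c - - N
  0≤N±c = el c≤N , el -N≤c

  -- Every corner product lies within W of a * c.
  hi : ∀ {s} → s ≤ a * c + W → a * c ≤ m → s < q
  hi {s} s≤ ac≤m = lt≡
    (solve 5 (λ s k W p q → q :- s := (con ½ :* (q :- p) :- W) :+ (((k :+ W) :- s) :+ (con ½ :* (p :+ q) :- k)))
      refl s (a * c) W p q)
    (0<+ (tl W<half) (0≤+ (el s≤) (el ac≤m)))

  lo : ∀ {s} → a * c - W ≤ s → m < a * c → p < s
  lo {s} ≤s m<ac = lt≡
    (solve 5 (λ s k W p q → s :- p := (con ½ :* (q :- p) :- W) :+ ((s :- (k :- W)) :+ (k :- con ½ :* (p :+ q))))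
      refl s (a * c) W p q)
    (0<+ (tl W<half) (0≤+ (el ≤s) (el (ℚ.<⇒≤ m<ac))))

  max<q : a * c ≤ m → cornerMax a b c d < q
  max<q k = ⊔-< (⊔-< (hi ac≤ k) (hi ad≤ k)) (⊔-< (hi bc≤ k) (hi bd≤ k))
    where
    ac≤ : a * c ≤ a * c + W
    ac≤ = le≡ (solve 5 (λ a c M N h → (a :* c :+ (M :+ N :+ con 1ℚ) :* h) :- a :* c
                                      := (M :+ N :+ con 1ℚ) :* h) refl a c M N h)
          (0≤* (0≤+ (0≤+ 0≤M 0≤N) (ℚ.<⇒≤ 0<1)) 0≤h)
    ad≤ : a * d ≤ a * c + W
    ad≤ = le≡ (solve 5 (λ a c M N h → (a :* c :+ (M :+ N :+ con 1ℚ) :* h) :- a :* (c :+ h)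
                                      := ((M :- a) :+ N :+ con 1ℚ) :* h) refl a c M N h)
          (0≤* (0≤+ (0≤+ (proj₁ 0≤M±a) 0≤N) (ℚ.<⇒≤ 0<1)) 0≤h)
    bc≤ : b * c ≤ a * c + W
    bc≤ = le≡ (solve 5 (λ a c M N h → (a :* c :+ (M :+ N :+ con 1ℚ) :* h) :- (a :+ h) :* c
                                      := (M :+ (N :- c) :+ con 1ℚ) :* h) refl a c M N h)
          (0≤* (0≤+ (0≤+ 0≤M (proj₁ 0≤N±c)) (ℚ.<⇒≤ 0<1)) 0≤h)
    bd≤ : b * d ≤ a * c + W
    bd≤ = le≡ (solve 5 (λ a c M N h → (a :* c :+ (M :+ N :+ con 1ℚ) :* h) :- (a :+ h) :* (c :+ h)
                                      := ((M :- a) :+ (N :- c) :+ (con 1ℚ :- h)) :* h) refl a c M N h)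
          (0≤* (0≤+ (0≤+ (proj₁ 0≤M±a) (proj₁ 0≤N±c)) (el h≤1)) 0≤h)

  p<min : m < a * c → p < cornerMin a b c d
  p<min k = <-⊓ (<-⊓ (lo ≤ac k) (lo ≤ad k)) (<-⊓ (lo ≤bc k) (lo ≤bd k))
    where
    ≤ac : a * c - W ≤ a * c
    ≤ac = le≡ (solve 5 (λ a c M N h → a :* c :- (a :* c :- (M :+ N :+ con 1ℚ) :* h)
                                      := (M :+ N :+ con 1ℚ) :* h) refl a c M N h)
          (0≤* (0≤+ (0≤+ 0≤M 0≤N) (ℚ.<⇒≤ 0<1)) 0≤h)
    ≤ad : a * c - W ≤ a * d
    ≤ad = le≡ (solve 5 (λ a c M N h → a :* (c :+ h) :- (a :* c :- (M :+ N :+ con 1ℚ) :* h)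
                                      := ((a :- (:- M)) :+ N :+ con 1ℚ) :* h) refl a c M N h)
          (0≤* (0≤+ (0≤+ (proj₂ 0≤M±a) 0≤N) (ℚ.<⇒≤ 0<1)) 0≤h)
    ≤bc : a * c - W ≤ b * c
    ≤bc = le≡ (solve 5 (λ a c M N h → (a :+ h) :* c :- (a :* c :- (M :+ N :+ con 1ℚ) :* h)
                                      := (M :+ (c :- (:- N)) :+ con 1ℚ) :* h) refl a c M N h)
          (0≤* (0≤+ (0≤+ 0≤M (proj₂ 0≤N±c)) (ℚ.<⇒≤ 0<1)) 0≤h)
    ≤bd : a * c - W ≤ b * d
    ≤bd = le≡ (solve 5 (λ a c M N h → (a :+ h) :* (c :+ h) :- (a :* c :- (M :+ N :+ con 1ℚ) :* h)
                                      := ((a :- (:- M)) :+ (c :- (:- N)) :+ (con 1ℚ :+ h)) :* h) refl a c M N h)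
          (0≤* (0≤+ (0≤+ (proj₂ 0≤M±a) (proj₂ 0≤N±c)) (0≤+ (ℚ.<⇒≤ 0<1) 0≤h)) 0≤h)

  separate : p < cornerMin a b c d ⊎ cornerMax a b c d < q
  separate = by (a * c ℚ.≤? m)
    where
    by : Dec (a * c ≤ m) → p < cornerMin a b c d ⊎ cornerMax a b c d < q
    by (yes k) = inj₂ (max<q k)
    by (no ¬k) = inj₁ (p<min (ℚ.≰⇒> ¬k))

fine-mesh : ∀ w {e} → 0ℚ < e → ∃[ h ] 0ℚ < h × h ≤ 1ℚ × w * h < e
fine-mesh w {e} 0<e = 1/suc n , 0<1/suc n , 1/suc≤1 n , lt≡
    (trans (cong (_- w * h) (trans (sym (ℚ.*-identityʳ e)) (cong (e *_) unit)))
      (solve 4 (λ e n w h → e :* ((con 1ℚ :+ n) :* h) :- w :* h := e :* h :+ (e :* n :- w) :* h)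
        refl e (fromℕℚ n) w h))
    (0<+ (0<* 0<e (0<1/suc n)) (0≤* (el (proj₂ large)) (ℚ.<⇒≤ (0<1/suc n))))
  where
  large : ∃[ n ] w ≤ e * fromℕℚ n
  large = archimedean w 0<e
  n : ℕ
  n = proj₁ large
  h : ℚ
  h = 1/suc n
  unit : 1ℚ ≡ (1ℚ + fromℕℚ n) * h
  unit = sym (trans (cong (_* h) (sym (fromℕℚ-suc n))) (1/suc-inverse n))

infixl 7 _*ℝ_

-- Interval multiplication: if a < x < b and c < y < d, then x y lies between the
-- extreme corner products.
_*ℝ_ : ℝ → ℝ → ℝ
x *ℝ y = record
  { Lower           = L
  ; Upper           = U
  ; lower-inhabited = cornerMin a₀ b₀ c₀ d₀ - 1ℚ , a₀ , b₀ , c₀ , d₀ , La₀ , Ub₀ , Lc₀ , Ud₀ , p-<p 0<1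
  ; upper-inhabited = cornerMax a₀ b₀ c₀ d₀ + 1ℚ , a₀ , b₀ , c₀ , d₀ , La₀ , Ub₀ , Lc₀ , Ud₀ , p<p+ 0<1
  ; lower-closed    = λ { p<q (a , b , c , d , La , Ub , Lc , Ud , h) →
                          a , b , c , d , La , Ub , Lc , Ud , ℚ.<-trans p<q h }
  ; upper-closed    = λ { p<q (a , b , c , d , La , Ub , Lc , Ud , h) →
                          a , b , c , d , La , Ub , Lc , Ud , ℚ.<-trans h p<q }
  ; lower-open      = λ { (a , b , c , d , La , Ub , Lc , Ud , h) → let m , p<m , m<k = ℚ.<-dense h in
                          m , p<m , a , b , c , d , La , Ub , Lc , Ud , m<k }
  ; upper-open      = λ { (a , b , c , d , La , Ub , Lc , Ud , h) → let m , k<m , m<q = ℚ.<-dense h in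
                          m , m<q , a , b , c , d , La , Ub , Lc , Ud , k<m }
  ; disjoint        = λ {q} → disj q
  ; located         = λ {p} {q} → loc p q
  }
  where
  L U : ℚ → Set
  L q = ∃[ a ] ∃[ b ] ∃[ c ] ∃[ d ] Lower x a × Upper x b × Lower y c × Upper y d × q < cornerMin a b c d
  U q = ∃[ a ] ∃[ b ] ∃[ c ] ∃[ d ] Lower x a × Upper x b × Lower y c × Upper y d × cornerMax a b c d < q

  a₀ b₀ c₀ d₀ : ℚ
  a₀ = proj₁ (lower-inhabited x)
  b₀ = proj₁ (upper-inhabited x)
  c₀ = proj₁ (lower-inhabited y)
  d₀ = proj₁ (upper-inhabited y)
  La₀ : Lower x a₀
  La₀ = proj₂ (lower-inhabited x)
  Ub₀ : Upper x b₀
  Ub₀ = proj₂ (upper-inhabited x)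
  Lc₀ : Lower y c₀
  Lc₀ = proj₂ (lower-inhabited y)
  Ud₀ : Upper y d₀
  Ud₀ = proj₂ (upper-inhabited y)

  ⊔-lower : ∀ z {p q} → Lower z p → Lower z q → Lower z (p ⊔ q)
  ⊔-lower z {p} {q} lp lq with ℚ.⊔-sel p q
  ... | inj₁ e = subst (Lower z) (sym e) lp
  ... | inj₂ e = subst (Lower z) (sym e) lq

  disj : ∀ q → L q → U q → ⊥
  disj q (a , b , c , d , La , Ub , Lc , Ud , h) (a′ , b′ , c′ , d′ , La′ , Ub′ , Lc′ , Ud′ , h′) =
    ℚ.<-asym
      (<cornerMin (ℚ.p≤p⊔q a a′) (ℚ.<⇒≤ (lower<upper x Ls Ub)) (ℚ.p≤p⊔q c c′) (ℚ.<⇒≤ (lower<upper y Lt Ud)) h)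
      (cornerMax< (ℚ.p≤q⊔p a a′) (ℚ.<⇒≤ (lower<upper x Ls Ub′)) (ℚ.p≤q⊔p c c′) (ℚ.<⇒≤ (lower<upper y Lt Ud′)) h′)
    where
    Ls = ⊔-lower x La La′
    Lt = ⊔-lower y Lc Lc′

  loc : ∀ p q → p < q → L p ⊎ U q
  loc p q p<q =
    let M , 0≤M , approxˣ = approximate x
        N , 0≤N , approxʸ = approximate y
        h , 0<h , h≤1 , W<half     = fine-mesh (M + N + 1ℚ) (0<* 0<½ (tl p<q))
        a , La , Ub , -M≤a , a≤M   = approxˣ h 0<h
        c , Lc , Ud , -N≤c , c≤N   = approxʸ h 0<h
    in Sum.map (λ k → a , a + h , c , c + h , La , Ub , Lc , Ud , k)
               (λ k → a , a + h , c , c + h , La , Ub , Lc , Ud , k)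
         (Corners.separate 0≤M 0≤N -M≤a a≤M -N≤c c≤N (ℚ.<⇒≤ 0<h) h≤1 W<half)
Cauchy : (ℕ → ℚ) → Set
Cauchy s = ∀ ε → 0ℚ < ε → ∃[ N ] (∀ m → N ℕ.≤ m → s N - ε ≤ s m × s m ≤ s N + ε)

lim : ∀ s → Cauchy s → ℝ
lim s cauchy = record
  { Lower           = L
  ; Upper           = U
  ; lower-inhabited = let N , h = cauchy 1ℚ 0<1 in
                      s N - 1ℚ - 1ℚ , s N - 1ℚ , p-<p 0<1 , N , λ m N≤m → proj₁ (h m N≤m)
  ; upper-inhabited = let N , h = cauchy 1ℚ 0<1 in
                      s N + 1ℚ + 1ℚ , s N + 1ℚ , p<p+ 0<1 , N , λ m N≤m → proj₂ (h m N≤m)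
  ; lower-closed    = λ { p<q (y , q<y , h) → y , ℚ.<-trans p<q q<y , h }
  ; upper-closed    = λ { p<q (y , y<p , h) → y , ℚ.<-trans y<p p<q , h }
  ; lower-open      = λ { (y , p<y , h) → let m , p<m , m<y = ℚ.<-dense p<y in m , p<m , y , m<y , h }
  ; upper-open      = λ { (y , y<q , h) → let m , y<m , m<q = ℚ.<-dense y<q in m , m<q , y , y<m , h }
  ; disjoint        = λ { (y , q<y , M , h) (z , z<q , N , k) →
                          ℚ.<-irrefl refl (ℚ.<-≤-trans (ℚ.<-trans z<q q<y)
                            (ℚ.≤-trans (h (M ℕ.⊔ N) (ℕ.m≤m⊔n M N)) (k (M ℕ.⊔ N) (ℕ.m≤n⊔m M N)))) }
  ; located         = λ {p} {q} → loc p q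
  }
  where
  L U : ℚ → Set
  L q = ∃[ y ] q < y × ∃[ N ] (∀ m → N ℕ.≤ m → y ≤ s m)
  U q = ∃[ y ] y < q × ∃[ N ] (∀ m → N ℕ.≤ m → s m ≤ y)

  loc : ∀ p q → p < q → L p ⊎ U q
  loc p q p<q = by (s N ℚ.≤? m)
    where
    m ε : ℚ
    m = ½ * (p + q)
    ε = ½ * (½ * (q - p))
    0<ε : 0ℚ < ε
    0<ε = 0<* 0<½ (0<* 0<½ (tl p<q))
    N : ℕ
    N = proj₁ (cauchy ε 0<ε)
    near : ∀ k → N ℕ.≤ k → s N - ε ≤ s k × s k ≤ s N + ε
    near = proj₂ (cauchy ε 0<ε)
    by : Dec (s N ≤ m) → L p ⊎ U q
    by (yes sN≤m) = inj₂ (s N + ε , lt≡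
      (solve 3 (λ x p q → q :- (x :+ con ½ :* (con ½ :* (q :- p)))
                 := con ½ :* (con ½ :* (q :- p)) :+ (con ½ :* (p :+ q) :- x)) refl (s N) p q)
      (0<+ 0<ε (el sN≤m)) , N , λ k N≤k → proj₂ (near k N≤k))
    by (no sN≰m) = inj₁ (s N - ε , lt≡
      (solve 3 (λ x p q → (x :- con ½ :* (con ½ :* (q :- p))) :- p
                 := con ½ :* (con ½ :* (q :- p)) :+ (x :- con ½ :* (p :+ q))) refl (s N) p q)
      (0<+ 0<ε (el (ℚ.<⇒≤ (ℚ.≰⇒> sN≰m)))) , N , λ k N≤k → proj₁ (near k N≤k))

-- expTerm q j = q ^ j / j !
expTerm : ℚ → ℕ → ℚ
expTerm q zero    = 1ℚ
expTerm q (suc j) = expTerm q j * (q * 1/suc j)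

expSum : ℚ → ℕ → ℚ
expSum q zero    = 0ℚ
expSum q (suc n) = expSum q n + expTerm q n

module ExpCauchy (q : ℚ) where
  M : ℕ
  M = proj₁ (above (ℚ.∣ q ∣ + ℚ.∣ q ∣))

  2∣q∣≤M : ℚ.∣ q ∣ + ℚ.∣ q ∣ ≤ fromℕℚ M
  2∣q∣≤M = proj₂ (above (ℚ.∣ q ∣ + ℚ.∣ q ∣))

  t : ℕ → ℚ
  t j = ℚ.∣ expTerm q j ∣

  0≤t : ∀ j → 0ℚ ≤ t j
  0≤t j = ℚ.0≤∣p∣ (expTerm q j)

  ratio : ∀ j → M ℕ.≤ j → ℚ.∣ q * 1/suc j ∣ ≤ ½
  ratio j M≤j = subst (_≤ ½) (sym abs) (le≡
      (trans (cong (λ u → ½ * u - ℚ.∣ q ∣ * 1/suc j) unit)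
        (solve 3 (λ n q h → con ½ :* ((con 1ℚ :+ n) :* h) :- q :* h := con ½ :* ((n :- (q :+ q)) :* h :+ h))
          refl (fromℕℚ j) ℚ.∣ q ∣ (1/suc j)))
      (0≤* (ℚ.<⇒≤ 0<½) (0≤+ (0≤* (el (ℚ.≤-trans 2∣q∣≤M (fromℕℚ-mono M≤j))) 0≤h) 0≤h)))
    where
    0≤h : 0ℚ ≤ 1/suc j
    0≤h = ℚ.<⇒≤ (0<1/suc j)
    unit : 1ℚ ≡ (1ℚ + fromℕℚ j) * 1/suc j
    unit = sym (trans (cong (_* 1/suc j) (sym (fromℕℚ-suc j))) (1/suc-inverse j))
    abs : ℚ.∣ q * 1/suc j ∣ ≡ ℚ.∣ q ∣ * 1/suc j
    abs = trans (ℚ.∣p*q∣≡∣p∣*∣q∣ q (1/suc j)) (cong (ℚ.∣ q ∣ *_) (ℚ.0≤p⇒∣p∣≡p 0≤h))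

  halves : ∀ j → M ℕ.≤ j → t (suc j) ≤ ½ * t j
  halves j M≤j = le≡
    (trans (cong (λ u → ½ * t j - u) (ℚ.∣p*q∣≡∣p∣*∣q∣ (expTerm q j) (q * 1/suc j)))
      (solve 2 (λ t r → con ½ :* t :- t :* r := t :* (con ½ :- r)) refl (t j) ℚ.∣ q * 1/suc j ∣))
    (0≤* (0≤t j) (el (ratio j M≤j)))

  decay : ∀ i → t (M ℕ.+ i) * (1ℚ + fromℕℚ i) ≤ t M
  decay zero    = ℚ.≤-reflexive (trans (cong (λ j → t j * (1ℚ + 0ℚ)) (ℕ.+-identityʳ M)) (ℚ.*-identityʳ (t M)))
  decay (suc i) = ℚ.≤-trans
    (subst₂ (λ j x → t j * (1ℚ + x) ≤ t (M ℕ.+ i) * (1ℚ + fromℕℚ i)) (sym (ℕ.+-suc M i)) (sym (fromℕℚ-suc i))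
      (le≡ (solve 3 (λ u v n → u :* (con 1ℚ :+ n) :- v :* (con 1ℚ :+ (con 1ℚ :+ n))
                      := (con ½ :* u :- v) :* (con 1ℚ :+ (con 1ℚ :+ n)) :+ con ½ :* (u :* n))
             refl (t (M ℕ.+ i)) (t (suc (M ℕ.+ i))) (fromℕℚ i))
        (0≤+ (0≤* (el (halves (M ℕ.+ i) (ℕ.m≤m+n M i)))
                  (0≤+ (ℚ.<⇒≤ 0<1) (0≤+ (ℚ.<⇒≤ 0<1) (0≤fromℕℚ i))))
             (0≤* (ℚ.<⇒≤ 0<½) (0≤* (0≤t (M ℕ.+ i)) (0≤fromℕℚ i))))))
    (decay i)

  -- |S (N + d) - S N| ≤ 2 (t N - t (N + d)) for N ≥ M.
  tail : ∀ N → M ℕ.≤ N → ∀ d →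
         (0ℚ ≤ (t N + t N) - (t (N ℕ.+ d) + t (N ℕ.+ d)) - (expSum q (N ℕ.+ d) - expSum q N)) ×
         (0ℚ ≤ (t N + t N) - (t (N ℕ.+ d) + t (N ℕ.+ d)) + (expSum q (N ℕ.+ d) - expSum q N))
  tail N M≤N zero rewrite ℕ.+-identityʳ N =
    ℚ.≤-reflexive (solve 2 (λ t s → con 0ℚ := (t :+ t) :- (t :+ t) :- (s :- s)) refl (t N) (expSum q N)) ,
    ℚ.≤-reflexive (solve 2 (λ t s → con 0ℚ := (t :+ t) :- (t :+ t) :+ (s :- s)) refl (t N) (expSum q N))
  tail N M≤N (suc d) rewrite ℕ.+-suc N d =
    subst (0ℚ ≤_)
      (solve 6 (λ tN u v S s x → ((tN :+ tN) :- (u :+ u) :- (s :- S)) :+ ((con ½ :* u :- v) :+ (con ½ :* u :- v) :+ (u :- x))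
                 := (tN :+ tN) :- (v :+ v) :- ((s :+ x) :- S))
        refl (t N) (t (N ℕ.+ d)) (t (suc (N ℕ.+ d))) (expSum q N) (expSum q (N ℕ.+ d)) (expTerm q (N ℕ.+ d)))
      (0≤+ (proj₁ (tail N M≤N d)) (0≤+ (0≤+ half half) (el (≤∣∣ (expTerm q (N ℕ.+ d)))))) ,
    subst (0ℚ ≤_)
      (solve 6 (λ tN u v S s x → ((tN :+ tN) :- (u :+ u) :+ (s :- S)) :+ ((con ½ :* u :- v) :+ (con ½ :* u :- v) :+ (x :- (:- u)))
                 := (tN :+ tN) :- (v :+ v) :+ ((s :+ x) :- S))
        refl (t N) (t (N ℕ.+ d)) (t (suc (N ℕ.+ d))) (expSum q N) (expSum q (N ℕ.+ d)) (expTerm q (N ℕ.+ d)))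
      (0≤+ (proj₂ (tail N M≤N d)) (0≤+ (0≤+ half half) (el (-∣∣≤ (expTerm q (N ℕ.+ d))))))
    where
    half : 0ℚ ≤ ½ * t (N ℕ.+ d) - t (suc (N ℕ.+ d))
    half = el (halves (N ℕ.+ d) (ℕ.≤-trans M≤N (ℕ.m≤m+n N d)))

  cauchy : Cauchy (expSum q)
  cauchy ε 0<ε = N , λ m N≤m → close m (ℕ.m≤n⇒∃[o]m+o≡n N≤m)
    where
    large : ∃[ i ] t M ≤ ½ * ε * fromℕℚ i
    large = archimedean (t M) (0<* 0<½ 0<ε)
    i N : ℕ
    i = proj₁ large
    N = M ℕ.+ i
    M≤N : M ℕ.≤ N
    M≤N = ℕ.m≤m+n M i
    tN≤ : t N ≤ ½ * ε
    tN≤ = ℚ.*-cancelʳ-≤-pos (1ℚ + fromℕℚ i) {{ℚ.positive (0<+ 0<1 (0≤fromℕℚ i))}}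
      (ℚ.≤-trans (decay i) (ℚ.≤-trans (proj₂ large)
        (le≡ (solve 2 (λ e n → e :* (con 1ℚ :+ n) :- e :* n := e) refl (½ * ε) (fromℕℚ i)) (ℚ.<⇒≤ (0<* 0<½ 0<ε)))))
    close : ∀ m → ∃[ d ] N ℕ.+ d ≡ m → expSum q N - ε ≤ expSum q m × expSum q m ≤ expSum q N + ε
    close m (d , refl) =
      le≡ (solve 5 (λ S s e u v → s :- (S :- e) := ((u :+ u) :- (v :+ v) :+ (s :- S))
                       :+ ((con ½ :* e :- u) :+ (con ½ :* e :- u) :+ (v :+ v)))
            refl (expSum q N) (expSum q (N ℕ.+ d)) ε (t N) (t (N ℕ.+ d)))
          (0≤+ (proj₂ (tail N M≤N d)) slack) ,
      le≡ (solve 5 (λ S s e u v → (S :+ e) :- s := ((u :+ u) :- (v :+ v) :- (s :- S))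
                       :+ ((con ½ :* e :- u) :+ (con ½ :* e :- u) :+ (v :+ v)))
            refl (expSum q N) (expSum q (N ℕ.+ d)) ε (t N) (t (N ℕ.+ d)))
          (0≤+ (proj₁ (tail N M≤N d)) slack)
      where
      slack : 0ℚ ≤ (½ * ε - t N) + (½ * ε - t N) + (t (N ℕ.+ d) + t (N ℕ.+ d))
      slack = 0≤+ (0≤+ (el tN≤) (el tN≤)) (0≤+ (0≤t (N ℕ.+ d)) (0≤t (N ℕ.+ d)))

exp : ℚ → ℝ
exp q = lim (expSum q) (ExpCauchy.cauchy q)

e : ℝ
e = exp 1ℚ

expTerm-mono : ∀ {p q} → 0ℚ ≤ p → p ≤ q → ∀ j → 0ℚ ≤ expTerm p j × expTerm p j ≤ expTerm q j
expTerm-mono 0≤p p≤q zero = ℚ.<⇒≤ 0<1 , ℚ.≤-refl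
expTerm-mono {p} {q} 0≤p p≤q (suc j) =
  0≤* 0≤u (0≤* 0≤p 0≤h) ,
  le≡ (solve 5 (λ u v p q h → v :* (q :* h) :- u :* (p :* h)
                  := (v :- u) :* (((q :- p) :+ p) :* h) :+ u :* ((q :- p) :* h))
        refl (expTerm p j) (expTerm q j) p q (1/suc j))
      (0≤+ (0≤* (el u≤v) (0≤* (0≤+ (el p≤q) 0≤p) 0≤h)) (0≤* 0≤u (0≤* (el p≤q) 0≤h)))
  where
  0≤u : 0ℚ ≤ expTerm p j
  0≤u = proj₁ (expTerm-mono 0≤p p≤q j)
  u≤v : expTerm p j ≤ expTerm q j
  u≤v = proj₂ (expTerm-mono 0≤p p≤q j)
  0≤h : 0ℚ ≤ 1/suc j
  0≤h = ℚ.<⇒≤ (0<1/suc j)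

expSum-gap : ∀ {p q} → 0ℚ ≤ p → p ≤ q → ∀ d → 0ℚ ≤ (expSum q (2 ℕ.+ d) - expSum p (2 ℕ.+ d)) - (q - p)
expSum-gap {p} {q} 0≤p p≤q zero = ℚ.≤-reflexive
  (solve 2 (λ p q → con 0ℚ := ((con 0ℚ :+ con 1ℚ :+ con 1ℚ :* (q :* con 1ℚ))
                       :- (con 0ℚ :+ con 1ℚ :+ con 1ℚ :* (p :* con 1ℚ))) :- (q :- p)) refl p q)
expSum-gap {p} {q} 0≤p p≤q (suc d) = subst (0ℚ ≤_)
  (solve 5 (λ s u x y g → ((u :- s) :- g) :+ (y :- x) := ((u :+ y) :- (s :+ x)) :- g)
    refl (expSum p (2 ℕ.+ d)) (expSum q (2 ℕ.+ d)) (expTerm p (2 ℕ.+ d)) (expTerm q (2 ℕ.+ d)) (q - p))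
  (0≤+ (expSum-gap 0≤p p≤q d) (el (proj₂ (expTerm-mono 0≤p p≤q (2 ℕ.+ d)))))

expSum-gap′ : ∀ {p q} → 0ℚ ≤ p → p ≤ q → ∀ m → 2 ℕ.≤ m → q - p ≤ expSum q m - expSum p m
expSum-gap′ 0≤p p≤q (suc (suc d)) (ℕ.s≤s (ℕ.s≤s _)) = le (expSum-gap 0≤p p≤q d)

exp-mono : ∀ {p q} → 0ℚ ≤ p → p < q → exp p <ℝ exp q
exp-mono {p} {q} 0≤p p<q = expSum p N + ε + ε
  , (expSum p N + ε , p<p+ 0<ε , N , λ m N≤m → proj₂ (near m N≤m))
  , (expSum p N + ε + ε + ε , p<p+ 0<ε , N ℕ.⊔ 2 , λ m k≤m →
      let near≤ = proj₁ (near m (ℕ.≤-trans (ℕ.m≤m⊔n N 2) k≤m))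
          gap   = expSum-gap′ 0≤p (ℚ.<⇒≤ p<q) m (ℕ.≤-trans (ℕ.m≤n⊔m N 2) k≤m)
      in le≡ (solve 5 (λ S s u p q → u :- (S :+ con ½ :* (con ½ :* (q :- p)) :+ con ½ :* (con ½ :* (q :- p)) :+ con ½ :* (con ½ :* (q :- p)))
                        := (s :- (S :- con ½ :* (con ½ :* (q :- p)))) :+ ((u :- s) :- (q :- p)))
               refl (expSum p N) (expSum p m) (expSum q m) p q)
             (0≤+ (el near≤) (el gap)))
  where
  ε : ℚ
  ε = ½ * (½ * (q - p))
  0<ε : 0ℚ < ε
  0<ε = 0<* 0<½ (0<* 0<½ (tl p<q))
  N : ℕ
  N = proj₁ (ExpCauchy.cauchy p ε 0<ε)
  near : ∀ k → N ℕ.≤ k → expSum p N - ε ≤ expSum p k × expSum p k ≤ expSum p N + ε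
  near = proj₂ (ExpCauchy.cauchy p ε 0<ε)

expSum-nonNeg : ∀ m → 0ℚ ≤ expSum 0ℚ m
expSum-nonNeg zero    = ℚ.≤-refl
expSum-nonNeg (suc m) = 0≤+ (expSum-nonNeg m) (proj₁ (expTerm-mono ℚ.≤-refl ℚ.≤-refl m))

exp-unbounded : ∀ y → ∃[ q ] 0ℚ ≤ q × Lower (exp q) y
exp-unbounded y = q , 0≤q , q , y<q , 2 , λ m 2≤m →
    le≡ (solve 3 (λ q s u → u :- q := ((u :- s) :- (q :- con 0ℚ)) :+ s) refl q (expSum 0ℚ m) (expSum q m))
        (0≤+ (el (expSum-gap′ ℚ.≤-refl 0≤q m 2≤m)) (expSum-nonNeg m))
  where
  q : ℚ
  q = (y + 1ℚ) ⊔ 0ℚ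
  0≤q : 0ℚ ≤ q
  0≤q = ℚ.p≤q⊔p (y + 1ℚ) 0ℚ
  y<q : y < q
  y<q = ℚ.<-≤-trans (p<p+ 0<1) (ℚ.p≤p⊔q (y + 1ℚ) 0ℚ)

-- For f strictly increasing and unbounded on [0, ∞), the real sup {q ≥ 0 : f q < x},
-- read as 0 when x ≤ f 0.  For x ≥ f 0 and continuous f this is the y ≥ 0 with f y = x.
inverse : (f : ℚ → ℝ) → (∀ {p q} → 0ℚ ≤ p → p < q → f p <ℝ f q) →
          (∀ y → ∃[ q ] 0ℚ ≤ q × Lower (f q) y) → ℝ → ℝ
inverse f f-mono f-unbounded x = record
  { Lower           = L
  ; Upper           = U
  ; lower-inhabited = - 1ℚ , inj₁ (ℚ.negative⁻¹ (- 1ℚ))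
  ; upper-inhabited = let y , Uy = upper-inhabited x
                          q , 0≤q , Ly = f-unbounded y
                      in q + 1ℚ , q , 0≤q , p<p+ 0<1 , y , Uy , Ly
  ; lower-closed    = λ { p<q (inj₁ q<0) → inj₁ (ℚ.<-trans p<q q<0)
                        ; p<q (inj₂ (s , q<s , h)) → inj₂ (s , ℚ.<-trans p<q q<s , h) }
  ; upper-closed    = λ { p<q (s , 0≤s , s<p , h) → s , 0≤s , ℚ.<-trans s<p p<q , h }
  ; lower-open      = λ { (inj₁ p<0) → let m , p<m , m<0 = ℚ.<-dense p<0 in m , p<m , inj₁ m<0
                        ; (inj₂ (s , p<s , h)) → let m , p<m , m<s = ℚ.<-dense p<s in m , p<m , inj₂ (s , m<s , h) }
  ; upper-open      = λ { (s , 0≤s , s<q , h) → let m , s<m , m<q = ℚ.<-dense s<q in m , m<q , s , 0≤s , s<m , h }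
  ; disjoint        = λ { (inj₁ q<0) (s , 0≤s , s<q , _) → ℚ.<-irrefl refl (ℚ.≤-<-trans 0≤s (ℚ.<-trans s<q q<0))
                        ; (inj₂ (t , q<t , u , Uft , Lx)) (s , 0≤s , s<q , v , Ux , Lfs) →
                            let w , Ufs , Lft = f-mono 0≤s (ℚ.<-trans s<q q<t) in
                            ℚ.<-irrefl refl (ℚ.<-trans (lower<upper x Lx Ux)
                              (ℚ.<-trans (lower<upper (f s) Lfs Ufs) (lower<upper (f t) Lft Uft))) }
  ; located         = λ {p} {q} → loc p q
  }
  where
  L U : ℚ → Set
  L q = q < 0ℚ ⊎ (∃[ s ] q < s × f s <ℝ x)
  U q = ∃[ s ] 0ℚ ≤ s × s < q × x <ℝ f s

  loc : ∀ p q → p < q → L p ⊎ U q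
  loc p q p<q = by (p ℚ.<? 0ℚ)
    where
    by : Dec (p < 0ℚ) → L p ⊎ U q
    by (yes p<0) = inj₁ (inj₁ p<0)
    by (no p≮0) =
      let s , p<s , s<q = ℚ.<-dense p<q
          t , s<t , t<q = ℚ.<-dense s<q
          0≤s = ℚ.≤-trans (ℚ.≮⇒≥ p≮0) (ℚ.<⇒≤ p<s)
          0≤t = ℚ.≤-trans 0≤s (ℚ.<⇒≤ s<t)
          w , Ufs , Lft = f-mono 0≤s s<t
          z , w<z , Lz  = lower-open (f t) Lft
      in Sum.map (λ Lw → inj₂ (s , p<s , w , Ufs , Lw)) (λ Uz → t , 0≤t , t<q , z , Uz , Lz) (located x w<z)

-- The natural logarithm of n ≥ 1, and log 0 = 0.
log : ℕ → ℝ
log n = inverse exp exp-mono exp-unbounded (fromℕ n)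

^-nonNeg : ∀ {p} m → 0ℚ ≤ p → 0ℚ ≤ p ^ m
^-nonNeg zero    0≤p = ℚ.<⇒≤ 0<1
^-nonNeg (suc m) 0≤p = 0≤* 0≤p (^-nonNeg m 0≤p)

^-mono : ∀ {p q} m → 0ℚ ≤ p → p < q → p ^ suc m < q ^ suc m
^-mono {p} {q} zero 0≤p p<q = subst₂ _<_ (sym (ℚ.*-identityʳ p)) (sym (ℚ.*-identityʳ q)) p<q
^-mono {p} {q} (suc m) 0≤p p<q = lt≡
  (solve 4 (λ p q u v → q :* v :- p :* u := ((q :- p) :* (v :- u) :+ ((q :- p) :* u :+ p :* (v :- u))))
    refl p q (p ^ suc m) (q ^ suc m))
  (0<+ (0<* (tl p<q) (tl ih)) (0≤+ (0≤* (el (ℚ.<⇒≤ p<q)) (^-nonNeg (suc m) 0≤p)) (0≤* 0≤p (el (ℚ.<⇒≤ ih)))))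
  where
  ih : p ^ suc m < q ^ suc m
  ih = ^-mono m 0≤p p<q

^-≥ : ∀ {q} m → 1ℚ ≤ q → q ≤ q ^ suc m × 1ℚ ≤ q ^ m
^-≥ {q} zero    1≤q = ℚ.≤-reflexive (sym (ℚ.*-identityʳ q)) , ℚ.≤-refl
^-≥ {q} (suc m) 1≤q = le≡ (solve 2 (λ q u → q :* u :- q := ((q :- con 1ℚ) :+ con 1ℚ) :* (u :- con 1ℚ)) refl q (q ^ suc m))
    (0≤* (0≤+ (el 1≤q) (ℚ.<⇒≤ 0<1)) (el 1≤)) , 1≤
  where
  1≤ : 1ℚ ≤ q ^ suc m
  1≤ = ℚ.≤-trans 1≤q (proj₁ (^-≥ m 1≤q))

power-mono : ∀ m .{{_ : NonZero m}} {p q} → 0ℚ ≤ p → p < q → fromℚ (p ^ m) <ℝ fromℚ (q ^ m)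
power-mono (suc m) 0≤p p<q = ℚ.<-dense (^-mono m 0≤p p<q)

power-unbounded : ∀ m .{{_ : NonZero m}} y → ∃[ q ] 0ℚ ≤ q × Lower (fromℚ (q ^ m)) y
power-unbounded (suc m) y = q , ℚ.≤-trans (ℚ.<⇒≤ 0<1) 1≤q , ℚ.<-≤-trans y<q (proj₁ (^-≥ m 1≤q))
  where
  q : ℚ
  q = (y + 1ℚ) ⊔ 1ℚ
  1≤q : 1ℚ ≤ q
  1≤q = ℚ.p≤q⊔p (y + 1ℚ) 1ℚ
  y<q : y < q
  y<q = ℚ.<-≤-trans (p<p+ 0<1) (ℚ.p≤p⊔q (y + 1ℚ) 1ℚ)

-- The m-th root of x ≥ 0, and 0 for x ≤ 0.
root : (m : ℕ) .{{_ : NonZero m}} → ℝ → ℝ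
root m = inverse (λ q → fromℚ (q ^ m)) (power-mono m) (power-unbounded m)

pred-nonZero : ∀ r → .{{NonTrivial r}} → NonZero (ℕ.pred r)
pred-nonZero (suc (suc r)) = _

record Hypergraph (n : ℕ) : Set where
  field
    edges  : List (Subset n)
    simple : Unique edges

open Hypergraph public

degree : ∀ {n} → Hypergraph n → Fin n → ℕ
degree H v = length (filter (v ∈?_) (edges H))

maxDegree : ∀ {n} → Hypergraph n → ℕ
maxDegree {n} H = max 0 (map (degree H) (allFin n))

Uniform : ∀ {n} → ℕ → Hypergraph n → Set
Uniform r H = All (λ E → ∣ E ∣ ≡ r) (edges H)

Linear : ∀ {n} → Hypergraph n → Set
Linear H = ∀ u v → u ≢ v → ∀ {E F} → E List.∈ edges H → F List.∈ edges H →
           u ∈ E → v ∈ E → u ∈ F → v ∈ F → E ≡ F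

ListAssignment : ℕ → ℕ → Set
ListAssignment n σ = Vec (Subset σ) n

Monochromatic : ∀ {n σ} → Vec (Fin σ) n → Subset n → Set
Monochromatic φ E = ∃[ c ] (∀ v → v ∈ E → lookup φ v ≡ c)

ProperColoring : ∀ {n σ} → Hypergraph n → ListAssignment n σ → Vec (Fin σ) n → Set
ProperColoring H L φ = (∀ v → lookup φ v ∈ lookup L v) × All (λ E → ¬ Monochromatic φ E) (edges H)

Colorable : ∀ {n σ} → Hypergraph n → ListAssignment n σ → Set
Colorable H L = ∃[ φ ] ProperColoring H L φ

∃Vec? : ∀ {σ} n {P : Vec (Fin σ) n → Set} → Decidable P → Dec (∃ P)
∃Vec? zero    P? = map′ (λ p → [] , p) (λ { ([] , p) → p }) (P? [])
∃Vec? (suc n) P? = map′ (λ { (c , φ , p) → c ∷ φ , p }) (λ { (c ∷ φ , p) → c , φ , p })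
                     (Fin.any? λ c → ∃Vec? n (λ φ → P? (c ∷ φ)))

colorable? : ∀ {n σ} (H : Hypergraph n) → Decidable (Colorable {n} {σ} H)
colorable? {n} H L = ∃Vec? n λ φ →
  Fin.all? (λ v → lookup φ v ∈? lookup L v) ×-dec
  All.all? (λ E → ¬? (Fin.any? λ c → Fin.all? λ v → (v ∈? E) →-dec (lookup φ v Fin.≟ c))) (edges H)

-- A finite distribution lists weighted outcomes.
Dist : Set → Set
Dist A = List (ℚ × A)

-- Uniform on the entries of a list without repetitions.
uniform : ∀ {A} → List A → Dist A
uniform []       = []
uniform (x ∷ xs) = map (1/suc (length xs) ,_) (x ∷ xs)

-- n independent samples.
independent : ∀ {A} n → Dist A → Dist (Vec A n)
independent zero    μ = (1ℚ , []) ∷ []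
independent (suc n) μ = cartesianProductWith (λ { (p , x) (q , xs) → p * q , x ∷ xs }) μ (independent n μ)

Pr : ∀ {A} {P : A → Set} → Decidable P → Dist A → ℚ
Pr P? μ = foldr (λ w s → proj₁ w + s) 0ℚ (filter (λ w → P? (proj₂ w)) μ)

subsets : ∀ n → List (Subset n)
subsets zero    = [] ∷ []
subsets (suc n) = map (outside ∷_) (subsets n) ++ map (inside ∷_) (subsets n)

subsetsOfSize : ∀ n → ℕ → List (Subset n)
subsetsOfSize n k = filter (λ S → ∣ S ∣ ℕ.≟ k) (subsets n)

randomListAssignment : (n k σ : ℕ) → Dist (ListAssignment n σ)
randomListAssignment n k σ = independent n (uniform (subsetsOfSize σ k))

infix 4 _⟶_

_⟶_ : (ℕ → ℚ) → ℚ → Set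
s ⟶ a = ∀ ε → 0ℚ < ε → ∃[ N ] (∀ n → N ℕ.≤ n → ℚ.∣ s n - a ∣ < ε)

{-# OPTIONS --safe #-}

-- Call a colour c ∈ L(v) bad at v when it lies in all other lists of at least M edges at v,
-- where M is about twice the mean.  By linearity the edges at v are otherwise disjoint, so
-- the expectation of Σ_{S ⊆ L(v)} z^|S| 2^(number of incidences of S with these edges)
-- factorises; for z = (9/16)^M it is at most 2^k, while k/2 bad colours make it at least
-- (9/8)^(M k / 2).  As M k / 2 is at least of order k^r, hence a large multiple of log n, a union
-- bound leaves at least k/2 good colours at every vertex.
-- From lists of ℓ ≥ k/2 good colours, each of colour degree at most D with
-- ℓ^(r-1) ≥ (1 + 1/(r-1))^(r-1) r D, a random colouring is proper with positive probability, by
-- Rosenfeld's counting argument; here (1 + 1/(r-1))^(r-1) ≤ e gives the constant e r, one factor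
-- 2^(r-1) comes from halving the lists and the last factor 2 from M.

module Submission where

open import Algebra.Bundles using (CommutativeRing)
import Algebra.Properties.CommutativeSemiring.Exp as Exp
open import Data.Bool using (true; false; if_then_else_)
open import Data.Empty using () renaming (⊥ to Empty)
open import Data.Fin using (Fin; zero; suc)
import Data.Fin.Properties as Fin
open import Data.Fin.Subset using (Subset; inside; outside; _∈_; _∉_; ∣_∣; _∩_; ∁; ⊤; ⊥; ⁅_⁆; _⊆_) renaming (_-_ to _∖_)
open import Data.Fin.Subset.Properties
  using (_∈?_; _⊆?_; ∈⊤; ∣p∣≤n; ∣⊥∣≡0; ∣∁p∣≡n∸∣p∣; ∩-identityʳ; ∩-assoc; drop-∷-⊆; p─⊥≡p; p─q⊆p; p∩q⊆p; p⊆q⇒∣p∣≤∣q∣;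
         x∈p∩q⁺; x∈p∩q⁻; x∈∁p⇒x∉p; x∈p∧x≢y⇒x∈p-y; x∈p⇒∣p-x∣<∣p∣)
open import Data.Integer using (+_)
open import Data.List using (List; []; _∷_; _++_; length; map; filter; foldr; allFin; cartesianProductWith)
open import Data.List.Extrema.Nat using (xs≤max)
open import Data.List.Membership.Propositional using (find; lose) renaming (_∈_ to _∈ₗ_)
open import Data.List.Membership.Propositional.Properties
  using (∈-++⁺ˡ; ∈-++⁺ʳ; ∈-map⁺; ∈-map⁻; ∈-allFin; ∈-filter⁺; ∈-filter⁻)
import Data.List.Properties as List
open import Data.List.Relation.Unary.All as All using (All; []; _∷_)
open import Data.List.Relation.Unary.AllPairs as AllPairs using (AllPairs; []; _∷_)
import Data.List.Relation.Unary.AllPairs.Properties as AllPairs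
open import Data.List.Relation.Unary.Any using (Any; any?; here; there)
import Data.List.Relation.Unary.Unique.Propositional.Properties as Unique
open import Data.Nat as ℕ using (ℕ; zero; suc; NonZero; NonTrivial; nonTrivial⇒nonZero)
open import Data.Nat.Combinatorics using (nCk+nC[k+1]≡[n+1]C[k+1]; nC1≡n; k>n⇒nCk≡0) renaming (_C_ to _choose_)
open import Data.Nat.DivMod using (m/n*n≤m; m≡m%n+[m/n]*n; m%n<n)
open import Data.Nat.ListAction using (sum)
import Data.Nat.Properties as ℕ
open import Algebra.Properties.CommutativeSemigroup ℕ.+-commutativeSemigroup using (x∙yz≈y∙xz)
open import Data.Product using (∃-syntax; _×_; _,_; proj₁; proj₂)
open import Data.Rational as ℚ using (ℚ; 0ℚ; 1ℚ; _<_; _≤_; _+_; _*_; _-_; -_)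
import Data.Rational.Properties as ℚ
open import Data.Rational.Solver using (module +-*-Solver)
open import Data.Sum using (_⊎_; inj₁; inj₂)
open import Data.Vec as Vec using (Vec; []; _∷_; lookup; replicate; here; there)
open import Data.Vec.Properties using (lookup∘tabulate; lookup-replicate; lookup-map; []=⇒lookup; lookup⇒[]=)
open import Function using (_∘_)
open import Relation.Binary.PropositionalEquality
open import Relation.Nullary using (¬_; Dec; yes; no; does; contradiction; ¬?; _→-dec_; _×-dec_)
open import Relation.Nullary.Decidable using (dec-true; toWitness)
open import Relation.Unary using (Decidable)
open import Defs

open +-*-Solver using (solve; con; _:+_; _:*_; _:-_; :-_; _:=_)
open Exp (CommutativeRing.commutativeSemiring ℚ.+-*-commutativeRing) using (_^_; ^-homo-*; ^-assocʳ; ^-distrib-*)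

-- Arithmetic and finite sums of rationals

-- A single colour may be bad with probability of order exp (- c k^(r-1)), far too large for a union
-- bound over n vertices when k is near (log n)^(1/r). Only many bad colours at one vertex, of
-- probability about exp (- c k^r), are rare enough, so one moment has to control many colours at
-- once, although the colours of a random k-set are dependent. The sum over S guesses the set of bad
-- colours; guessing costs the factor 2^k, which is harmless because r ≥ 2 and k tends to infinity.
-- The dependence is harmless because a k-set contains a given T with at most the independent
-- probability (k/σ)^|T|, and the moment expands in these events with nonnegative coefficients. The
-- real hypotheses are met only through rational members of cuts: they become (2 r)^r Δ ≤ ((r-1)
-- σ)^(r-1) and n ≤ (17/16)^T, and exp occurs only through its partial sums.

0≤1 : 0ℚ ≤ 1ℚ
0≤1 = ℚ.<⇒≤ 0<1

*-monoˡ : ∀ {p q s} → 0ℚ ≤ s → p ≤ q → s * p ≤ s * q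
*-monoˡ {s = s} 0≤s = ℚ.*-monoˡ-≤-nonNeg s {{ℚ.nonNegative 0≤s}}

*-monoʳ : ∀ {p q s} → 0ℚ ≤ s → p ≤ q → p * s ≤ q * s
*-monoʳ {s = s} 0≤s = ℚ.*-monoʳ-≤-nonNeg s {{ℚ.nonNegative 0≤s}}

*-mono : ∀ {p q s t} → 0ℚ ≤ s → 0ℚ ≤ q → p ≤ q → s ≤ t → p * s ≤ q * t
*-mono 0≤s 0≤q p≤q s≤t = ℚ.≤-trans (*-monoʳ 0≤s p≤q) (*-monoˡ 0≤q s≤t)

*-cancelʳ : ∀ {p q s} → 0ℚ < s → p * s ≤ q * s → p ≤ q
*-cancelʳ {s = s} 0<s = ℚ.*-cancelʳ-≤-pos s {{ℚ.positive 0<s}}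

*-cancelˡ : ∀ {p q s} → 0ℚ < s → s * p ≤ s * q → p ≤ q
*-cancelˡ {s = s} 0<s = ℚ.*-cancelˡ-≤-pos s {{ℚ.positive 0<s}}

≤* : ∀ {p q} → 0ℚ ≤ p → 1ℚ ≤ q → p ≤ p * q
≤* {p} {q} 0≤p 1≤q = subst (_≤ p * q) (ℚ.*-identityʳ p) (*-monoˡ 0≤p 1≤q)

^-positive : ∀ {p} n → 0ℚ < p → 0ℚ < p ^ n
^-positive zero    0<p = 0<1
^-positive (suc n) 0<p = 0<* 0<p (^-positive n 0<p)

^-monoˡ-≤ : ∀ {p q} n → 0ℚ ≤ p → p ≤ q → p ^ n ≤ q ^ n
^-monoˡ-≤ zero    0≤p p≤q = ℚ.≤-refl
^-monoˡ-≤ (suc n) 0≤p p≤q =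
  *-mono (^-nonNeg n 0≤p) (ℚ.≤-trans 0≤p p≤q) p≤q (^-monoˡ-≤ n 0≤p p≤q)

^-monoʳ-≤ : ∀ {p m n} → 1ℚ ≤ p → m ℕ.≤ n → p ^ m ≤ p ^ n
^-monoʳ-≤ {p} {n = n} 1≤p ℕ.z≤n = proj₂ (^-≥ n 1≤p)
^-monoʳ-≤ 1≤p (ℕ.s≤s m≤n) = *-monoˡ (ℚ.≤-trans 0≤1 1≤p) (^-monoʳ-≤ 1≤p m≤n)

1^ : ∀ n → 1ℚ ^ n ≡ 1ℚ
1^ zero    = refl
1^ (suc n) = trans (ℚ.*-identityˡ _) (1^ n)

fromℕℚ-+ : ∀ m n → fromℕℚ (m ℕ.+ n) ≡ fromℕℚ m + fromℕℚ n
fromℕℚ-+ zero    n = sym (ℚ.+-identityˡ (fromℕℚ n))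
fromℕℚ-+ (suc m) n = begin
  fromℕℚ (suc (m ℕ.+ n))         ≡⟨ fromℕℚ-suc (m ℕ.+ n) ⟩
  1ℚ + fromℕℚ (m ℕ.+ n)          ≡⟨ cong (λ x → 1ℚ + x) (fromℕℚ-+ m n) ⟩
  1ℚ + (fromℕℚ m + fromℕℚ n)     ≡⟨ ℚ.+-assoc 1ℚ (fromℕℚ m) (fromℕℚ n) ⟨
  1ℚ + fromℕℚ m + fromℕℚ n       ≡⟨ cong (_+ fromℕℚ n) (fromℕℚ-suc m) ⟨
  fromℕℚ (suc m) + fromℕℚ n      ∎
  where open ≡-Reasoning

fromℕℚ-* : ∀ m n → fromℕℚ (m ℕ.* n) ≡ fromℕℚ m * fromℕℚ n
fromℕℚ-* zero    n = sym (ℚ.*-zeroˡ (fromℕℚ n))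
fromℕℚ-* (suc m) n = begin
  fromℕℚ (n ℕ.+ m ℕ.* n)                ≡⟨ fromℕℚ-+ n (m ℕ.* n) ⟩
  fromℕℚ n + fromℕℚ (m ℕ.* n)           ≡⟨ cong (λ x → fromℕℚ n + x) (fromℕℚ-* m n) ⟩
  fromℕℚ n + fromℕℚ m * fromℕℚ n        ≡⟨ solve 2 (λ a b → b :+ a :* b := (con 1ℚ :+ a) :* b) refl (fromℕℚ m) (fromℕℚ n) ⟩
  (1ℚ + fromℕℚ m) * fromℕℚ n            ≡⟨ cong (_* fromℕℚ n) (fromℕℚ-suc m) ⟨
  fromℕℚ (suc m) * fromℕℚ n             ∎
  where open ≡-Reasoning

fromℕℚ-^ : ∀ m n → fromℕℚ (m ℕ.^ n) ≡ fromℕℚ m ^ n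
fromℕℚ-^ m zero    = refl
fromℕℚ-^ m (suc n) = trans (fromℕℚ-* m (m ℕ.^ n)) (cong (fromℕℚ m *_) (fromℕℚ-^ m n))

fromℕℚ-mono-< : ∀ {m n} → m ℕ.< n → fromℕℚ m < fromℕℚ n
fromℕℚ-mono-< {m} {n} m<n = ℚ.<-≤-trans
  (lt≡ (trans (cong (_- fromℕℚ m) (fromℕℚ-suc m)) (solve 1 (λ x → (con 1ℚ :+ x) :- x := con 1ℚ) refl (fromℕℚ m))) 0<1)
  (fromℕℚ-mono m<n)

fromℕℚ-cancel-≤ : ∀ {m n} → fromℕℚ m ≤ fromℕℚ n → m ℕ.≤ n
fromℕℚ-cancel-≤ {m} {n} h with m ℕ.≤? n
... | yes m≤n = m≤n
... | no  m≰n = contradiction (ℚ.<-≤-trans (fromℕℚ-mono-< (ℕ.≰⇒> m≰n)) h) (ℚ.<-irrefl refl)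

0<fromℕℚ : ∀ {n} → 0 ℕ.< n → 0ℚ < fromℕℚ n
0<fromℕℚ {suc n} _ = 0<fromℕℚ-suc n

ind : ∀ {P : Set} → Dec P → ℚ
ind P? = if does P? then 1ℚ else 0ℚ

ind-yes : ∀ {P : Set} (P? : Dec P) → P → ind P? ≡ 1ℚ
ind-yes (yes _) p = refl
ind-yes (no ¬p) p = contradiction p ¬p

ind-no : ∀ {P : Set} (P? : Dec P) → ¬ P → ind P? ≡ 0ℚ
ind-no (yes p) ¬p = contradiction p ¬p
ind-no (no _)  ¬p = refl

0≤ind : ∀ {P : Set} (P? : Dec P) → 0ℚ ≤ ind P?
0≤ind (yes _) = 0≤1
0≤ind (no _)  = ℚ.≤-refl

ind≤1 : ∀ {P : Set} (P? : Dec P) → ind P? ≤ 1ℚ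
ind≤1 (yes _) = ℚ.≤-refl
ind≤1 (no _)  = 0≤1

ind-mono : ∀ {P Q : Set} (P? : Dec P) (Q? : Dec Q) → (P → Q) → ind P? ≤ ind Q?
ind-mono (yes p) Q? f = ℚ.≤-reflexive (sym (ind-yes Q? (f p)))
ind-mono (no _)  Q? f = 0≤ind Q?

private variable
  A A′ : Set

∑ : List A → (A → ℚ) → ℚ
∑ []       f = 0ℚ
∑ (x ∷ xs) f = f x + ∑ xs f

∏ : List A → (A → ℚ) → ℚ
∏ []       f = 1ℚ
∏ (x ∷ xs) f = f x * ∏ xs f

∑-mono : ∀ (xs : List A) {f g} → (∀ {x} → x ∈ₗ xs → f x ≤ g x) → ∑ xs f ≤ ∑ xs g
∑-mono []       f≤g = ℚ.≤-refl
∑-mono (x ∷ xs) f≤g = ℚ.+-mono-≤ (f≤g (here refl)) (∑-mono xs (f≤g ∘ there))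

∑-cong : ∀ (xs : List A) {f g} → (∀ x → f x ≡ g x) → ∑ xs f ≡ ∑ xs g
∑-cong []       f≡g = refl
∑-cong (x ∷ xs) f≡g = cong₂ _+_ (f≡g x) (∑-cong xs f≡g)

∑-0 : ∀ (xs : List A) → ∑ xs (λ _ → 0ℚ) ≡ 0ℚ
∑-0 []       = refl
∑-0 (x ∷ xs) = trans (ℚ.+-identityˡ _) (∑-0 xs)

∑-nonNeg : ∀ (xs : List A) {f} → (∀ x → 0ℚ ≤ f x) → 0ℚ ≤ ∑ xs f
∑-nonNeg xs 0≤f = subst (_≤ ∑ xs _) (∑-0 xs) (∑-mono xs (λ {x} _ → 0≤f x))

∑-+ : ∀ (xs : List A) f g → ∑ xs (λ x → f x + g x) ≡ ∑ xs f + ∑ xs g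
∑-+ []       f g = refl
∑-+ (x ∷ xs) f g = trans (cong (λ y → f x + g x + y) (∑-+ xs f g))
  (solve 4 (λ a b c d → a :+ b :+ (c :+ d) := a :+ c :+ (b :+ d)) refl (f x) (g x) (∑ xs f) (∑ xs g))

∑-*ˡ : ∀ (xs : List A) c f → ∑ xs (λ x → c * f x) ≡ c * ∑ xs f
∑-*ˡ []       c f = sym (ℚ.*-zeroʳ c)
∑-*ˡ (x ∷ xs) c f = trans (cong (λ y → c * f x + y) (∑-*ˡ xs c f)) (sym (ℚ.*-distribˡ-+ c _ _))

∑-const : ∀ (xs : List A) c → ∑ xs (λ _ → c) ≡ fromℕℚ (length xs) * c
∑-const []       c = sym (ℚ.*-zeroˡ c)
∑-const (x ∷ xs) c = trans (cong (λ y → c + y) (∑-const xs c))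
  (trans (solve 2 (λ c n → c :+ n :* c := (con 1ℚ :+ n) :* c) refl c (fromℕℚ (length xs)))
    (cong (_* c) (sym (fromℕℚ-suc (length xs)))))

∑-swap : ∀ (xs : List A) (ys : List A′) (f : A → A′ → ℚ) →
         ∑ xs (λ x → ∑ ys (f x)) ≡ ∑ ys (λ y → ∑ xs (λ x → f x y))
∑-swap []       ys f = sym (∑-0 ys)
∑-swap (x ∷ xs) ys f = trans (cong (λ z → ∑ ys (f x) + z) (∑-swap xs ys f))
  (sym (∑-+ ys (f x) (λ y → ∑ xs (λ x → f x y))))

∑-++ : ∀ (xs ys : List A) f → ∑ (xs ++ ys) f ≡ ∑ xs f + ∑ ys f
∑-++ []       ys f = sym (ℚ.+-identityˡ _)
∑-++ (x ∷ xs) ys f = trans (cong (λ z → f x + z) (∑-++ xs ys f)) (sym (ℚ.+-assoc (f x) _ _))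

∑-map : ∀ (g : A → A′) (xs : List A) f → ∑ (map g xs) f ≡ ∑ xs (f ∘ g)
∑-map g []       f = refl
∑-map g (x ∷ xs) f = cong (λ z → f (g x) + z) (∑-map g xs f)

∑-filter : ∀ {P : A → Set} (P? : Decidable P) xs f →
           ∑ (filter P? xs) f ≡ ∑ xs (λ x → ind (P? x) * f x)
∑-filter P? []       f = refl
∑-filter P? (x ∷ xs) f with P? x
... | yes _ = cong₂ _+_ (sym (ℚ.*-identityˡ (f x))) (∑-filter P? xs f)
... | no  _ = trans (∑-filter P? xs f) (trans (sym (ℚ.+-identityˡ _)) (cong (λ z → z + ∑ xs (λ x → ind (P? x) * f x)) (sym (ℚ.*-zeroˡ (f x)))))

∑-∈ : ∀ {xs : List A} {x} f → (∀ x → 0ℚ ≤ f x) → x ∈ₗ xs → f x ≤ ∑ xs f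
∑-∈ {xs = x ∷ xs} f 0≤f (here refl) = subst (_≤ f x + ∑ xs f) (ℚ.+-identityʳ (f x)) (ℚ.+-monoʳ-≤ (f x) (∑-nonNeg xs 0≤f))
∑-∈ {xs = y ∷ xs} {x} f 0≤f (there x∈) = subst (_≤ f y + ∑ xs f) (ℚ.+-identityˡ (f x)) (ℚ.+-mono-≤ (0≤f y) (∑-∈ f 0≤f x∈))

∏-nonNeg : ∀ (xs : List A) {f} → (∀ x → 0ℚ ≤ f x) → 0ℚ ≤ ∏ xs f
∏-nonNeg []       0≤f = 0≤1
∏-nonNeg (x ∷ xs) 0≤f = 0≤* (0≤f x) (∏-nonNeg xs 0≤f)

∏-cong : ∀ (xs : List A) {f g} → (∀ {x} → x ∈ₗ xs → f x ≡ g x) → ∏ xs f ≡ ∏ xs g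
∏-cong []       f≡g = refl
∏-cong (x ∷ xs) f≡g = cong₂ _*_ (f≡g (here refl)) (∏-cong xs (f≡g ∘ there))

∏-map : ∀ (g : A → A′) (xs : List A) f → ∏ (map g xs) f ≡ ∏ xs (f ∘ g)
∏-map g []       f = refl
∏-map g (x ∷ xs) f = cong (λ z → f (g x) * z) (∏-map g xs f)

∏-const : ∀ (xs : List A) c → ∏ xs (λ _ → c) ≡ c ^ length xs
∏-const []       c = refl
∏-const (x ∷ xs) c = cong (c *_) (∏-const xs c)

-- Averages over lists

-- The value 0 at `[]` matches `uniform []`, so `∑-uniform` and `Pr-independent` hold for every
-- list.
1/length : List A → ℚ
1/length []       = 0ℚ
1/length (_ ∷ xs) = 1/suc (length xs)

0≤1/length : (xs : List A) → 0ℚ ≤ 1/length xs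
0≤1/length []       = ℚ.≤-refl
0≤1/length (_ ∷ xs) = ℚ.<⇒≤ (0<1/suc (length xs))

length*1/length : (xs : List A) → 0 ℕ.< length xs → fromℕℚ (length xs) * 1/length xs ≡ 1ℚ
length*1/length (_ ∷ xs) _ = 1/suc-inverse (length xs)

avg : List A → (A → ℚ) → ℚ
avg xs f = 1/length xs * ∑ xs f

avg-mono : ∀ (xs : List A) {f g} → (∀ {x} → x ∈ₗ xs → f x ≤ g x) → avg xs f ≤ avg xs g
avg-mono xs f≤g = *-monoˡ (0≤1/length xs) (∑-mono xs f≤g)

avg-cong : ∀ (xs : List A) {f g} → (∀ x → f x ≡ g x) → avg xs f ≡ avg xs g
avg-cong xs f≡g = cong (1/length xs *_) (∑-cong xs f≡g)

avg-+ : ∀ (xs : List A) f g → avg xs (λ x → f x + g x) ≡ avg xs f + avg xs g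
avg-+ xs f g = trans (cong (1/length xs *_) (∑-+ xs f g)) (ℚ.*-distribˡ-+ (1/length xs) _ _)

avg-*ˡ : ∀ (xs : List A) c f → avg xs (λ x → c * f x) ≡ c * avg xs f
avg-*ˡ xs c f = trans (cong (1/length xs *_) (∑-*ˡ xs c f))
  (solve 3 (λ w c s → w :* (c :* s) := c :* (w :* s)) refl (1/length xs) c (∑ xs f))

avg-const : ∀ (xs : List A) → 0 ℕ.< length xs → ∀ c → avg xs (λ _ → c) ≡ c
avg-const xs 0<l c = trans (cong (1/length xs *_) (∑-const xs c))
  (trans (solve 3 (λ w n c → w :* (n :* c) := n :* w :* c) refl (1/length xs) (fromℕℚ (length xs)) c)
    (trans (cong (_* c) (length*1/length xs 0<l)) (ℚ.*-identityˡ c)))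

∑-avg : ∀ (ys : List A′) (xs : List A) (f : A → A′ → ℚ) →
        ∑ ys (λ y → avg xs (λ x → f x y)) ≡ avg xs (λ x → ∑ ys (f x))
∑-avg ys xs f = trans (∑-*ˡ ys (1/length xs) (λ y → ∑ xs (λ x → f x y)))
  (cong (1/length xs *_) (sym (∑-swap xs ys f)))

avg-swap : ∀ (xs : List A) (ys : List A′) (f : A → A′ → ℚ) →
           avg xs (λ x → avg ys (f x)) ≡ avg ys (λ y → avg xs (λ x → f x y))
avg-swap xs ys f = trans (cong (1/length xs *_) (∑-*ˡ xs (1/length ys) (λ x → ∑ ys (f x))))
  (trans (solve 3 (λ a b s → a :* (b :* s) := b :* (a :* s)) refl (1/length xs) (1/length ys) (∑ xs (λ x → ∑ ys (f x))))
    (cong (1/length ys *_) (trans (cong (1/length xs *_) (∑-swap xs ys f)) (sym (∑-*ˡ ys (1/length xs) (λ y → ∑ xs (λ x → f x y)))))))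

-- Expectation when each coordinate is drawn uniformly and independently from its own list. The
-- lists may vary with the coordinate, so that one operator serves both the random list assignment
-- and the random colouring from given lists.
Avg : ∀ {n} → Vec (List A) n → (Vec A n → ℚ) → ℚ
Avg []         f = f []
Avg (xs ∷ xss) f = avg xs (λ x → Avg xss (λ φ → f (x ∷ φ)))

_∈Π_ : ∀ {n} → Vec A n → Vec (List A) n → Set
φ ∈Π xss = ∀ u → lookup φ u ∈ₗ lookup xss u

AllNonEmpty : ∀ {n} → Vec (List A) n → Set
AllNonEmpty xss = ∀ u → 0 ℕ.< length (lookup xss u)

∷∈Π : ∀ {n x} {xs : List A} {φ} {xss : Vec (List A) n} → x ∈ₗ xs → φ ∈Π xss → (x ∷ φ) ∈Π (xs ∷ xss)
∷∈Π x∈ φ∈ zero    = x∈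
∷∈Π x∈ φ∈ (suc u) = φ∈ u

module _ {A : Set} where

  Avg-mono : ∀ {n} (xss : Vec (List A) n) {f g} → (∀ φ → φ ∈Π xss → f φ ≤ g φ) → Avg xss f ≤ Avg xss g
  Avg-mono []         f≤g = f≤g [] λ ()
  Avg-mono (xs ∷ xss) f≤g = avg-mono xs λ {x} x∈ → Avg-mono xss λ φ φ∈ →
    f≤g (x ∷ φ) (∷∈Π {xs = xs} {φ} {xss} x∈ φ∈)

  Avg-cong : ∀ {n} (xss : Vec (List A) n) {f g} → (∀ φ → f φ ≡ g φ) → Avg xss f ≡ Avg xss g
  Avg-cong []         f≡g = f≡g []
  Avg-cong (xs ∷ xss) f≡g = avg-cong xs λ x → Avg-cong xss λ φ → f≡g (x ∷ φ)

  Avg-+ : ∀ {n} (xss : Vec (List A) n) f g → Avg xss (λ φ → f φ + g φ) ≡ Avg xss f + Avg xss g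
  Avg-+ []         f g = refl
  Avg-+ (xs ∷ xss) f g = trans (avg-cong xs λ x → Avg-+ xss (λ φ → f (x ∷ φ)) (λ φ → g (x ∷ φ))) (avg-+ xs _ _)

  Avg-*ˡ : ∀ {n} (xss : Vec (List A) n) c f → Avg xss (λ φ → c * f φ) ≡ c * Avg xss f
  Avg-*ˡ []         c f = refl
  Avg-*ˡ (xs ∷ xss) c f = trans (avg-cong xs λ x → Avg-*ˡ xss c (λ φ → f (x ∷ φ))) (avg-*ˡ xs c _)

  Avg-const : ∀ {n} (xss : Vec (List A) n) → AllNonEmpty xss → ∀ c → Avg xss (λ _ → c) ≡ c
  Avg-const []         ne c = refl
  Avg-const (xs ∷ xss) ne c = trans (avg-cong xs λ x → Avg-const xss (ne ∘ suc) c) (avg-const xs (ne zero) c)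

  Avg-0 : ∀ {n} (xss : Vec (List A) n) → Avg xss (λ _ → 0ℚ) ≡ 0ℚ
  Avg-0 xss = trans (Avg-*ˡ xss 0ℚ (λ _ → 0ℚ)) (ℚ.*-zeroˡ (Avg xss (λ _ → 0ℚ)))

  Avg-nonNeg : ∀ {n} (xss : Vec (List A) n) {f} → (∀ φ → 0ℚ ≤ f φ) → 0ℚ ≤ Avg xss f
  Avg-nonNeg xss {f} 0≤f = subst (_≤ Avg xss f) (Avg-0 xss) (Avg-mono xss λ φ _ → 0≤f φ)

  Avg-∑ : ∀ {n} {A′ : Set} (xss : Vec (List A) n) (ys : List A′) (f : A′ → Vec A n → ℚ) →
          Avg xss (λ φ → ∑ ys (λ y → f y φ)) ≡ ∑ ys (λ y → Avg xss (f y))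
  Avg-∑ []         ys f = refl
  Avg-∑ (xs ∷ xss) ys f = trans (avg-cong xs λ x → Avg-∑ xss ys (λ y φ → f y (x ∷ φ)))
    (sym (∑-avg ys xs (λ x y → Avg xss (λ φ → f y (x ∷ φ)))))

  -- Resampling: `f x` does not read coordinate v, so the entry at v may be replaced by an
  -- independent second draw. At the head this is `avg-const` read backwards. It is used to fix the
  -- list at v, and later the colour at v, before averaging over the rest.
  Avg-decouple : ∀ {n} (xss : Vec (List A) n) → AllNonEmpty xss → ∀ v (f : A → Vec A n → ℚ) →
    (∀ x φ ψ → (∀ u → u ≢ v → lookup φ u ≡ lookup ψ u) → f x φ ≡ f x ψ) →
    Avg xss (λ φ → f (lookup φ v) φ) ≡ avg (lookup xss v) (λ x → Avg xss (f x))
  Avg-decouple (xs ∷ xss) ne zero f inv = avg-cong xs λ x →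
    trans (sym (avg-const xs (ne zero) _))
      (avg-cong xs λ y → Avg-cong xss λ φ → inv x (x ∷ φ) (y ∷ φ)
        λ { zero 0≢0 → contradiction refl 0≢0 ; (suc u) _ → refl })
  Avg-decouple (xs ∷ xss) ne (suc v) f inv =
    trans (avg-cong xs λ y → Avg-decouple xss (ne ∘ suc) v (λ x φ → f x (y ∷ φ))
             λ x φ ψ eq → inv x (y ∷ φ) (y ∷ ψ) λ { zero _ → refl ; (suc u) u≢v → eq u (u≢v ∘ cong suc) })
      (avg-swap xs (lookup xss v) (λ y x → Avg xss (λ φ → f x (y ∷ φ))))

-- Probabilities of product distributions as averages

Pr-∑ : ∀ {P : A → Set} (P? : Decidable P) (μ : Dist A) →
          Pr P? μ ≡ ∑ μ (λ w → proj₁ w * ind (P? (proj₂ w)))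
Pr-∑ P? [] = refl
Pr-∑ P? ((w , x) ∷ μ) with P? x
... | yes _ = cong₂ _+_ (sym (ℚ.*-identityʳ w)) (Pr-∑ P? μ)
... | no  _ = trans (Pr-∑ P? μ) (trans (sym (ℚ.+-identityˡ _)) (cong (λ z → z + ∑ μ (λ w → proj₁ w * ind (P? (proj₂ w)))) (sym (ℚ.*-zeroʳ w))))

∑-uniform : ∀ (xs : List A) (f : A → ℚ) → ∑ (uniform xs) (λ w → proj₁ w * f (proj₂ w)) ≡ avg xs f
∑-uniform [] f = refl
∑-uniform (x ∷ xs) f = trans (∑-map (1/suc (length xs) ,_) (x ∷ xs) (λ w → proj₁ w * f (proj₂ w)))
  (∑-*ˡ (x ∷ xs) (1/suc (length xs)) f)

∑-cartesianProductWith : ∀ {C : Set} (h : A → A′ → C) (xs : List A) (ys : List A′) f →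
  ∑ (cartesianProductWith h xs ys) f ≡ ∑ xs (λ x → ∑ ys (λ y → f (h x y)))
∑-cartesianProductWith h []       ys f = refl
∑-cartesianProductWith h (x ∷ xs) ys f = trans (∑-++ (map (h x) ys) _ f)
  (cong₂ _+_ (∑-map (h x) ys f) (∑-cartesianProductWith h xs ys f))

∑-independent : ∀ n (xs : List A) (f : Vec A n → ℚ) →
  ∑ (independent n (uniform xs)) (λ w → proj₁ w * f (proj₂ w)) ≡ Avg (replicate n xs) f
∑-independent zero    xs f = trans (ℚ.+-identityʳ _) (ℚ.*-identityˡ (f []))
∑-independent (suc n) xs f = trans (∑-cartesianProductWith _ (uniform xs) (independent n (uniform xs)) _)
  (trans (∑-cong (uniform xs) λ { (p , x) → trans
      (∑-cong (independent n (uniform xs)) λ { (q , φ) → ℚ.*-assoc p q (f (x ∷ φ)) })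
      (trans (∑-*ˡ (independent n (uniform xs)) p (λ w → proj₁ w * f (x ∷ proj₂ w)))
        (cong (p *_) (∑-independent n xs (λ φ → f (x ∷ φ))))) })
    (∑-uniform xs (λ x → Avg (replicate n xs) (λ φ → f (x ∷ φ)))))

Pr-independent : ∀ n (xs : List A) {P : Vec A n → Set} (P? : Decidable P) →
  Pr P? (independent n (uniform xs)) ≡ Avg (replicate n xs) (ind ∘ P?)
Pr-independent n xs P? = trans (Pr-∑ P? (independent n (uniform xs))) (∑-independent n xs (ind ∘ P?))

-- Uniformly random k-subsets

∑-subsets : ∀ n f → ∑ (subsets (suc n)) f ≡ ∑ (subsets n) (f ∘ (outside ∷_)) + ∑ (subsets n) (f ∘ (inside ∷_))
∑-subsets n f = trans (∑-++ (map (outside ∷_) (subsets n)) (map (inside ∷_) (subsets n)) f)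
  (cong₂ _+_ (∑-map (outside ∷_) (subsets n) f) (∑-map (inside ∷_) (subsets n) f))

∈-subsets : ∀ {n} (S : Subset n) → S ∈ₗ subsets n
∈-subsets []            = here refl
∈-subsets (outside ∷ S) = ∈-++⁺ˡ (∈-map⁺ (outside ∷_) (∈-subsets S))
∈-subsets (inside  ∷ S) = ∈-++⁺ʳ (map (outside ∷_) (subsets _)) (∈-map⁺ (inside ∷_) (∈-subsets S))

-- The indicator of S ⊆ x, by recursion rather than through `_⊆?_`, so that it computes when a sum
-- over `subsets` is split at the first coordinate.
sub : ∀ {n} → Subset n → Subset n → ℚ
sub []            []            = 1ℚ
sub (outside ∷ S) (_       ∷ x) = sub S x
sub (inside  ∷ S) (inside  ∷ x) = sub S x
sub (inside  ∷ S) (outside ∷ x) = 0ℚ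

0≤sub : ∀ {n} (S x : Subset n) → 0ℚ ≤ sub S x
0≤sub []            []            = 0≤1
0≤sub (outside ∷ S) (_       ∷ x) = 0≤sub S x
0≤sub (inside  ∷ S) (inside  ∷ x) = 0≤sub S x
0≤sub (inside  ∷ S) (outside ∷ x) = ℚ.≤-refl

sub-⊆ : ∀ {n} (S x : Subset n) → S ⊆ x → sub S x ≡ 1ℚ
sub-⊆ []            []            S⊆x = refl
sub-⊆ (outside ∷ S) (_       ∷ x) S⊆x = sub-⊆ S x (drop-∷-⊆ S⊆x)
sub-⊆ (inside  ∷ S) (inside  ∷ x) S⊆x = sub-⊆ S x (drop-∷-⊆ S⊆x)
sub-⊆ (inside  ∷ S) (outside ∷ x) S⊆x with () ← S⊆x here

sub-⊥ : ∀ {n} (x : Subset n) → sub ⊥ x ≡ 1ℚ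
sub-⊥ []      = refl
sub-⊥ (_ ∷ x) = sub-⊥ x

sub-∩ : ∀ {n} (S I x : Subset n) → sub S (I ∩ x) ≡ sub S I * sub S x
sub-∩ []            []            []            = refl
sub-∩ (outside ∷ S) (_       ∷ I) (_       ∷ x) = sub-∩ S I x
sub-∩ (inside  ∷ S) (inside  ∷ I) (inside  ∷ x) = sub-∩ S I x
sub-∩ (inside  ∷ S) (inside  ∷ I) (outside ∷ x) = sym (ℚ.*-zeroʳ (sub S I))
sub-∩ (inside  ∷ S) (outside ∷ I) (inside  ∷ x) = sym (ℚ.*-zeroˡ (sub S x))
sub-∩ (inside  ∷ S) (outside ∷ I) (outside ∷ x) = refl

binomial : ∀ {n} z (x : Subset n) → ∑ (subsets n) (λ S → sub S x * z ^ ∣ S ∣) ≡ (1ℚ + z) ^ ∣ x ∣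
binomial z [] = refl
binomial {suc n} z (inside ∷ x) = begin
  ∑ (subsets (suc n)) (λ S → sub S (inside ∷ x) * z ^ ∣ S ∣)                      ≡⟨ ∑-subsets n _ ⟩
  s + ∑ (subsets n) (λ S → sub S x * (z * z ^ ∣ S ∣))                             ≡⟨ cong (λ y → s + y) (∑-cong (subsets n) λ S →
                                                                                     solve 3 (λ a z b → a :* (z :* b) := z :* (a :* b)) refl (sub S x) z (z ^ ∣ S ∣)) ⟩
  s + ∑ (subsets n) (λ S → z * (sub S x * z ^ ∣ S ∣))                             ≡⟨ cong (λ y → s + y) (∑-*ˡ (subsets n) z _) ⟩
  s + z * s                                                                       ≡⟨ solve 2 (λ s z → s :+ z :* s := (con 1ℚ :+ z) :* s) refl s z ⟩
  (1ℚ + z) * s                                                                    ≡⟨ cong ((1ℚ + z) *_) (binomial z x) ⟩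
  (1ℚ + z) * (1ℚ + z) ^ ∣ x ∣                                                     ∎
  where
  open ≡-Reasoning
  s : ℚ
  s = ∑ (subsets n) (λ S → sub S x * z ^ ∣ S ∣)
binomial {suc n} z (outside ∷ x) = begin
  ∑ (subsets (suc n)) (λ S → sub S (outside ∷ x) * z ^ ∣ S ∣)                     ≡⟨ ∑-subsets n _ ⟩
  s + ∑ (subsets n) (λ S → 0ℚ * (z * z ^ ∣ S ∣))                                  ≡⟨ cong (λ y → s + y) (∑-cong (subsets n) λ S → ℚ.*-zeroˡ (z * z ^ ∣ S ∣)) ⟩
  s + ∑ (subsets n) (λ S → 0ℚ)                                                    ≡⟨ cong (λ y → s + y) (∑-0 (subsets n)) ⟩
  s + 0ℚ                                                                          ≡⟨ ℚ.+-identityʳ s ⟩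
  s                                                                               ≡⟨ binomial z x ⟩
  (1ℚ + z) ^ ∣ x ∣                                                                ∎
  where
  open ≡-Reasoning
  s : ℚ
  s = ∑ (subsets n) (λ S → sub S x * z ^ ∣ S ∣)

supersets : ∀ {n} → ℕ → Subset n → ℚ
supersets {n} k S = ∑ (subsets n) (λ x → ind (∣ x ∣ ℕ.≟ k) * sub S x)

private
  ∑-zero : ∀ {A : Set} (xs : List A) {f} → (∀ x → f x ≡ 0ℚ) → ∑ xs f ≡ 0ℚ
  ∑-zero xs f≡0 = trans (∑-cong xs f≡0) (∑-0 xs)

supersets-outside-zero : ∀ {n} (S : Subset n) → supersets 0 (outside ∷ S) ≡ supersets 0 S
supersets-outside-zero {n} S = trans (∑-subsets n _)
  (trans (cong (λ y → supersets 0 S + y) (∑-zero (subsets n) λ x → ℚ.*-zeroˡ (sub S x))) (ℚ.+-identityʳ (supersets 0 S)))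

supersets-outside-suc : ∀ {n} k (S : Subset n) → supersets (suc k) (outside ∷ S) ≡ supersets (suc k) S + supersets k S
supersets-outside-suc {n} k S = ∑-subsets n _

supersets-inside-zero : ∀ {n} (S : Subset n) → supersets 0 (inside ∷ S) ≡ 0ℚ
supersets-inside-zero {n} S = trans (∑-subsets n _) (cong₂ _+_
  (∑-zero (subsets n) λ x → ℚ.*-zeroʳ (ind (∣ x ∣ ℕ.≟ 0))) (∑-zero (subsets n) λ x → ℚ.*-zeroˡ (sub S x)))

supersets-inside-suc : ∀ {n} k (S : Subset n) → supersets (suc k) (inside ∷ S) ≡ supersets k S
supersets-inside-suc {n} k S = trans (∑-subsets n _)
  (trans (cong (_+ supersets k S) (∑-zero (subsets n) λ x → ℚ.*-zeroʳ (ind (∣ x ∣ ℕ.≟ suc k)))) (ℚ.+-identityˡ (supersets k S)))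

supersets-< : ∀ {n} k (S : Subset n) → k ℕ.< ∣ S ∣ → supersets k S ≡ 0ℚ
supersets-< zero    (outside ∷ S) k< = trans (supersets-outside-zero S) (supersets-< 0 S k<)
supersets-< (suc k) (outside ∷ S) k< = trans (supersets-outside-suc k S)
  (cong₂ _+_ (supersets-< (suc k) S k<) (supersets-< k S (ℕ.<-trans (ℕ.n<1+n k) k<)))
supersets-< zero    (inside  ∷ S) k<         = supersets-inside-zero S
supersets-< (suc k) (inside  ∷ S) (ℕ.s≤s k<) = trans (supersets-inside-suc k S) (supersets-< k S k<)

-- A coordinate outside S gives Pascal's rule, one inside only lowers k. Writing k as ∣ S ∣ + j
-- avoids a truncated subtraction in the lower index.
supersets-+ : ∀ {n} (S : Subset n) k j → k ≡ ∣ S ∣ ℕ.+ j → supersets k S ≡ fromℕℚ (∣ ∁ S ∣ choose j)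
supersets-+ []            zero    zero    refl = refl
supersets-+ []            (suc _) (suc j) refl = refl
supersets-+ (inside  ∷ S) (suc k) j       eq = trans (supersets-inside-suc k S) (supersets-+ S k j (ℕ.suc-injective eq))
supersets-+ (outside ∷ S) zero    zero    eq = trans (supersets-outside-zero S) (supersets-+ S 0 0 eq)
supersets-+ (outside ∷ S) zero    (suc j) eq = contradiction (trans eq (ℕ.+-suc ∣ S ∣ j)) λ ()
supersets-+ (outside ∷ S) (suc k) zero    eq = trans (supersets-outside-suc k S) (trans
  (cong₂ _+_ (supersets-+ S (suc k) 0 eq) (supersets-< k S (ℕ.≤-reflexive (trans eq (ℕ.+-identityʳ ∣ S ∣)))))
  (ℚ.+-identityʳ (fromℕℚ (∣ ∁ S ∣ choose 0))))
supersets-+ (outside ∷ S) (suc k) (suc j) eq = begin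
  supersets (suc k) (outside ∷ S)                              ≡⟨ supersets-outside-suc k S ⟩
  supersets (suc k) S + supersets k S                          ≡⟨ cong₂ _+_ (supersets-+ S (suc k) (suc j) eq)
                                                                    (supersets-+ S k j (ℕ.suc-injective (trans eq (ℕ.+-suc ∣ S ∣ j)))) ⟩
  fromℕℚ (∣ ∁ S ∣ choose suc j) + fromℕℚ (∣ ∁ S ∣ choose j)              ≡⟨ fromℕℚ-+ (∣ ∁ S ∣ choose suc j) (∣ ∁ S ∣ choose j) ⟨
  fromℕℚ (∣ ∁ S ∣ choose suc j ℕ.+ ∣ ∁ S ∣ choose j)                     ≡⟨ cong fromℕℚ (trans (ℕ.+-comm (∣ ∁ S ∣ choose suc j) (∣ ∁ S ∣ choose j))
                                                                    (nCk+nC[k+1]≡[n+1]C[k+1] ∣ ∁ S ∣ j)) ⟩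
  fromℕℚ (suc ∣ ∁ S ∣ choose suc j)                                 ∎
  where open ≡-Reasoning

-- Multiplied-out form of the ratio (k + 1) / (n + 1) of two neighbouring binomial coefficients;
-- `C-ratio` takes out the prescribed elements one at a time with it.
absorption : ∀ n k → suc n ℕ.* (n choose k) ≡ suc k ℕ.* (suc n choose suc k)
absorption zero    zero    = refl
absorption zero    (suc k) = sym (trans (cong (suc (suc k) ℕ.*_) (k>n⇒nCk≡0 {1} {suc (suc k)} (ℕ.s≤s (ℕ.s≤s ℕ.z≤n)))) (ℕ.*-zeroʳ (suc (suc k))))
absorption (suc n) zero    = trans (ℕ.*-comm (suc (suc n)) 1) (cong (ℕ._+ 0) (sym (nC1≡n (suc (suc n)))))
absorption (suc n) (suc k) = begin
  suc (suc n) ℕ.* b                                  ≡⟨ cong (λ x → b ℕ.+ suc n ℕ.* x) (nCk+nC[k+1]≡[n+1]C[k+1] n k) ⟨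
  b ℕ.+ suc n ℕ.* (n choose k ℕ.+ n choose suc k)              ≡⟨ cong (b ℕ.+_) (ℕ.*-distribˡ-+ (suc n) (n choose k) (n choose suc k)) ⟩
  b ℕ.+ (suc n ℕ.* (n choose k) ℕ.+ suc n ℕ.* (n choose suc k))≡⟨ cong₂ (λ x y → b ℕ.+ (x ℕ.+ y)) (absorption n k) (absorption n (suc k)) ⟩
  b ℕ.+ (suc k ℕ.* b ℕ.+ suc (suc k) ℕ.* c)          ≡⟨ ℕ.+-assoc b (suc k ℕ.* b) (suc (suc k) ℕ.* c) ⟨
  suc (suc k) ℕ.* b ℕ.+ suc (suc k) ℕ.* c            ≡⟨ ℕ.*-distribˡ-+ (suc (suc k)) b c ⟨
  suc (suc k) ℕ.* (b ℕ.+ c)                          ≡⟨ cong (suc (suc k) ℕ.*_) (nCk+nC[k+1]≡[n+1]C[k+1] (suc n) (suc k)) ⟩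
  suc (suc k) ℕ.* (suc (suc n) choose suc (suc k))        ∎
  where
  open ≡-Reasoning
  b c : ℕ
  b = suc n choose suc k
  c = suc n choose suc (suc k)

-- Given that t elements are chosen, the others are too with a smaller probability:
-- the ratio of the binomial coefficients is a product of t fractions at most κ.
C-ratio : ∀ t d j κ → 0ℚ ≤ κ → κ ≤ 1ℚ → fromℕℚ (t ℕ.+ j) ≤ κ * fromℕℚ (t ℕ.+ d) →
          fromℕℚ (d choose j) ≤ κ ^ t * fromℕℚ ((t ℕ.+ d) choose (t ℕ.+ j))
C-ratio zero    d j κ 0≤κ κ≤1 h = ℚ.≤-reflexive (sym (ℚ.*-identityˡ (fromℕℚ (d choose j))))
C-ratio (suc t) d j κ 0≤κ κ≤1 h = begin
  fromℕℚ (d choose j)                     ≤⟨ C-ratio t d j κ 0≤κ κ≤1 h′ ⟩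
  κ ^ t * b                          ≤⟨ *-monoˡ (^-nonNeg t 0≤κ) step ⟩
  κ ^ t * (κ * c)                    ≡⟨ solve 3 (λ u κ c → u :* (κ :* c) := κ :* u :* c) refl (κ ^ t) κ c ⟩
  κ * κ ^ t * c                      ∎
  where
  open ℚ.≤-Reasoning
  N K b c : ℚ
  N = fromℕℚ (t ℕ.+ d)
  K = fromℕℚ (t ℕ.+ j)
  b = fromℕℚ ((t ℕ.+ d) choose (t ℕ.+ j))
  c = fromℕℚ (suc (t ℕ.+ d) choose suc (t ℕ.+ j))
  h₁ : 1ℚ + K ≤ κ * (1ℚ + N)
  h₁ = subst₂ (λ x y → x ≤ κ * y) (fromℕℚ-suc (t ℕ.+ j)) (fromℕℚ-suc (t ℕ.+ d)) h
  h′ : K ≤ κ * N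
  h′ = le≡ (solve 3 (λ K N κ → κ :* N :- K := (κ :* (con 1ℚ :+ N) :- (con 1ℚ :+ K)) :+ (con 1ℚ :- κ)) refl K N κ)
         (0≤+ (el h₁) (el κ≤1))
  absorb : (1ℚ + N) * b ≡ (1ℚ + K) * c
  absorb = trans (cong (_* b) (sym (fromℕℚ-suc (t ℕ.+ d))))
    (trans (sym (fromℕℚ-* (suc (t ℕ.+ d)) ((t ℕ.+ d) choose (t ℕ.+ j))))
      (trans (cong fromℕℚ (absorption (t ℕ.+ d) (t ℕ.+ j)))
        (trans (fromℕℚ-* (suc (t ℕ.+ j)) (suc (t ℕ.+ d) choose suc (t ℕ.+ j))) (cong (_* c) (fromℕℚ-suc (t ℕ.+ j))))))
  step : b ≤ κ * c
  step = *-cancelˡ (0<+ 0<1 (0≤fromℕℚ (t ℕ.+ d))) (begin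
    (1ℚ + N) * b          ≡⟨ absorb ⟩
    (1ℚ + K) * c          ≤⟨ *-monoʳ (0≤fromℕℚ (suc (t ℕ.+ d) choose suc (t ℕ.+ j))) h₁ ⟩
    κ * (1ℚ + N) * c      ≡⟨ solve 3 (λ κ n c → κ :* n :* c := n :* (κ :* c)) refl κ (1ℚ + N) c ⟩
    (1ℚ + N) * (κ * c)    ∎)

∣∁∣+ : ∀ {n} (S : Subset n) → ∣ S ∣ ℕ.+ ∣ ∁ S ∣ ≡ n
∣∁∣+ S = trans (cong (∣ S ∣ ℕ.+_) (∣∁p∣≡n∸∣p∣ S)) (ℕ.m+[n∸m]≡n (∣p∣≤n S))

-- Every set contains `⊥`, so this is the count `supersets` at `⊥`.
length-subsetsOfSize : ∀ σ k → fromℕℚ (length (subsetsOfSize σ k)) ≡ fromℕℚ (σ choose k)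
length-subsetsOfSize σ k = begin
  fromℕℚ (length (subsetsOfSize σ k))                     ≡⟨ ℚ.*-identityʳ _ ⟨
  fromℕℚ (length (subsetsOfSize σ k)) * 1ℚ                ≡⟨ ∑-const (subsetsOfSize σ k) 1ℚ ⟨
  ∑ (subsetsOfSize σ k) (λ _ → 1ℚ)                        ≡⟨ ∑-filter (λ S → ∣ S ∣ ℕ.≟ k) (subsets σ) (λ _ → 1ℚ) ⟩
  ∑ (subsets σ) (λ x → ind (∣ x ∣ ℕ.≟ k) * 1ℚ)            ≡⟨ ∑-cong (subsets σ) (λ x → cong (ind (∣ x ∣ ℕ.≟ k) *_) (sub-⊥ x)) ⟨
  supersets k (⊥ {σ})                                     ≡⟨ supersets-+ (⊥ {σ}) k k (cong (ℕ._+ k) (sym (∣⊥∣≡0 σ))) ⟩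
  fromℕℚ (∣ ∁ (⊥ {σ}) ∣ choose k)                              ≡⟨ cong (λ n → fromℕℚ (n choose k)) (trans (∣∁p∣≡n∸∣p∣ (⊥ {σ})) (cong (σ ℕ.∸_) (∣⊥∣≡0 σ))) ⟩
  fromℕℚ (σ choose k)                                          ∎
  where open ≡-Reasoning

C-positive : ∀ {n k} → k ℕ.≤ n → 0 ℕ.< n choose k
C-positive {n}     {zero}  _             = ℕ.s≤s ℕ.z≤n
C-positive {suc n} {suc k} (ℕ.s≤s k≤n) = subst (0 ℕ.<_) (nCk+nC[k+1]≡[n+1]C[k+1] n k)
  (ℕ.≤-trans (C-positive k≤n) (ℕ.m≤m+n (n choose k) (n choose suc k)))

subsetsOfSize-nonEmpty : ∀ {σ k} → k ℕ.≤ σ → 0 ℕ.< length (subsetsOfSize σ k)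
subsetsOfSize-nonEmpty {σ} {k} k≤σ = ℕ.≤-trans (C-positive k≤σ)
  (fromℕℚ-cancel-≤ (ℚ.≤-reflexive (sym (length-subsetsOfSize σ k))))

-- `κ` stands for k / σ, given as an upper bound without division.
module RandomSubset {σ k : ℕ} (k≤σ : k ℕ.≤ σ) (κ : ℚ) (0≤κ : 0ℚ ≤ κ) (κ≤1 : κ ≤ 1ℚ) (k≤κσ : fromℕℚ k ≤ κ * fromℕℚ σ) where

  Ω : List (Subset σ)
  Ω = subsetsOfSize σ k

  supersets≤ : ∀ S → supersets k S ≤ κ ^ ∣ S ∣ * fromℕℚ (length Ω)
  supersets≤ S = by (ℕ.≤-<-connex ∣ S ∣ k)
    where
    open ℚ.≤-Reasoning
    bound : ∀ j → ∣ S ∣ ℕ.+ j ≡ k → supersets k S ≤ κ ^ ∣ S ∣ * fromℕℚ (length Ω)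
    bound j eq = begin
      supersets k S                                                     ≡⟨ supersets-+ S k j (sym eq) ⟩
      fromℕℚ (∣ ∁ S ∣ choose j)                                              ≤⟨ C-ratio ∣ S ∣ ∣ ∁ S ∣ j κ 0≤κ κ≤1
                                                                             (subst₂ (λ x y → fromℕℚ x ≤ κ * fromℕℚ y) (sym eq) (sym (∣∁∣+ S)) k≤κσ) ⟩
      κ ^ ∣ S ∣ * fromℕℚ ((∣ S ∣ ℕ.+ ∣ ∁ S ∣) choose (∣ S ∣ ℕ.+ j))          ≡⟨ cong₂ (λ x y → κ ^ ∣ S ∣ * fromℕℚ (x choose y)) (∣∁∣+ S) eq ⟩
      κ ^ ∣ S ∣ * fromℕℚ (σ choose k)                                        ≡⟨ cong (κ ^ ∣ S ∣ *_) (length-subsetsOfSize σ k) ⟨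
      κ ^ ∣ S ∣ * fromℕℚ (length Ω)                                     ∎
    by : ∣ S ∣ ℕ.≤ k ⊎ k ℕ.< ∣ S ∣ → supersets k S ≤ κ ^ ∣ S ∣ * fromℕℚ (length Ω)
    by (inj₁ ∣S∣≤k) = let j , eq = ℕ.m≤n⇒∃[o]m+o≡n ∣S∣≤k in bound j eq
    by (inj₂ k<∣S∣) = ℚ.≤-trans (ℚ.≤-reflexive (supersets-< k S k<∣S∣)) (0≤* (^-nonNeg ∣ S ∣ 0≤κ) (0≤fromℕℚ (length Ω)))

  -- Sampling without replacement makes inclusions negatively dependent: the exact probability is a
  -- quotient of binomial coefficients, and `C-ratio` compares it with the product value.
  avg-sub : ∀ S → avg Ω (sub S) ≤ κ ^ ∣ S ∣
  avg-sub S = begin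
    1/length Ω * ∑ Ω (sub S)                          ≡⟨ cong (1/length Ω *_) (∑-filter (λ S → ∣ S ∣ ℕ.≟ k) (subsets σ) (sub S)) ⟩
    1/length Ω * supersets k S                        ≤⟨ *-monoˡ (0≤1/length Ω) (supersets≤ S) ⟩
    1/length Ω * (κ ^ ∣ S ∣ * fromℕℚ (length Ω))      ≡⟨ solve 3 (λ w u l → w :* (u :* l) := u :* (l :* w)) refl (1/length Ω) (κ ^ ∣ S ∣) (fromℕℚ (length Ω)) ⟩
    κ ^ ∣ S ∣ * (fromℕℚ (length Ω) * 1/length Ω)      ≡⟨ cong (κ ^ ∣ S ∣ *_) (length*1/length Ω (subsetsOfSize-nonEmpty k≤σ)) ⟩
    κ ^ ∣ S ∣ * 1ℚ                                    ≡⟨ ℚ.*-identityʳ (κ ^ ∣ S ∣) ⟩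
    κ ^ ∣ S ∣                                         ∎
    where open ℚ.≤-Reasoning

  -- Expanding over T ⊆ I ∩ x, each T contributes at most its value under independent choices.
  avg-pow : ∀ {a} → 0ℚ ≤ a → ∀ I → avg Ω (λ x → (1ℚ + a) ^ ∣ I ∩ x ∣) ≤ (1ℚ + a * κ) ^ ∣ I ∣
  avg-pow {a} 0≤a I = begin
    avg Ω (λ x → (1ℚ + a) ^ ∣ I ∩ x ∣)                                            ≡⟨ avg-cong Ω expand ⟩
    avg Ω (λ x → ∑ (subsets σ) (λ T → c T * sub T x))                             ≡⟨ ∑-avg (subsets σ) Ω (λ x T → c T * sub T x) ⟨
    ∑ (subsets σ) (λ T → avg Ω (λ x → c T * sub T x))                             ≡⟨ ∑-cong (subsets σ) (λ T → avg-*ˡ Ω (c T) (sub T)) ⟩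
    ∑ (subsets σ) (λ T → c T * avg Ω (sub T))                                     ≤⟨ ∑-mono (subsets σ) (λ {T} _ →
                                                                                       *-monoˡ (0≤* (0≤sub T I) (^-nonNeg ∣ T ∣ 0≤a)) (avg-sub T)) ⟩
    ∑ (subsets σ) (λ T → c T * κ ^ ∣ T ∣)                                         ≡⟨ ∑-cong (subsets σ) (λ T →
                                                                                       trans (ℚ.*-assoc (sub T I) (a ^ ∣ T ∣) (κ ^ ∣ T ∣))
                                                                                         (cong (sub T I *_) (sym (^-distrib-* a κ ∣ T ∣)))) ⟩
    ∑ (subsets σ) (λ T → sub T I * (a * κ) ^ ∣ T ∣)                               ≡⟨ binomial (a * κ) I ⟩
    (1ℚ + a * κ) ^ ∣ I ∣                                                          ∎
    where
    open ℚ.≤-Reasoning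
    c : Subset σ → ℚ
    c T = sub T I * a ^ ∣ T ∣
    expand : ∀ x → (1ℚ + a) ^ ∣ I ∩ x ∣ ≡ ∑ (subsets σ) (λ T → c T * sub T x)
    expand x = trans (sym (binomial a (I ∩ x))) (∑-cong (subsets σ) λ T →
      trans (cong (_* a ^ ∣ T ∣) (sub-∩ T I x))
        (solve 3 (λ u v w → u :* v :* w := u :* w :* v) refl (sub T I) (sub T x) (a ^ ∣ T ∣)))

-- Products over disjoint edges

2ℚ : ℚ
2ℚ = 1ℚ + 1ℚ

-- The colours common to all lists on F; for empty F these are all colours.
inter : ∀ {n σ} → Subset n → ListAssignment n σ → Subset σ
inter []            []      = ⊤
inter (inside  ∷ F) (x ∷ L) = x ∩ inter F L
inter (outside ∷ F) (x ∷ L) = inter F L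

module EdgeMoments {σ k : ℕ} (k≤σ : k ℕ.≤ σ) (κ : ℚ) (0≤κ : 0ℚ ≤ κ) (κ≤1 : κ ≤ 1ℚ) (k≤κσ : fromℕℚ k ≤ κ * fromℕℚ σ) where

  open RandomSubset k≤σ κ 0≤κ κ≤1 k≤κσ using (Ω; avg-pow)

  -- The state of an edge while the lists are revealed in turn: the first component holds its
  -- vertices still to come, the second the colours of S found in all of its lists so far.
  Item : ℕ → Set
  Item n = Subset n × Subset σ

  Disjoint : ∀ {n} → Item n → Item n → Set
  Disjoint (F , _) (G , _) = ∀ u → u ∈ F → u ∈ G → Empty

  restrict : ∀ {n} → Subset σ → Item (suc n) → Item n
  restrict x (inside  ∷ F , I) = F , I ∩ x
  restrict x (outside ∷ F , I) = F , I

  value : ∀ {n} → ListAssignment n σ → Item n → ℚ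
  value L (F , I) = 2ℚ ^ ∣ I ∩ inter F L ∣

  -- If inclusions were independent, a colour of I would survive the lists on F with probability
  -- κ^|F| and then contribute a factor 2, hence 1 + κ^|F| per colour. For empty F this is `value`
  -- itself.
  bound : ∀ {n} → Item n → ℚ
  bound (F , I) = (1ℚ + κ ^ ∣ F ∣) ^ ∣ I ∣

  0≤bound : ∀ {n} (i : Item n) → 0ℚ ≤ bound i
  0≤bound (F , I) = ^-nonNeg ∣ I ∣ (0≤+ 0≤1 (^-nonNeg ∣ F ∣ 0≤κ))

  value-restrict : ∀ {n} x L (i : Item (suc n)) → value (x ∷ L) i ≡ value L (restrict x i)
  value-restrict x L (inside  ∷ F , I) = cong (λ J → 2ℚ ^ ∣ J ∣) (sym (∩-assoc I x (inter F L)))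
  value-restrict x L (outside ∷ F , I) = refl

  restrict-disjoint : ∀ {n} x {i j : Item (suc n)} → Disjoint i j → Disjoint (restrict x i) (restrict x j)
  restrict-disjoint x {inside  ∷ F , I} {inside  ∷ G , J} h u p q = h (suc u) (there p) (there q)
  restrict-disjoint x {inside  ∷ F , I} {outside ∷ G , J} h u p q = h (suc u) (there p) (there q)
  restrict-disjoint x {outside ∷ F , I} {inside  ∷ G , J} h u p q = h (suc u) (there p) (there q)
  restrict-disjoint x {outside ∷ F , I} {outside ∷ G , J} h u p q = h (suc u) (there p) (there q)

  bound-restrict : ∀ {n} x (i : Item (suc n)) → zero ∉ proj₁ i → bound (restrict x i) ≡ bound i
  bound-restrict x (inside  ∷ F , I) 0∉ = contradiction here 0∉
  bound-restrict x (outside ∷ F , I) 0∉ = refl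

  -- By disjointness at most one item contains vertex `zero`, so all other bounds are constants and
  -- leave the average. For that one item `avg-pow` with a = κ^|F| supplies the missing factor κ.
  avg-bound : ∀ {n} (is : List (Item (suc n))) → AllPairs Disjoint is →
              avg Ω (λ x → ∏ is (bound ∘ restrict x)) ≤ ∏ is bound
  avg-bound [] [] = ℚ.≤-reflexive (avg-const Ω (subsetsOfSize-nonEmpty k≤σ) 1ℚ)
  avg-bound ((outside ∷ F , I) ∷ is) (_ ∷ ap) = begin
    avg Ω (λ x → bound (F , I) * ∏ is (bound ∘ restrict x))      ≡⟨ avg-*ˡ Ω (bound (F , I)) _ ⟩
    bound (F , I) * avg Ω (λ x → ∏ is (bound ∘ restrict x))      ≤⟨ *-monoˡ (0≤bound (F , I)) (avg-bound is ap) ⟩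
    bound (F , I) * ∏ is bound                                   ∎
    where open ℚ.≤-Reasoning
  avg-bound ((inside ∷ F , I) ∷ is) (dis ∷ ap) = begin
    avg Ω (λ x → bound (F , I ∩ x) * ∏ is (bound ∘ restrict x))  ≡⟨ avg-cong Ω (λ x → trans (cong (bound (F , I ∩ x) *_)
                                                                      (∏-cong is λ {i} i∈ → bound-restrict x i λ 0∈ → All.lookup dis i∈ zero here 0∈))
                                                                      (ℚ.*-comm (bound (F , I ∩ x)) (∏ is bound))) ⟩
    avg Ω (λ x → ∏ is bound * bound (F , I ∩ x))                 ≡⟨ avg-*ˡ Ω (∏ is bound) _ ⟩
    ∏ is bound * avg Ω (λ x → bound (F , I ∩ x))                 ≤⟨ *-monoˡ (∏-nonNeg is 0≤bound) (avg-pow (^-nonNeg ∣ F ∣ 0≤κ) I) ⟩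
    ∏ is bound * (1ℚ + κ ^ ∣ F ∣ * κ) ^ ∣ I ∣                    ≡⟨ cong (λ z → ∏ is bound * (1ℚ + z) ^ ∣ I ∣) (ℚ.*-comm (κ ^ ∣ F ∣) κ) ⟩
    ∏ is bound * bound (inside ∷ F , I)                          ≡⟨ ℚ.*-comm (∏ is bound) _ ⟩
    bound (inside ∷ F , I) * ∏ is bound                          ∎
    where open ℚ.≤-Reasoning

  -- Revealing one list at a time, ∏ bound ∘ restrict is a supermartingale.
  Avg-value : ∀ {n} (is : List (Item n)) → AllPairs Disjoint is →
              Avg (replicate n Ω) (λ L → ∏ is (value L)) ≤ ∏ is bound
  Avg-value {zero}  is ap = ℚ.≤-reflexive (∏-cong is λ { {[] , I} _ → cong (λ J → 2ℚ ^ ∣ J ∣) (∩-identityʳ I) })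
  Avg-value {suc n} is ap = begin
    avg Ω (λ x → Avg (replicate n Ω) (λ L → ∏ is (value (x ∷ L))))                  ≡⟨ avg-cong Ω (λ x → Avg-cong (replicate n Ω) λ L →
                                                                                         trans (∏-cong is λ {i} _ → value-restrict x L i)
                                                                                           (sym (∏-map (restrict x) is (value L)))) ⟩
    avg Ω (λ x → Avg (replicate n Ω) (λ L → ∏ (map (restrict x) is) (value L)))     ≤⟨ avg-mono Ω (λ {x} _ → Avg-value (map (restrict x) is)
                                                                                         (AllPairs.map⁺ (AllPairs.map (restrict-disjoint x) ap))) ⟩
    avg Ω (λ x → ∏ (map (restrict x) is) bound)                                     ≡⟨ avg-cong Ω (λ x → ∏-map (restrict x) is bound) ⟩
    avg Ω (λ x → ∏ is (bound ∘ restrict x))                                         ≤⟨ avg-bound is ap ⟩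
    ∏ is bound                                                                      ∎
    where open ℚ.≤-Reasoning

-- Bad colours

∣p∖x∣ : ∀ {n} {x : Fin n} (p : Subset n) → x ∈ p → suc ∣ p ∖ x ∣ ≡ ∣ p ∣
∣p∖x∣ (inside  ∷ p) here       = cong (suc ∘ ∣_∣) (p─⊥≡p p)
∣p∖x∣ (inside  ∷ p) (there x∈) = cong suc (∣p∖x∣ p x∈)
∣p∖x∣ (outside ∷ p) (there x∈) = ∣p∖x∣ p x∈

x∉p∖x : ∀ {n} (x : Fin n) (p : Subset n) → x ∉ p ∖ x
x∉p∖x (suc x) (_ ∷ p) (there x∈) = x∉p∖x x p x∈

∈∖⇒∈ : ∀ {n} {x : Fin n} y p → x ∈ p ∖ y → x ∈ p
∈∖⇒∈ y p = p─q⊆p p ⁅ y ⁆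

∈∖⇒≢ : ∀ {n} {x : Fin n} y p → x ∈ p ∖ y → x ≢ y
∈∖⇒≢ y p x∈ refl = x∉p∖x y p x∈

∣p∩q∣+∣p∩∁q∣ : ∀ {n} (p q : Subset n) → ∣ p ∩ q ∣ ℕ.+ ∣ p ∩ ∁ q ∣ ≡ ∣ p ∣
∣p∩q∣+∣p∩∁q∣ []            []            = refl
∣p∩q∣+∣p∩∁q∣ (inside  ∷ p) (inside  ∷ q) = cong suc (∣p∩q∣+∣p∩∁q∣ p q)
∣p∩q∣+∣p∩∁q∣ (inside  ∷ p) (outside ∷ q) = trans (ℕ.+-suc ∣ p ∩ q ∣ ∣ p ∩ ∁ q ∣) (cong suc (∣p∩q∣+∣p∩∁q∣ p q))
∣p∩q∣+∣p∩∁q∣ (outside ∷ p) (_       ∷ q) = ∣p∩q∣+∣p∩∁q∣ p q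

AllPairs-map-∈ : ∀ {A : Set} {R S : A → A → Set} {xs} → (∀ {x y} → x ∈ₗ xs → y ∈ₗ xs → R x y → S x y) →
                 AllPairs R xs → AllPairs S xs
AllPairs-map-∈ f []         = []
AllPairs-map-∈ f (rs ∷ ap) = All.tabulate (λ y∈ → f (here refl) (there y∈) (All.lookup rs y∈))
  ∷ AllPairs-map-∈ (λ x∈ y∈ → f (there x∈) (there y∈)) ap

∏-^ : ∀ {A : Set} (xs : List A) z (f : A → ℕ) → ∏ xs (λ x → z ^ f x) ≡ z ^ sum (map f xs)
∏-^ []       z f = refl
∏-^ (x ∷ xs) z f = trans (cong (z ^ f x *_) (∏-^ xs z f)) (sym (^-homo-* z (f x) (sum (map f xs))))

multiplicity : ∀ {σ} → Fin σ → List (Subset σ) → ℕ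
multiplicity c Js = length (filter (c ∈?_) Js)

multiplicity-suc : ∀ {σ} (c : Fin σ) (Js : List (Subset (suc σ))) →
                   multiplicity (suc c) Js ≡ multiplicity c (map Vec.tail Js)
multiplicity-suc c []             = refl
multiplicity-suc c ((_ ∷ J) ∷ Js) with does (c ∈? J)
... | true  = cong suc (multiplicity-suc c Js)
... | false = multiplicity-suc c Js

sum-∩-inside : ∀ {σ} (S : Subset σ) Js → sum (map (λ J → ∣ (inside ∷ S) ∩ J ∣) Js) ≡
               multiplicity zero Js ℕ.+ sum (map (λ J → ∣ S ∩ J ∣) (map Vec.tail Js))
sum-∩-inside S []                  = refl
sum-∩-inside S ((inside  ∷ J) ∷ Js) = cong suc (trans (cong (∣ S ∩ J ∣ ℕ.+_) (sum-∩-inside S Js)) (x∙yz≈y∙xz ∣ S ∩ J ∣ (multiplicity zero Js) _))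
sum-∩-inside S ((outside ∷ J) ∷ Js) = trans (cong (∣ S ∩ J ∣ ℕ.+_) (sum-∩-inside S Js)) (x∙yz≈y∙xz ∣ S ∩ J ∣ (multiplicity zero Js) _)

sum-∩-outside : ∀ {σ} (S : Subset σ) Js → sum (map (λ J → ∣ (outside ∷ S) ∩ J ∣) Js) ≡
                sum (map (λ J → ∣ S ∩ J ∣) (map Vec.tail Js))
sum-∩-outside S []             = refl
sum-∩-outside S ((_ ∷ J) ∷ Js) = cong (∣ S ∩ J ∣ ℕ.+_) (sum-∩-outside S Js)

-- Double counting of pairs (c, J) with c ∈ S ∩ J. The induction removes the first colour from all
-- sets simultaneously, which is why `map Vec.tail` appears.
*-∣∣≤sum-∩ : ∀ {σ} M (S : Subset σ) Js → (∀ c → c ∈ S → M ℕ.≤ multiplicity c Js) →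
             M ℕ.* ∣ S ∣ ℕ.≤ sum (map (λ J → ∣ S ∩ J ∣) Js)
*-∣∣≤sum-∩ M []            Js h = ℕ.≤-trans (ℕ.≤-reflexive (ℕ.*-zeroʳ M)) ℕ.z≤n
*-∣∣≤sum-∩ M (outside ∷ S) Js h = ℕ.≤-trans
  (*-∣∣≤sum-∩ M S (map Vec.tail Js) λ c c∈ → ℕ.≤-trans (h (suc c) (there c∈)) (ℕ.≤-reflexive (multiplicity-suc c Js)))
  (ℕ.≤-reflexive (sym (sum-∩-outside S Js)))
*-∣∣≤sum-∩ M (inside ∷ S) Js h = ℕ.≤-trans (ℕ.≤-reflexive (ℕ.*-suc M ∣ S ∣)) (ℕ.≤-trans
  (ℕ.+-mono-≤ (h zero here)
    (*-∣∣≤sum-∩ M S (map Vec.tail Js) λ c c∈ → ℕ.≤-trans (h (suc c) (there c∈)) (ℕ.≤-reflexive (multiplicity-suc c Js))))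
  (ℕ.≤-reflexive (sym (sum-∩-inside S Js))))

inter-cong : ∀ {n σ} (F : Subset n) (L L′ : ListAssignment n σ) →
             (∀ u → u ∈ F → lookup L u ≡ lookup L′ u) → inter F L ≡ inter F L′
inter-cong []            []      []        eq = refl
inter-cong (inside  ∷ F) (x ∷ L) (x′ ∷ L′) eq = cong₂ _∩_ (eq zero here) (inter-cong F L L′ λ u u∈ → eq (suc u) (there u∈))
inter-cong (outside ∷ F) (x ∷ L) (x′ ∷ L′) eq = inter-cong F L L′ λ u u∈ → eq (suc u) (there u∈)

link : ∀ {n} → Hypergraph n → Fin n → List (Subset n)
link H v = map (_∖ v) (filter (v ∈?_) (edges H))

module _ {n : ℕ} (H : Hypergraph n) (v : Fin n) where

  ∈-link : ∀ {F} → F ∈ₗ link H v → ∃[ E ] E ∈ₗ edges H × v ∈ E × F ≡ E ∖ v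
  ∈-link F∈ with E , E∈ , eq ← ∈-map⁻ (_∖ v) F∈ = E , proj₁ (∈-filter⁻ (v ∈?_) {xs = edges H} E∈) , proj₂ (∈-filter⁻ (v ∈?_) {xs = edges H} E∈) , eq

  link-∌ : ∀ {F} → F ∈ₗ link H v → v ∉ F
  link-∌ F∈ with E , _ , _ , refl ← ∈-link F∈ = x∉p∖x v E

  link-size : ∀ {m F} → Uniform (suc m) H → F ∈ₗ link H v → ∣ F ∣ ≡ m
  link-size unif F∈ with E , E∈ , v∈E , refl ← ∈-link F∈ = ℕ.suc-injective (trans (∣p∖x∣ E v∈E) (All.lookup unif E∈))

  -- Two edges at v already share v, so linearity forbids a second common vertex; `simple`
  -- guarantees that different entries of the list are different edges.
  link-disjoint : Linear H → AllPairs (λ F G → ∀ u → u ∈ F → u ∈ G → Empty) (link H v)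
  link-disjoint lin = AllPairs.map⁺ (AllPairs-map-∈ disjoint-pair (Unique.filter⁺ (v ∈?_) (simple H)))
    where
    disjoint-pair : ∀ {E F} → E ∈ₗ filter (v ∈?_) (edges H) → F ∈ₗ filter (v ∈?_) (edges H) → E ≢ F →
                    ∀ u → u ∈ E ∖ v → u ∈ F ∖ v → Empty
    disjoint-pair {E} {F} E∈ F∈ E≢F u u∈E u∈F =
      let E∈H , v∈E = ∈-filter⁻ (v ∈?_) {xs = edges H} E∈
          F∈H , v∈F = ∈-filter⁻ (v ∈?_) {xs = edges H} F∈
      in E≢F (lin u v (∈∖⇒≢ v E u∈E) E∈H F∈H (∈∖⇒∈ v E u∈E) v∈E (∈∖⇒∈ v F u∈F) v∈F)

  length-link≤maxDegree : length (link H v) ℕ.≤ maxDegree H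
  length-link≤maxDegree = ℕ.≤-trans (ℕ.≤-reflexive (List.length-map (_∖ v) (filter (v ∈?_) (edges H))))
    (All.lookup (xs≤max 0 (map (degree H) (allFin n))) (∈-map⁺ (degree H) (∈-allFin v)))

does-true : ∀ {P : Set} (P? : Dec P) → does P? ≡ true → P
does-true (yes p) _ = p

-- Counts the edges at v all of whose other vertices have c in their lists. The list at v itself
-- does not enter, so bad colours are independent of it.
colorDegree : ∀ {n σ} → Hypergraph n → ListAssignment n σ → Fin n → Fin σ → ℕ
colorDegree H L v c = multiplicity c (map (λ F → inter F L) (link H v))

badColors : ∀ {n σ} → ℕ → Hypergraph n → ListAssignment n σ → Fin n → Subset σ
badColors M H L v = Vec.tabulate λ c → does (M ℕ.≤? colorDegree H L v c)

module _ {n σ : ℕ} (M : ℕ) (H : Hypergraph n) (L : ListAssignment n σ) (v : Fin n) where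

  ∈-badColors : ∀ c → c ∈ badColors M H L v → M ℕ.≤ colorDegree H L v c
  ∈-badColors c c∈ = does-true (M ℕ.≤? colorDegree H L v c)
    (trans (sym (lookup∘tabulate (λ c → does (M ℕ.≤? colorDegree H L v c)) c)) ([]=⇒lookup c∈))

  ∉-badColors : ∀ c → c ∉ badColors M H L v → colorDegree H L v c ℕ.< M
  ∉-badColors c c∉ = ℕ.≰⇒> λ M≤ → c∉ (lookup⇒[]= c _
    (trans (lookup∘tabulate (λ c → does (M ℕ.≤? colorDegree H L v c)) c) (dec-true (M ℕ.≤? colorDegree H L v c) M≤)))

module Weight {n σ : ℕ} (H : Hypergraph n) (v : Fin n) (z : ℚ) (0≤z : 0ℚ ≤ z) where

  colorWeight : Subset σ → ListAssignment n σ → ℚ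
  colorWeight S L = ∏ (link H v) (λ F → 2ℚ ^ ∣ S ∩ inter F L ∣)

  term : Subset σ → ListAssignment n σ → Subset σ → ℚ
  term x L S = sub S x * (z ^ ∣ S ∣ * colorWeight S L)

  weight : ListAssignment n σ → ℚ
  weight L = ∑ (subsets σ) (term (lookup L v) L)

  0≤2^ : ∀ i → 0ℚ ≤ 2ℚ ^ i
  0≤2^ i = ^-nonNeg i (0≤+ 0≤1 0≤1)

  0≤term : ∀ x L S → 0ℚ ≤ term x L S
  0≤term x L S = 0≤* (0≤sub S x) (0≤* (^-nonNeg ∣ S ∣ 0≤z) (∏-nonNeg (link H v) λ F → 0≤2^ ∣ S ∩ inter F L ∣))

  0≤weight : ∀ L → 0ℚ ≤ weight L
  0≤weight L = ∑-nonNeg (subsets σ) (0≤term (lookup L v) L)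

  -- Only the term for S = B, the set of all bad colours in L(v), is kept. It has at least M |B|
  -- incidences, and z 2^M ≥ 1 allows the exponent |B| to be lowered to s.
  weight≥ : ∀ M s L → 1ℚ ≤ z * 2ℚ ^ M → s ℕ.≤ ∣ lookup L v ∩ badColors M H L v ∣ → (z * 2ℚ ^ M) ^ s ≤ weight L
  weight≥ M s L 1≤ s≤ = begin
    (z * 2ℚ ^ M) ^ s                            ≤⟨ ^-monoʳ-≤ 1≤ s≤ ⟩
    (z * 2ℚ ^ M) ^ ∣ B ∣                        ≡⟨ ^-distrib-* z (2ℚ ^ M) ∣ B ∣ ⟩
    z ^ ∣ B ∣ * (2ℚ ^ M) ^ ∣ B ∣                ≡⟨ cong (z ^ ∣ B ∣ *_) (^-assocʳ 2ℚ M ∣ B ∣) ⟩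
    z ^ ∣ B ∣ * 2ℚ ^ (M ℕ.* ∣ B ∣)              ≤⟨ *-monoˡ (^-nonNeg ∣ B ∣ 0≤z) (^-monoʳ-≤ 1≤2 (*-∣∣≤sum-∩ M B Js λ c c∈ →
                                                     ∈-badColors M H L v c (proj₂ (x∈p∩q⁻ (lookup L v) (badColors M H L v) c∈)))) ⟩
    z ^ ∣ B ∣ * 2ℚ ^ sum (map (λ J → ∣ B ∩ J ∣) Js)
                                                ≡⟨ cong (z ^ ∣ B ∣ *_) (∏-^ Js 2ℚ (λ J → ∣ B ∩ J ∣)) ⟨
    z ^ ∣ B ∣ * ∏ Js (λ J → 2ℚ ^ ∣ B ∩ J ∣)     ≡⟨ cong (z ^ ∣ B ∣ *_) (∏-map (λ F → inter F L) (link H v) (λ J → 2ℚ ^ ∣ B ∩ J ∣)) ⟩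
    z ^ ∣ B ∣ * colorWeight B L                 ≡⟨ ℚ.*-identityˡ _ ⟨
    1ℚ * (z ^ ∣ B ∣ * colorWeight B L)          ≡⟨ cong (_* (z ^ ∣ B ∣ * colorWeight B L)) (sub-⊆ B (lookup L v) (p∩q⊆p (lookup L v) (badColors M H L v))) ⟨
    term (lookup L v) L B                       ≤⟨ ∑-∈ (term (lookup L v) L) (0≤term (lookup L v) L) (∈-subsets B) ⟩
    weight L                                    ∎
    where
    open ℚ.≤-Reasoning
    B : Subset σ
    B = lookup L v ∩ badColors M H L v
    Js : List (Subset σ)
    Js = map (λ F → inter F L) (link H v)
    1≤2 : 1ℚ ≤ 2ℚ
    1≤2 = ℚ.<⇒≤ (p<p+ 0<1)

  module _ {m k : ℕ} (lin : Linear H) (unif : Uniform (suc m) H) (k≤σ : k ℕ.≤ σ)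
           (κ : ℚ) (0≤κ : 0ℚ ≤ κ) (κ≤1 : κ ≤ 1ℚ) (k≤κσ : fromℕℚ k ≤ κ * fromℕℚ σ)
           (small : z * (1ℚ + κ ^ m) ^ maxDegree H ≤ 1ℚ) where

    open RandomSubset k≤σ κ 0≤κ κ≤1 k≤κσ using (Ω)
    open EdgeMoments k≤σ κ 0≤κ κ≤1 k≤κσ using (Avg-value; bound; value)

    ΩΠ : Vec (List (Subset σ)) n
    ΩΠ = replicate n Ω

    -- After `Avg-value` each edge at v contributes (1 + κ^m)^|S|, so everything is the |S|-th power
    -- of z (1 + κ^m)^deg(v), a base that `small` keeps below 1.
    Avg-colorWeight : ∀ S → z ^ ∣ S ∣ * Avg ΩΠ (colorWeight S) ≤ 1ℚ
    Avg-colorWeight S = begin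
      z ^ ∣ S ∣ * Avg ΩΠ (colorWeight S)                     ≡⟨ cong (z ^ ∣ S ∣ *_) (Avg-cong ΩΠ λ L → ∏-map (_, S) (link H v) (value L)) ⟨
      z ^ ∣ S ∣ * Avg ΩΠ (λ L → ∏ is (value L))              ≤⟨ *-monoˡ (^-nonNeg ∣ S ∣ 0≤z) (Avg-value is (AllPairs.map⁺ (link-disjoint H v lin))) ⟩
      z ^ ∣ S ∣ * ∏ is bound                                 ≡⟨ cong (z ^ ∣ S ∣ *_) (trans (∏-map (_, S) (link H v) bound)
                                                                  (trans (∏-cong (link H v) λ F∈ → cong (λ i → (1ℚ + κ ^ i) ^ ∣ S ∣) (link-size H v unif F∈))
                                                                    (∏-const (link H v) (w ^ ∣ S ∣)))) ⟩
      z ^ ∣ S ∣ * (w ^ ∣ S ∣) ^ length (link H v)            ≡⟨ cong (z ^ ∣ S ∣ *_) (trans (^-assocʳ w ∣ S ∣ (length (link H v)))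
                                                                  (trans (cong (w ^_) (ℕ.*-comm ∣ S ∣ (length (link H v)))) (sym (^-assocʳ w (length (link H v)) ∣ S ∣)))) ⟩
      z ^ ∣ S ∣ * (w ^ length (link H v)) ^ ∣ S ∣            ≡⟨ ^-distrib-* z (w ^ length (link H v)) ∣ S ∣ ⟨
      (z * w ^ length (link H v)) ^ ∣ S ∣                    ≤⟨ ^-monoˡ-≤ ∣ S ∣ (0≤* 0≤z (^-nonNeg (length (link H v)) 0≤w)) (ℚ.≤-trans
                                                                  (*-monoˡ 0≤z (^-monoʳ-≤ 1≤w (length-link≤maxDegree H v))) small) ⟩
      1ℚ ^ ∣ S ∣                                             ≡⟨ 1^ ∣ S ∣ ⟩
      1ℚ                                                     ∎
      where
      open ℚ.≤-Reasoning
      is : List (Subset n × Subset σ)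
      is = map (_, S) (link H v)
      w : ℚ
      w = 1ℚ + κ ^ m
      1≤w : 1ℚ ≤ w
      1≤w = le≡ (solve 1 (λ x → (con 1ℚ :+ x) :- con 1ℚ := x) refl (κ ^ m)) (^-nonNeg m 0≤κ)
      0≤w : 0ℚ ≤ w
      0≤w = ℚ.≤-trans 0≤1 1≤w

    colorWeight-cong : ∀ S L L′ → (∀ u → u ≢ v → lookup L u ≡ lookup L′ u) → colorWeight S L ≡ colorWeight S L′
    colorWeight-cong S L L′ eq = ∏-cong (link H v) λ {F} F∈ →
      cong (λ J → 2ℚ ^ ∣ S ∩ J ∣) (inter-cong F L L′ λ u u∈ → eq u λ { refl → link-∌ H v F∈ u∈ })

    -- `colorWeight` ignores the list at v, so that list can be fixed to a k-set x. Each of the 2^k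
    -- subsets of x then contributes at most 1 on average.
    Avg-weight : Avg ΩΠ weight ≤ 2ℚ ^ k
    Avg-weight = begin
      Avg ΩΠ weight                                                  ≡⟨ Avg-decouple ΩΠ (λ u → subst (λ xs → 0 ℕ.< length xs) (sym (lookup-replicate u Ω)) (subsetsOfSize-nonEmpty k≤σ))
                                                                          v (λ x L → ∑ (subsets σ) (term x L))
                                                                          (λ x L L′ eq → ∑-cong (subsets σ) λ S → cong (λ y → sub S x * (z ^ ∣ S ∣ * y)) (colorWeight-cong S L L′ eq)) ⟩
      avg (lookup ΩΠ v) (λ x → Avg ΩΠ (λ L → ∑ (subsets σ) (term x L)))
                                                                     ≡⟨ cong (λ xs → avg xs (λ x → Avg ΩΠ (λ L → ∑ (subsets σ) (term x L)))) (lookup-replicate v Ω) ⟩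
      avg Ω (λ x → Avg ΩΠ (λ L → ∑ (subsets σ) (term x L)))          ≤⟨ avg-mono Ω (λ {x} x∈ → pointwise x (proj₂ (∈-filter⁻ (λ S → ∣ S ∣ ℕ.≟ k) {xs = subsets σ} x∈))) ⟩
      avg Ω (λ _ → 2ℚ ^ k)                                           ≡⟨ avg-const Ω (subsetsOfSize-nonEmpty k≤σ) (2ℚ ^ k) ⟩
      2ℚ ^ k                                                         ∎
      where
      open ℚ.≤-Reasoning
      pointwise : ∀ x → ∣ x ∣ ≡ k → Avg ΩΠ (λ L → ∑ (subsets σ) (term x L)) ≤ 2ℚ ^ k
      pointwise x ∣x∣≡k = begin
        Avg ΩΠ (λ L → ∑ (subsets σ) (term x L))                      ≡⟨ Avg-∑ ΩΠ (subsets σ) (λ S L → term x L S) ⟩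
        ∑ (subsets σ) (λ S → Avg ΩΠ (λ L → term x L S))              ≡⟨ ∑-cong (subsets σ) (λ S → trans (Avg-*ˡ ΩΠ (sub S x) (λ L → z ^ ∣ S ∣ * colorWeight S L))
                                                                          (cong (sub S x *_) (Avg-*ˡ ΩΠ (z ^ ∣ S ∣) (colorWeight S)))) ⟩
        ∑ (subsets σ) (λ S → sub S x * (z ^ ∣ S ∣ * Avg ΩΠ (colorWeight S)))
                                                                     ≤⟨ ∑-mono (subsets σ) (λ {S} _ → *-monoˡ (0≤sub S x)
                                                                          (ℚ.≤-trans (Avg-colorWeight S) (ℚ.≤-reflexive (sym (1^ ∣ S ∣))))) ⟩
        ∑ (subsets σ) (λ S → sub S x * 1ℚ ^ ∣ S ∣)                   ≡⟨ binomial 1ℚ x ⟩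
        2ℚ ^ ∣ x ∣                                                   ≡⟨ cong (2ℚ ^_) ∣x∣≡k ⟩
        2ℚ ^ k                                                       ∎

-- Colouring from lists of bounded colour degree

elements : ∀ {σ} → Subset σ → List (Fin σ)
elements []            = []
elements (inside  ∷ S) = zero ∷ map suc (elements S)
elements (outside ∷ S) = map suc (elements S)

length-elements : ∀ {σ} (S : Subset σ) → length (elements S) ≡ ∣ S ∣
length-elements []            = refl
length-elements (inside  ∷ S) = cong suc (trans (List.length-map suc (elements S)) (length-elements S))
length-elements (outside ∷ S) = trans (List.length-map suc (elements S)) (length-elements S)

∈-elements⁺ : ∀ {σ} {c : Fin σ} {S} → c ∈ S → c ∈ₗ elements S
∈-elements⁺ {S = inside  ∷ S} here       = here refl
∈-elements⁺ {S = inside  ∷ S} (there c∈) = there (∈-map⁺ suc (∈-elements⁺ c∈))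
∈-elements⁺ {S = outside ∷ S} (there c∈) = ∈-map⁺ suc (∈-elements⁺ c∈)

∈-elements⁻ : ∀ {σ} {c : Fin σ} S → c ∈ₗ elements S → c ∈ S
∈-elements⁻ (inside  ∷ S) (here refl) = here
∈-elements⁻ (inside  ∷ S) (there c∈) with _ , d∈ , refl ← ∈-map⁻ suc c∈ = there (∈-elements⁻ S d∈)
∈-elements⁻ (outside ∷ S) c∈         with _ , d∈ , refl ← ∈-map⁻ suc c∈ = there (∈-elements⁻ S d∈)

∑-elements : ∀ {σ} (S : Subset σ) c → ∑ (elements S) (λ x → ind (x Fin.≟ c)) ≡ ind (c ∈? S)
∑-elements (inside ∷ S) zero = trans (cong (λ y → 1ℚ + y) (trans (∑-map suc (elements S) _) (∑-0 (elements S)))) (ℚ.+-identityʳ 1ℚ)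
∑-elements (outside ∷ S) zero    = trans (∑-map suc (elements S) _) (∑-0 (elements S))
∑-elements (inside  ∷ S) (suc c) = trans (ℚ.+-identityˡ _) (trans (∑-map suc (elements S) _) (∑-elements S c))
∑-elements (outside ∷ S) (suc c) = trans (∑-map suc (elements S) _) (∑-elements S c)

∑-ind : ∀ {σ} c (Js : List (Subset σ)) → ∑ Js (λ J → ind (c ∈? J)) ≡ fromℕℚ (multiplicity c Js)
∑-ind c []       = refl
∑-ind c (J ∷ Js) with does (c ∈? J)
... | true  = trans (cong (λ y → 1ℚ + y) (∑-ind c Js)) (sym (fromℕℚ-suc (multiplicity c Js)))
... | false = trans (ℚ.+-identityˡ _) (∑-ind c Js)

ind-∩ : ∀ {σ} (c : Fin σ) S T → ind (c ∈? (S ∩ T)) ≡ ind (c ∈? S) * ind (c ∈? T)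
ind-∩ zero    (inside  ∷ S) (inside  ∷ T) = refl
ind-∩ zero    (inside  ∷ S) (outside ∷ T) = refl
ind-∩ zero    (outside ∷ S) (t       ∷ T) = sym (ℚ.*-zeroˡ (ind (zero ∈? (t ∷ T))))
ind-∩ (suc c) (_       ∷ S) (_       ∷ T) = ind-∩ c S T

match : ∀ {n σ} → Subset n → Vec (Fin σ) n → Fin σ → ℚ
match []            []      c = 1ℚ
match (inside  ∷ F) (y ∷ φ) c = ind (y Fin.≟ c) * match F φ c
match (outside ∷ F) (y ∷ φ) c = match F φ c

0≤match : ∀ {n σ} (F : Subset n) (φ : Vec (Fin σ) n) c → 0ℚ ≤ match F φ c
0≤match []            []      c = 0≤1
0≤match (inside  ∷ F) (y ∷ φ) c = 0≤* (0≤ind (y Fin.≟ c)) (0≤match F φ c)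
0≤match (outside ∷ F) (y ∷ φ) c = 0≤match F φ c

match≡1 : ∀ {n σ} (F : Subset n) (φ : Vec (Fin σ) n) c → (∀ u → u ∈ F → lookup φ u ≡ c) → match F φ c ≡ 1ℚ
match≡1 []            []      c eq = refl
match≡1 (inside  ∷ F) (y ∷ φ) c eq = cong₂ _*_ (ind-yes (y Fin.≟ c) (eq zero here)) (match≡1 F φ c λ u u∈ → eq (suc u) (there u∈))
match≡1 (outside ∷ F) (y ∷ φ) c eq = match≡1 F φ c λ u u∈ → eq (suc u) (there u∈)

match-cong : ∀ {n σ} (F : Subset n) (φ ψ : Vec (Fin σ) n) c → (∀ u → u ∈ F → lookup φ u ≡ lookup ψ u) → match F φ c ≡ match F ψ c
match-cong []            []      []      c eq = refl
match-cong (inside  ∷ F) (y ∷ φ) (z ∷ ψ) c eq = cong₂ (λ y m → ind (y Fin.≟ c) * m) (eq zero here) (match-cong F φ ψ c λ u u∈ → eq (suc u) (there u∈))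
match-cong (outside ∷ F) (y ∷ φ) (z ∷ ψ) c eq = match-cong F φ ψ c λ u u∈ → eq (suc u) (there u∈)

elementLists : ∀ {n σ} → ListAssignment n σ → Vec (List (Fin σ)) n
elementLists = Vec.map elements

module RandomColoring (q : ℚ) (0≤q : 0ℚ ≤ q) where

  Spread : ∀ {n σ} → ListAssignment n σ → Set
  Spread G = ∀ u → 0 ℕ.< ∣ lookup G u ∣ × 1/length (elements (lookup G u)) ≤ q

  nonEmpty : ∀ {n σ} {G : ListAssignment n σ} → Spread G → AllNonEmpty (elementLists G)
  nonEmpty {G = G} sp u = subst (0 ℕ.<_) (sym (trans (cong length (lookup-map u elements G)) (length-elements (lookup G u)))) (proj₁ (sp u))

  -- Independence of f from the colours on F. All of F receives colour c with probability 0 if some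
  -- list on F misses c, and otherwise with a product of reciprocal list sizes, each at most q.
  Avg-match : ∀ {n σ} (G : ListAssignment n σ) → Spread G → ∀ F c (f : Vec (Fin σ) n → ℚ) → (∀ φ → 0ℚ ≤ f φ) →
    (∀ φ ψ → (∀ u → u ∉ F → lookup φ u ≡ lookup ψ u) → f φ ≡ f ψ) →
    Avg (elementLists G) (λ φ → f φ * match F φ c) ≤ Avg (elementLists G) f * (q ^ ∣ F ∣ * ind (c ∈? inter F G))
  Avg-match {σ = σ} [] sp [] c f 0≤f inv = ℚ.≤-reflexive (cong (f [] *_) (sym (cong (1ℚ *_) (ind-yes (c ∈? ⊤ {σ}) ∈⊤))))
  Avg-match (g ∷ G) sp (outside ∷ F) c f 0≤f inv = begin
    avg (elements g) (λ y → Avg gs (λ φ → f (y ∷ φ) * match F φ c))      ≤⟨ avg-mono (elements g) (λ {y} _ → Avg-match G (sp ∘ suc) F c (λ φ → f (y ∷ φ)) (λ φ → 0≤f (y ∷ φ))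
                                                                              λ φ ψ eq → inv (y ∷ φ) (y ∷ ψ) λ { zero _ → refl ; (suc u) u∉ → eq u (u∉ ∘ there) }) ⟩
    avg (elements g) (λ y → Avg gs (λ φ → f (y ∷ φ)) * K)                ≡⟨ avg-cong (elements g) (λ y → ℚ.*-comm (Avg gs (λ φ → f (y ∷ φ))) K) ⟩
    avg (elements g) (λ y → K * Avg gs (λ φ → f (y ∷ φ)))                ≡⟨ avg-*ˡ (elements g) K (λ y → Avg gs (λ φ → f (y ∷ φ))) ⟩
    K * avg (elements g) (λ y → Avg gs (λ φ → f (y ∷ φ)))                ≡⟨ ℚ.*-comm K _ ⟩
    Avg (elements g ∷ gs) f * K                                          ∎
    where
    open ℚ.≤-Reasoning
    gs = elementLists G
    K : ℚ
    K = q ^ ∣ F ∣ * ind (c ∈? inter F G)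
  Avg-match (g ∷ G) sp (inside ∷ F) c f 0≤f inv = begin
    avg (elements g) (λ y → Avg gs (λ φ → f (y ∷ φ) * (ind (y Fin.≟ c) * match F φ c)))
                                                                         ≡⟨ avg-cong (elements g) (λ y → trans
                                                                              (Avg-cong gs λ φ → trans (cong (_* (ind (y Fin.≟ c) * match F φ c)) (head-irrelevant y φ))
                                                                                (solve 3 (λ a b c → a :* (b :* c) := b :* (a :* c)) refl (f (c ∷ φ)) (ind (y Fin.≟ c)) (match F φ c)))
                                                                              (trans (Avg-*ˡ gs (ind (y Fin.≟ c)) (λ φ → f (c ∷ φ) * match F φ c)) (ℚ.*-comm (ind (y Fin.≟ c)) B))) ⟩
    avg (elements g) (λ y → B * ind (y Fin.≟ c))                         ≡⟨ avg-*ˡ (elements g) B (λ y → ind (y Fin.≟ c)) ⟩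
    B * (1/length (elements g) * ∑ (elements g) (λ y → ind (y Fin.≟ c))) ≡⟨ cong (λ z → B * (1/length (elements g) * z)) (∑-elements g c) ⟩
    B * (1/length (elements g) * ind (c ∈? g))                           ≤⟨ *-mono (0≤* (0≤1/length (elements g)) (0≤ind (c ∈? g)))
                                                                              (0≤* (Avg-nonNeg gs λ φ → 0≤f (c ∷ φ)) (0≤* (^-nonNeg ∣ F ∣ 0≤q) (0≤ind (c ∈? inter F G))))
                                                                              (Avg-match G (sp ∘ suc) F c (λ φ → f (c ∷ φ)) (λ φ → 0≤f (c ∷ φ))
                                                                                λ φ ψ eq → inv (c ∷ φ) (c ∷ ψ) λ { zero _ → refl ; (suc u) u∉ → eq u (u∉ ∘ there) })
                                                                              (*-monoʳ (0≤ind (c ∈? g)) (proj₂ (sp zero))) ⟩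
    Avg gs (λ φ → f (c ∷ φ)) * (q ^ ∣ F ∣ * ind (c ∈? inter F G)) * (q * ind (c ∈? g))
                                                                         ≡⟨ solve 5 (λ a u i q j → a :* (u :* i) :* (q :* j) := a :* (q :* u :* (j :* i))) refl
                                                                              (Avg gs (λ φ → f (c ∷ φ))) (q ^ ∣ F ∣) (ind (c ∈? inter F G)) q (ind (c ∈? g)) ⟩
    Avg gs (λ φ → f (c ∷ φ)) * (q * q ^ ∣ F ∣ * (ind (c ∈? g) * ind (c ∈? inter F G)))
                                                                         ≡⟨ cong₂ (λ a i → a * (q * q ^ ∣ F ∣ * i)) average (ind-∩ c g (inter F G)) ⟨
    Avg (elements g ∷ gs) f * (q * q ^ ∣ F ∣ * ind (c ∈? (g ∩ inter F G))) ∎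
    where
    open ℚ.≤-Reasoning
    gs = elementLists G
    B : ℚ
    B = Avg gs (λ φ → f (c ∷ φ) * match F φ c)
    -- The head lies in F and f does not read it, so a dummy value will do; c is at hand.
    head-irrelevant : ∀ y φ → f (y ∷ φ) ≡ f (c ∷ φ)
    head-irrelevant y φ = inv (y ∷ φ) (c ∷ φ) λ { zero 0∉ → contradiction here 0∉ ; (suc u) _ → refl }
    average : Avg (elements g ∷ gs) f ≡ Avg gs (λ φ → f (c ∷ φ))
    average = trans (avg-cong (elements g) λ y → Avg-cong gs (head-irrelevant y))
      (avg-const (elements g) (subst (0 ℕ.<_) (sym (length-elements g)) (proj₁ (sp zero))) _)

-- Set difference as repeated removal of one vertex, the form in which `Q-removeAll` collects one
-- factor ρ per vertex.
removeAll : ∀ {n} → List (Fin n) → Subset n → Subset n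
removeAll us X = foldr (λ u Y → Y ∖ u) X us

removeAll-⊆ : ∀ {n} us (X : Subset n) → removeAll us X ⊆ X
removeAll-⊆ []       X x∈ = x∈
removeAll-⊆ (u ∷ us) X x∈ = removeAll-⊆ us X (∈∖⇒∈ u (removeAll us X) x∈)

∉-removeAll : ∀ {n} us (X : Subset n) {u} → u ∈ₗ us → u ∉ removeAll us X
∉-removeAll (u ∷ us) X (here refl) = x∉p∖x u (removeAll us X)
∉-removeAll (w ∷ us) X (there u∈)  = λ u∈′ → ∉-removeAll us X u∈ (∈∖⇒∈ w (removeAll us X) u∈′)

monochromatic? : ∀ {n σ} (φ : Vec (Fin σ) n) E → Dec (Monochromatic φ E)
monochromatic? φ E = Fin.any? λ c → Fin.all? λ v → (v ∈? E) →-dec (lookup φ v Fin.≟ c)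

nonEmptySubset : ∀ {n m} (E : Subset n) → ∣ E ∣ ≡ suc m → ∃[ v ] v ∈ E
nonEmptySubset (inside  ∷ E) eq = zero , here
nonEmptySubset (outside ∷ E) eq = let v , v∈ = nonEmptySubset E eq in suc v , there v∈

-- Q X is the probability that a uniformly random colouring from the lists G has no
-- monochromatic edge inside X.  Removing a vertex from X multiplies Q by at most ρ,
-- by induction on ∣ X ∣: what is lost is that some F ∪ {v} is monochromatic, and this is
-- independent of having no monochromatic edge inside X ∖ F.
module ColorDegrees {n σ m D : ℕ} (H : Hypergraph n) (unif : Uniform (suc m) H) (G : ListAssignment n σ)
  (q ρ : ℚ) (0≤q : 0ℚ ≤ q) (1≤ρ : 1ℚ ≤ ρ) (gap : 1ℚ ≤ ρ * (1ℚ - fromℕℚ D * (ρ * q) ^ m))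
  (spread : RandomColoring.Spread q 0≤q G)
  (degrees : ∀ v c → c ∈ lookup G v → colorDegree H G v c ℕ.≤ D)
  where

  open RandomColoring q 0≤q using (Avg-match; nonEmpty)

  gs : Vec (List (Fin σ)) n
  gs = elementLists G

  Good : Subset n → Vec (Fin σ) n → Set
  Good X φ = All (λ E → E ⊆ X → ¬ Monochromatic φ E) (edges H)

  good? : ∀ X φ → Dec (Good X φ)
  good? X φ = All.all? (λ E → (E ⊆? X) →-dec ¬? (monochromatic? φ E)) (edges H)

  good : Subset n → Vec (Fin σ) n → ℚ
  good X φ = ind (good? X φ)

  0≤good : ∀ X φ → 0ℚ ≤ good X φ
  0≤good X φ = 0≤ind (good? X φ)

  good-anti : ∀ {X Y} φ → Y ⊆ X → good X φ ≤ good Y φ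
  good-anti {X} {Y} φ Y⊆X = ind-mono (good? X φ) (good? Y φ) (All.map λ h E⊆Y → h (Y⊆X ∘ E⊆Y))

  good-local : ∀ X φ ψ → (∀ u → u ∈ X → lookup φ u ≡ lookup ψ u) → good X φ ≡ good X ψ
  good-local X φ ψ eq = ℚ.≤-antisym
    (ind-mono (good? X φ) (good? X ψ) (All.map (transport φ ψ eq)))
    (ind-mono (good? X ψ) (good? X φ) (All.map (transport ψ φ λ u u∈ → sym (eq u u∈))))
    where
    transport : ∀ φ ψ {E} → (∀ u → u ∈ X → lookup φ u ≡ lookup ψ u) →
                (E ⊆ X → ¬ Monochromatic φ E) → E ⊆ X → ¬ Monochromatic ψ E
    transport φ ψ eq h E⊆X (c , mono) = h E⊆X (c , λ u u∈ → trans (eq u (E⊆X u∈)) (mono u u∈))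

  Q : Subset n → ℚ
  Q X = Avg gs (good X)

  0≤Q : ∀ X → 0ℚ ≤ Q X
  0≤Q X = Avg-nonNeg gs (0≤good X)

  without : Subset n → Subset n → Subset n
  without X F = removeAll (elements F) X

  -- Requiring goodness only off F, instead of on all of X ∖ v, overestimates the loss but makes the
  -- first factor independent of the colours on F and at v.
  lost : Subset n → Fin n → Vec (Fin σ) n → Subset n → ℚ
  lost X v φ F = good (without (X ∖ v) F) φ * match F φ (lookup φ v)

  0≤lost : ∀ X v φ F → 0ℚ ≤ lost X v φ F
  0≤lost X v φ F = 0≤* (0≤good (without (X ∖ v) F) φ) (0≤match F φ (lookup φ v))

  -- If X ∖ v is good and X is not, then a monochromatic edge inside X must contain v, and its
  -- remaining vertices form a member of `link H v` coloured like v.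
  good-∖ : ∀ X v φ → good (X ∖ v) φ ≤ good X φ + ∑ (link H v) (lost X v φ)
  good-∖ X v φ = by (any? (λ E → (E ⊆? X) ×-dec monochromatic? φ E) (edges H)) (good? (X ∖ v) φ)
    where
    0≤∑ : 0ℚ ≤ ∑ (link H v) (lost X v φ)
    0≤∑ = ∑-nonNeg (link H v) (0≤lost X v φ)

    by : Dec (Any (λ E → E ⊆ X × Monochromatic φ E) (edges H)) → (g? : Dec (Good (X ∖ v) φ)) →
         ind g? ≤ good X φ + ∑ (link H v) (lost X v φ)
    by (no none) g? = ℚ.≤-trans (ind≤1 g?) (ℚ.≤-trans
      (ℚ.≤-reflexive (sym (trans (ℚ.+-identityʳ (good X φ)) (ind-yes (good? X φ)
        (All.tabulate λ E∈ E⊆X mono → none (lose E∈ ((λ {u} → E⊆X {u}) , mono)))))))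
      (ℚ.+-monoʳ-≤ (good X φ) 0≤∑))
    by (yes some) (no _)   = 0≤+ (0≤good X φ) 0≤∑
    by (yes some) (yes gd) = found (find some)
      where
      found : ∃[ E ] E ∈ₗ edges H × E ⊆ X × Monochromatic φ E → 1ℚ ≤ good X φ + ∑ (link H v) (lost X v φ)
      found (E , E∈ , E⊆X , c , mono) = ℚ.≤-trans
        (ℚ.≤-reflexive (sym (cong₂ _*_ (ℚ.≤-antisym (ind≤1 (good? (without (X ∖ v) F) φ))
          (ℚ.≤-trans (ℚ.≤-reflexive (sym (ind-yes (good? (X ∖ v) φ) gd))) (good-anti φ (removeAll-⊆ (elements F) (X ∖ v)))))
          (match≡1 F φ (lookup φ v) λ u u∈ → trans (mono u (∈∖⇒∈ v E u∈)) (sym (mono v v∈E))))))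
        (ℚ.≤-trans (∑-∈ (lost X v φ) (0≤lost X v φ) (∈-map⁺ (_∖ v) (∈-filter⁺ (v ∈?_) E∈ v∈E)))
          (subst (_≤ good X φ + ∑ (link H v) (lost X v φ)) (ℚ.+-identityˡ (∑ (link H v) (lost X v φ)))
            (ℚ.+-monoˡ-≤ (∑ (link H v) (lost X v φ)) (0≤good X φ))))
        where
        F : Subset n
        F = E ∖ v
        v∈E : v ∈ E
        v∈E with v ∈? E
        ... | yes v∈ = v∈
        ... | no v∉  = contradiction (c , mono) (All.lookup gd E∈ λ {u} u∈ → x∈p∧x≢y⇒x∈p-y (E⊆X u∈) λ { refl → v∉ u∈ })

  -- Neither factor of `lost` reads the colour at v other than as the target colour x, so
  -- `Avg-decouple` applies, followed by `Avg-match`. The average over x is kept because only the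
  -- sum over F for a fixed colour x is bounded by the colour degree.
  Avg-lost : ∀ X v F → F ∈ₗ link H v →
             Avg gs (λ φ → lost X v φ F) ≤ avg (elements (lookup G v)) (λ x → Q (without (X ∖ v) F) * (q ^ m * ind (x ∈? inter F G)))
  Avg-lost X v F F∈ = begin
    Avg gs (λ φ → lost X v φ F)                                              ≡⟨ Avg-decouple gs (nonEmpty {G = G} spread) v (λ x φ → good Y φ * match F φ x) (λ x φ ψ eq →
                                                                                  cong₂ _*_ (good-local Y φ ψ λ u u∈ → eq u (∈∖⇒≢ v X (removeAll-⊆ (elements F) (X ∖ v) u∈)))
                                                                                    (match-cong F φ ψ x λ u u∈ → eq u λ { refl → link-∌ H v F∈ u∈ })) ⟩
    avg (lookup gs v) (λ x → Avg gs (λ φ → good Y φ * match F φ x))          ≡⟨ cong (λ xs → avg xs (λ x → Avg gs (λ φ → good Y φ * match F φ x))) (lookup-map v elements G) ⟩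
    avg (elements (lookup G v)) (λ x → Avg gs (λ φ → good Y φ * match F φ x))
                                                                             ≤⟨ avg-mono (elements (lookup G v)) (λ {x} _ → Avg-match G spread F x (good Y) (0≤good Y) λ φ ψ eq →
                                                                                  good-local Y φ ψ λ u u∈ → eq u λ u∈F → ∉-removeAll (elements F) (X ∖ v) (∈-elements⁺ u∈F) u∈) ⟩
    avg (elements (lookup G v)) (λ x → Q Y * (q ^ ∣ F ∣ * ind (x ∈? inter F G)))
                                                                             ≡⟨ cong (λ i → avg (elements (lookup G v)) (λ x → Q Y * (q ^ i * ind (x ∈? inter F G)))) (link-size H v unif F∈) ⟩
    avg (elements (lookup G v)) (λ x → Q Y * (q ^ m * ind (x ∈? inter F G))) ∎
    where
    open ℚ.≤-Reasoning
    Y : Subset n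
    Y = without (X ∖ v) F

  0≤ρ : 0ℚ ≤ ρ
  0≤ρ = ℚ.≤-trans 0≤1 1≤ρ

  -- The one-vertex bound is a hypothesis restricted to sets of size at most t, so that the lemma
  -- can be used inside the induction that proves this bound.
  Q-removeAll : ∀ t → (∀ X → ∣ X ∣ ℕ.≤ t → ∀ v → Q (X ∖ v) ≤ ρ * Q X) →
                ∀ X → ∣ X ∣ ℕ.≤ t → ∀ us → Q (removeAll us X) ≤ ρ ^ length us * Q X
  Q-removeAll t step X X≤t []       = ℚ.≤-reflexive (sym (ℚ.*-identityˡ (Q X)))
  Q-removeAll t step X X≤t (u ∷ us) = begin
    Q (removeAll us X ∖ u)            ≤⟨ step (removeAll us X) (ℕ.≤-trans (p⊆q⇒∣p∣≤∣q∣ (removeAll-⊆ us X)) X≤t) u ⟩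
    ρ * Q (removeAll us X)            ≤⟨ *-monoˡ 0≤ρ (Q-removeAll t step X X≤t us) ⟩
    ρ * (ρ ^ length us * Q X)         ≡⟨ ℚ.*-assoc ρ (ρ ^ length us) (Q X) ⟨
    ρ * ρ ^ length us * Q X           ∎
    where open ℚ.≤-Reasoning

  -- Putting back the m vertices of F costs ρ^m, and colouring them like v has probability at most
  -- q^m. For a fixed colour x at v the surviving indicators add up to its colour degree, at most D.
  Q-lost : ∀ t → (∀ X → ∣ X ∣ ℕ.≤ t → ∀ v → Q (X ∖ v) ≤ ρ * Q X) →
           ∀ X v → ∣ X ∖ v ∣ ℕ.≤ t → Avg gs (λ φ → ∑ (link H v) (lost X v φ)) ≤ fromℕℚ D * (ρ * q) ^ m * Q (X ∖ v)
  Q-lost t step X v X≤t = begin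
    Avg gs (λ φ → ∑ (link H v) (lost X v φ))                   ≡⟨ Avg-∑ gs (link H v) (λ F φ → lost X v φ F) ⟩
    ∑ (link H v) (λ F → Avg gs (λ φ → lost X v φ F))           ≤⟨ ∑-mono (link H v) (λ {F} F∈ → ℚ.≤-trans (Avg-lost X v F F∈) (avg-mono els λ {x} _ → each F F∈ x)) ⟩
    ∑ (link H v) (λ F → avg els (λ x → K * ind (x ∈? inter F G)))
                                                               ≡⟨ ∑-avg (link H v) els (λ x F → K * ind (x ∈? inter F G)) ⟩
    avg els (λ x → ∑ (link H v) (λ F → K * ind (x ∈? inter F G)))
                                                               ≡⟨ avg-cong els (λ x → trans (∑-*ˡ (link H v) K (λ F → ind (x ∈? inter F G)))
                                                                    (cong (K *_) (trans (sym (∑-map (λ F → inter F G) (link H v) (λ J → ind (x ∈? J))))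
                                                                      (∑-ind x (map (λ F → inter F G) (link H v)))))) ⟩
    avg els (λ x → K * fromℕℚ (colorDegree H G v x))           ≤⟨ avg-mono els (λ {x} x∈ → *-monoˡ 0≤K (fromℕℚ-mono (degrees v x (∈-elements⁻ (lookup G v) x∈)))) ⟩
    avg els (λ x → K * fromℕℚ D)                               ≡⟨ avg-const els (subst (0 ℕ.<_) (sym (length-elements (lookup G v))) (proj₁ (spread v))) (K * fromℕℚ D) ⟩
    K * fromℕℚ D                                               ≡⟨ solve 3 (λ x y d → x :* y :* d := d :* x :* y) refl ((ρ * q) ^ m) (Q (X ∖ v)) (fromℕℚ D) ⟩
    fromℕℚ D * (ρ * q) ^ m * Q (X ∖ v)                         ∎
    where
    open ℚ.≤-Reasoning
    els : List (Fin σ)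
    els = elements (lookup G v)
    K : ℚ
    K = (ρ * q) ^ m * Q (X ∖ v)
    0≤K : 0ℚ ≤ K
    0≤K = 0≤* (^-nonNeg m (0≤* 0≤ρ 0≤q)) (0≤Q (X ∖ v))
    each : ∀ F → F ∈ₗ link H v → ∀ x → Q (without (X ∖ v) F) * (q ^ m * ind (x ∈? inter F G)) ≤ K * ind (x ∈? inter F G)
    each F F∈ x = begin
      Q (without (X ∖ v) F) * (q ^ m * i)        ≤⟨ *-monoʳ (0≤* (^-nonNeg m 0≤q) (0≤ind (x ∈? inter F G))) (Q-removeAll t step (X ∖ v) X≤t (elements F)) ⟩
      ρ ^ length (elements F) * Q (X ∖ v) * (q ^ m * i)
                                                 ≡⟨ cong (λ j → ρ ^ j * Q (X ∖ v) * (q ^ m * i)) (trans (length-elements F) (link-size H v unif F∈)) ⟩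
      ρ ^ m * Q (X ∖ v) * (q ^ m * i)            ≡⟨ solve 4 (λ r y q i → r :* y :* (q :* i) := r :* q :* y :* i) refl (ρ ^ m) (Q (X ∖ v)) (q ^ m) i ⟩
      ρ ^ m * q ^ m * Q (X ∖ v) * i              ≡⟨ cong (λ z → z * Q (X ∖ v) * i) (^-distrib-* ρ q m) ⟨
      K * i                                      ∎
      where
      i : ℚ
      i = ind (x ∈? inter F G)

  -- With ε = D (ρ q)^m the two preceding bounds give (1 - ε) Q (X ∖ v) ≤ Q X, and `gap` says 1 ≤ ρ
  -- (1 - ε). The number t makes the induction on the size structural, since `Q-lost` needs the
  -- claim for many smaller sets at once.
  Q-∖ : ∀ t X → ∣ X ∣ ℕ.≤ t → ∀ v → Q (X ∖ v) ≤ ρ * Q X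
  Q-∖ t X X≤t v = by t X≤t (v ∈? X)
    where
    open ℚ.≤-Reasoning
    by : ∀ t → ∣ X ∣ ℕ.≤ t → Dec (v ∈ X) → Q (X ∖ v) ≤ ρ * Q X
    by t X≤t (no v∉X) = begin
      Q (X ∖ v)   ≤⟨ Avg-mono gs (λ φ _ → good-anti φ λ x∈ → x∈p∧x≢y⇒x∈p-y x∈ λ { refl → v∉X x∈ }) ⟩
      Q X         ≤⟨ ≤* (0≤Q X) 1≤ρ ⟩
      Q X * ρ     ≡⟨ ℚ.*-comm (Q X) ρ ⟩
      ρ * Q X     ∎
    by zero    X≤t (yes v∈X) = contradiction (ℕ.≤-trans (x∈p⇒∣p-x∣<∣p∣ v∈X) X≤t) λ ()
    by (suc t) X≤t (yes v∈X) = begin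
      y                        ≡⟨ ℚ.*-identityˡ y ⟨
      1ℚ * y                   ≤⟨ *-monoʳ (0≤Q (X ∖ v)) gap ⟩
      ρ * (1ℚ - ε) * y         ≡⟨ solve 3 (λ ρ e y → ρ :* (con 1ℚ :- e) :* y := ρ :* (y :- e :* y)) refl ρ ε y ⟩
      ρ * (y - ε * y)          ≤⟨ *-monoˡ 0≤ρ (le≡ (solve 3 (λ y e x → x :- (y :- e) := (x :+ e) :- y) refl y (ε * y) (Q X)) (el bound)) ⟩
      ρ * Q X                  ∎
      where
      y ε : ℚ
      y = Q (X ∖ v)
      ε = fromℕℚ D * (ρ * q) ^ m
      bound : y ≤ Q X + ε * y
      bound = begin
        y                                                            ≤⟨ Avg-mono gs (λ φ _ → good-∖ X v φ) ⟩
        Avg gs (λ φ → good X φ + ∑ (link H v) (lost X v φ))          ≡⟨ Avg-+ gs (good X) (λ φ → ∑ (link H v) (lost X v φ)) ⟩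
        Q X + Avg gs (λ φ → ∑ (link H v) (lost X v φ))               ≤⟨ ℚ.+-monoʳ-≤ (Q X) (Q-lost t (Q-∖ t) X v (ℕ.s≤s⁻¹ (ℕ.≤-trans (x∈p⇒∣p-x∣<∣p∣ v∈X) X≤t))) ⟩
        Q X + ε * y                                                  ∎

  -- No edge fits into the empty set, so Q starts at 1 there; putting back all vertices gives 1 ≤
  -- ρ^n Q ⊤. Without a proper colouring Q ⊤ would be 0, and `colorable?` turns the contradiction
  -- into a colouring.
  colorable : Colorable H G
  colorable = by (colorable? H G)
    where
    Y : Subset n
    Y = removeAll (allFin n) ⊤
    Q-Y : Q Y ≡ 1ℚ
    Q-Y = trans (Avg-cong gs λ φ → ind-yes (good? Y φ) (All.map (λ {E} size E⊆Y _ →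
      let v , v∈E = nonEmptySubset E size in ∉-removeAll (allFin n) ⊤ (∈-allFin v) (E⊆Y v∈E)) unif)) (Avg-const gs (nonEmpty {G = G} spread) 1ℚ)
    by : Dec (Colorable H G) → Colorable H G
    by (yes col) = col
    by (no ¬col) = contradiction (begin-strict
      0ℚ                                          <⟨ 0<1 ⟩
      1ℚ                                          ≡⟨ Q-Y ⟨
      Q Y                                         ≤⟨ Q-removeAll n (Q-∖ n) ⊤ (∣p∣≤n (⊤ {n})) (allFin n) ⟩
      ρ ^ length (allFin n) * Q ⊤                 ≤⟨ *-monoˡ (^-nonNeg (length (allFin n)) 0≤ρ) (Avg-mono gs none) ⟩
      ρ ^ length (allFin n) * Avg gs (λ _ → 0ℚ)   ≡⟨ cong (ρ ^ length (allFin n) *_) (Avg-0 gs) ⟩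
      ρ ^ length (allFin n) * 0ℚ                  ≡⟨ ℚ.*-zeroʳ (ρ ^ length (allFin n)) ⟩
      0ℚ                                          ∎) (ℚ.<-irrefl refl)
      where
      open ℚ.≤-Reasoning
      none : ∀ φ → φ ∈Π gs → good ⊤ φ ≤ 0ℚ
      none φ φ∈ = ℚ.≤-reflexive (ind-no (good? ⊤ φ) λ gd → ¬col (φ ,
        (λ v → ∈-elements⁻ (lookup G v) (subst (lookup φ v ∈ₗ_) (lookup-map v elements G) (φ∈ v))) ,
        All.map (λ h → h λ _ → ∈⊤) gd))

-- Exponentials, logarithms and roots

0≤expTerm : ∀ {a} → 0ℚ ≤ a → ∀ j → 0ℚ ≤ expTerm a j
0≤expTerm 0≤a j = proj₁ (expTerm-mono 0≤a ℚ.≤-refl j)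

expSum-monoˡ : ∀ {a b} → 0ℚ ≤ a → a ≤ b → ∀ n → expSum a n ≤ expSum b n
expSum-monoˡ 0≤a a≤b zero    = ℚ.≤-refl
expSum-monoˡ 0≤a a≤b (suc n) = ℚ.+-mono-≤ (expSum-monoˡ 0≤a a≤b n) (proj₂ (expTerm-mono 0≤a a≤b n))

expSum-≤-suc : ∀ {a} → 0ℚ ≤ a → ∀ n → expSum a n ≤ expSum a (suc n)
expSum-≤-suc {a} 0≤a n = le≡ (solve 2 (λ x y → (x :+ y) :- x := y) refl (expSum a n) (expTerm a n)) (0≤expTerm 0≤a n)

expSum-monoʳ : ∀ {a} → 0ℚ ≤ a → ∀ d n → expSum a n ≤ expSum a (d ℕ.+ n)
expSum-monoʳ 0≤a zero    n = ℚ.≤-refl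
expSum-monoʳ 0≤a (suc d) n = ℚ.≤-trans (expSum-monoʳ 0≤a d n) (expSum-≤-suc 0≤a (d ℕ.+ n))

1≡[2+n]/[2+n] : ∀ n → 1ℚ ≡ (1ℚ + (1ℚ + fromℕℚ n)) * 1/suc (suc n)
1≡[2+n]/[2+n] n = sym (trans (cong (_* 1/suc (suc n)) (trans (cong (λ x → 1ℚ + x) (sym (fromℕℚ-suc n))) (sym (fromℕℚ-suc (suc n)))))
  (1/suc-inverse (suc n)))

expTerm-suc : ∀ a j → (1ℚ + fromℕℚ j) * expTerm a (suc j) ≡ a * expTerm a j
expTerm-suc a j = begin
  (1ℚ + fromℕℚ j) * (expTerm a j * (a * 1/suc j))      ≡⟨ solve 4 (λ x t a w → x :* (t :* (a :* w)) := a :* t :* (x :* w)) refl (1ℚ + fromℕℚ j) (expTerm a j) a (1/suc j) ⟩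
  a * expTerm a j * ((1ℚ + fromℕℚ j) * 1/suc j)        ≡⟨ cong (λ x → a * expTerm a j * (x * 1/suc j)) (fromℕℚ-suc j) ⟨
  a * expTerm a j * (fromℕℚ (suc j) * 1/suc j)         ≡⟨ cong (a * expTerm a j *_) (1/suc-inverse j) ⟩
  a * expTerm a j * 1ℚ                                 ≡⟨ ℚ.*-identityʳ (a * expTerm a j) ⟩
  a * expTerm a j                                      ∎
  where open ≡-Reasoning

module _ {a h : ℚ} (0≤a : 0ℚ ≤ a) (0≤h : 0ℚ ≤ h) where

  private
    b : ℚ
    b = a + h
    0≤b : 0ℚ ≤ b
    0≤b = 0≤+ 0≤a 0≤h

  -- For x ≥ 0 the function x^(j+1) / (j+1)! is convex with derivative x^j / j!; this is its tangent
  -- at a, evaluated at b = a + h.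
  expTerm-+≥ : ∀ j → expTerm a (suc j) + h * expTerm a j ≤ expTerm b (suc j)
  expTerm-+≥ zero = ℚ.≤-reflexive (solve 2 (λ a h → con 1ℚ :* (a :* con 1ℚ) :+ h :* con 1ℚ := con 1ℚ :* ((a :+ h) :* con 1ℚ)) refl a h)
  expTerm-+≥ (suc j) = begin
    t₁ * (a * w) + h * t₁                               ≡⟨ cong (λ x → t₁ * (a * w) + x) (ℚ.*-identityʳ (h * t₁)) ⟨
    t₁ * (a * w) + h * t₁ * 1ℚ                          ≡⟨ cong (λ x → t₁ * (a * w) + h * t₁ * x) (1≡[2+n]/[2+n] j) ⟩
    t₁ * (a * w) + h * t₁ * ((1ℚ + (1ℚ + N)) * w)       ≡⟨ solve 5 (λ t a w h n → t :* (a :* w) :+ h :* t :* ((con 1ℚ :+ (con 1ℚ :+ n)) :* w)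
                                                              := (t :* a :+ h :* t :+ h :* ((con 1ℚ :+ n) :* t)) :* w) refl t₁ a w h N ⟩
    (t₁ * a + h * t₁ + h * ((1ℚ + N) * t₁)) * w         ≡⟨ cong (λ x → (t₁ * a + h * t₁ + h * x) * w) (expTerm-suc a j) ⟩
    (t₁ * a + h * t₁ + h * (a * t₀)) * w                ≤⟨ *-monoʳ {t₁ * a + h * t₁ + h * (a * t₀)} {(t₁ + h * t₀) * b} (ℚ.<⇒≤ (0<1/suc (suc j))) (le≡ (solve 4 (λ t₀ t₁ a h →
                                                              (t₁ :+ h :* t₀) :* (a :+ h) :- (t₁ :* a :+ h :* t₁ :+ h :* (a :* t₀)) := h :* (h :* t₀)) refl t₀ t₁ a h)
                                                              (0≤* 0≤h (0≤* 0≤h (0≤expTerm 0≤a j)))) ⟩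
    (t₁ + h * t₀) * b * w                               ≤⟨ *-monoʳ (ℚ.<⇒≤ (0<1/suc (suc j))) (*-monoʳ 0≤b (expTerm-+≥ j)) ⟩
    expTerm b (suc j) * b * w                           ≡⟨ ℚ.*-assoc (expTerm b (suc j)) b w ⟩
    expTerm b (suc (suc j))                             ∎
    where
    open ℚ.≤-Reasoning
    t₀ t₁ w N : ℚ
    t₀ = expTerm a j
    t₁ = expTerm a (suc j)
    w = 1/suc (suc j)
    N = fromℕℚ j

  -- The same convexity with the tangent at b, evaluated at a.
  expTerm-+≤ : ∀ j → expTerm b (suc j) ≤ expTerm a (suc j) + h * expTerm b j
  expTerm-+≤ zero = ℚ.≤-reflexive (solve 2 (λ a h → con 1ℚ :* ((a :+ h) :* con 1ℚ) := con 1ℚ :* (a :* con 1ℚ) :+ h :* con 1ℚ) refl a h)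
  expTerm-+≤ (suc j) = begin
    u₁ * ((a + h) * w)                                  ≡⟨ solve 4 (λ u a h w → u :* ((a :+ h) :* w) := (a :* u :+ h :* u) :* w) refl u₁ a h w ⟩
    (a * u₁ + h * u₁) * w                               ≤⟨ *-monoʳ (ℚ.<⇒≤ (0<1/suc (suc j))) (ℚ.+-monoˡ-≤ (h * u₁) (*-monoˡ 0≤a (expTerm-+≤ j))) ⟩
    (a * (t₁ + h * u₀) + h * u₁) * w                    ≤⟨ *-monoʳ {a * (t₁ + h * u₀) + h * u₁} {a * t₁ + h * (b * u₀) + h * u₁} (ℚ.<⇒≤ (0<1/suc (suc j))) (le≡ (solve 5 (λ a t h u v →
                                                              (a :* t :+ h :* ((a :+ h) :* u) :+ h :* v) :- (a :* (t :+ h :* u) :+ h :* v) := h :* (h :* u)) refl a t₁ h u₀ u₁)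
                                                              (0≤* 0≤h (0≤* 0≤h (0≤expTerm 0≤b j)))) ⟩
    (a * t₁ + h * (b * u₀) + h * u₁) * w                ≡⟨ cong (λ x → (a * t₁ + h * x + h * u₁) * w) (expTerm-suc b j) ⟨
    (a * t₁ + h * ((1ℚ + N) * u₁) + h * u₁) * w         ≡⟨ solve 6 (λ a t h n u w → (a :* t :+ h :* ((con 1ℚ :+ n) :* u) :+ h :* u) :* w
                                                              := t :* (a :* w) :+ h :* u :* ((con 1ℚ :+ (con 1ℚ :+ n)) :* w)) refl a t₁ h N u₁ w ⟩
    t₁ * (a * w) + h * u₁ * ((1ℚ + (1ℚ + N)) * w)       ≡⟨ cong (λ x → t₁ * (a * w) + h * u₁ * x) (1≡[2+n]/[2+n] j) ⟨
    t₁ * (a * w) + h * u₁ * 1ℚ                          ≡⟨ cong (λ x → t₁ * (a * w) + x) (ℚ.*-identityʳ (h * u₁)) ⟩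
    t₁ * (a * w) + h * u₁                               ∎
    where
    open ℚ.≤-Reasoning
    t₁ u₀ u₁ w N : ℚ
    t₁ = expTerm a (suc j)
    u₀ = expTerm b j
    u₁ = expTerm b (suc j)
    w = 1/suc (suc j)
    N = fromℕℚ j

  -- Finite substitute for (1 + h) exp a ≤ exp (a + h), got by summing tangents, so that no
  -- functional equation of exp is required. The index grows by one because differentiation lowers
  -- the degree.
  expSum-+≥ : ∀ n → (1ℚ + h) * expSum a n ≤ expSum b (suc n)
  expSum-+≥ n = begin
    (1ℚ + h) * expSum a n               ≡⟨ solve 2 (λ h s → (con 1ℚ :+ h) :* s := s :+ h :* s) refl h (expSum a n) ⟩
    expSum a n + h * expSum a n         ≤⟨ ℚ.+-monoˡ-≤ (h * expSum a n) (expSum-≤-suc 0≤a n) ⟩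
    expSum a (suc n) + h * expSum a n   ≤⟨ sums n ⟩
    expSum b (suc n)                    ∎
    where
    open ℚ.≤-Reasoning
    sums : ∀ n → expSum a (suc n) + h * expSum a n ≤ expSum b (suc n)
    sums zero    = ℚ.≤-reflexive (solve 1 (λ h → con 0ℚ :+ con 1ℚ :+ h :* con 0ℚ := con 0ℚ :+ con 1ℚ) refl h)
    sums (suc n) = subst (_≤ expSum b (suc (suc n)))
      (solve 5 (λ s t h x y → (s :+ h :* x) :+ (t :+ h :* y) := s :+ t :+ h :* (x :+ y)) refl
        (expSum a (suc n)) (expTerm a (suc n)) h (expSum a n) (expTerm a n))
      (ℚ.+-mono-≤ (sums n) (expTerm-+≥ n))

  expSum-+≤ : ∀ n → (1ℚ - h) * expSum b n ≤ expSum a n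
  expSum-+≤ zero    = ℚ.≤-reflexive (ℚ.*-zeroʳ (1ℚ - h))
  expSum-+≤ (suc n) = begin
    (1ℚ - h) * expSum b (suc n)                               ≡⟨ solve 2 (λ h s → (con 1ℚ :- h) :* s := s :- h :* s) refl h (expSum b (suc n)) ⟩
    expSum b (suc n) - h * expSum b (suc n)                   ≤⟨ ℚ.+-mono-≤ (sums n) (ℚ.neg-antimono-≤ (*-monoˡ 0≤h (expSum-≤-suc 0≤b n))) ⟩
    expSum a (suc n) + h * expSum b n - h * expSum b n        ≡⟨ solve 2 (λ s x → s :+ x :- x := s) refl (expSum a (suc n)) (h * expSum b n) ⟩
    expSum a (suc n)                                          ∎
    where
    open ℚ.≤-Reasoning
    sums : ∀ n → expSum b (suc n) ≤ expSum a (suc n) + h * expSum b n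
    sums zero    = ℚ.≤-reflexive (solve 1 (λ h → con 0ℚ :+ con 1ℚ := con 0ℚ :+ con 1ℚ :+ h :* con 0ℚ) refl h)
    sums (suc n) = subst (expSum b (suc (suc n)) ≤_)
      (solve 5 (λ s t h x y → (s :+ h :* x) :+ (t :+ h :* y) := s :+ t :+ h :* (x :+ y)) refl
        (expSum a (suc n)) (expTerm a (suc n)) h (expSum b n) (expTerm b n))
      (ℚ.+-mono-≤ (sums n) (expTerm-+≤ n))

suc* : ∀ n p → fromℕℚ (suc n) * p ≡ fromℕℚ n * p + p
suc* n p = trans (cong (_* p) (fromℕℚ-suc n)) (solve 2 (λ n p → (con 1ℚ :+ n) :* p := n :* p :+ p) refl (fromℕℚ n) p)

^≤expSum : ∀ {p} → 0ℚ ≤ p → ∀ n → (1ℚ + p) ^ n ≤ expSum (fromℕℚ n * p) (suc n)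
^≤expSum {p} 0≤p zero    = ℚ.≤-refl
^≤expSum {p} 0≤p (suc n) = begin
  (1ℚ + p) * (1ℚ + p) ^ n                     ≤⟨ *-monoˡ (0≤+ 0≤1 0≤p) (^≤expSum 0≤p n) ⟩
  (1ℚ + p) * expSum (fromℕℚ n * p) (suc n)    ≤⟨ expSum-+≥ (0≤* (0≤fromℕℚ n) 0≤p) 0≤p (suc n) ⟩
  expSum (fromℕℚ n * p + p) (suc (suc n))     ≡⟨ cong (λ x → expSum x (suc (suc n))) (suc* n p) ⟨
  expSum (fromℕℚ (suc n) * p) (suc (suc n))   ∎
  where open ℚ.≤-Reasoning

expSum-0 : ∀ m → expSum 0ℚ m ≤ 1ℚ
expSum-0 zero    = 0≤1
expSum-0 (suc m) = ℚ.≤-reflexive (one m)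
  where
  one : ∀ m → expSum 0ℚ (suc m) ≡ 1ℚ
  one zero    = refl
  one (suc m) = trans (cong₂ _+_ (one m) (trans (cong (expTerm 0ℚ m *_) (ℚ.*-zeroˡ (1/suc m))) (ℚ.*-zeroʳ (expTerm 0ℚ m)))) (ℚ.+-identityʳ 1ℚ)

^*expSum≤1 : ∀ {h} → 0ℚ ≤ h → h ≤ 1ℚ → ∀ N m → (1ℚ - h) ^ N * expSum (fromℕℚ N * h) m ≤ 1ℚ
^*expSum≤1 {h} 0≤h h≤1 zero    m = subst (_≤ 1ℚ) (trans (cong (λ x → expSum x m) (sym (ℚ.*-zeroˡ h))) (sym (ℚ.*-identityˡ _))) (expSum-0 m)
^*expSum≤1 {h} 0≤h h≤1 (suc N) m = begin
  (1ℚ - h) * (1ℚ - h) ^ N * expSum (fromℕℚ (suc N) * h) m        ≡⟨ cong (λ x → (1ℚ - h) * (1ℚ - h) ^ N * expSum x m) (suc* N h) ⟩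
  (1ℚ - h) * (1ℚ - h) ^ N * expSum (fromℕℚ N * h + h) m          ≡⟨ solve 3 (λ a b c → a :* b :* c := b :* (a :* c)) refl (1ℚ - h) ((1ℚ - h) ^ N) (expSum (fromℕℚ N * h + h) m) ⟩
  (1ℚ - h) ^ N * ((1ℚ - h) * expSum (fromℕℚ N * h + h) m)        ≤⟨ *-monoˡ (^-nonNeg N (el h≤1)) (expSum-+≤ (0≤* (0≤fromℕℚ N) 0≤h) 0≤h m) ⟩
  (1ℚ - h) ^ N * expSum (fromℕℚ N * h) m                         ≤⟨ ^*expSum≤1 0≤h h≤1 N m ⟩
  1ℚ                                                             ∎
  where open ℚ.≤-Reasoning

-- Both powers are compared with exp: (1 + p)^n ≤ exp (n p) ≤ exp (N h), while (1 - h)^N ≤ exp (- N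
-- h). With h = 1/4 and N = 2 M this yields the hypothesis `small` of the moment bound.
[1-h]^N*[1+p]^n≤1 : ∀ {h p} → 0ℚ ≤ h → h ≤ 1ℚ → 0ℚ ≤ p → ∀ N n → fromℕℚ n * p ≤ fromℕℚ N * h →
                    (1ℚ - h) ^ N * (1ℚ + p) ^ n ≤ 1ℚ
[1-h]^N*[1+p]^n≤1 {h} {p} 0≤h h≤1 0≤p N n np≤Nh = begin
  (1ℚ - h) ^ N * (1ℚ + p) ^ n                      ≤⟨ *-monoˡ 0≤ (^≤expSum 0≤p n) ⟩
  (1ℚ - h) ^ N * expSum (fromℕℚ n * p) (suc n)     ≤⟨ *-monoˡ 0≤ (expSum-monoˡ (0≤* (0≤fromℕℚ n) 0≤p) np≤Nh (suc n)) ⟩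
  (1ℚ - h) ^ N * expSum (fromℕℚ N * h) (suc n)     ≤⟨ ^*expSum≤1 0≤h h≤1 N (suc n) ⟩
  1ℚ                                               ∎
  where
  open ℚ.≤-Reasoning
  0≤ : 0ℚ ≤ (1ℚ - h) ^ N
  0≤ = ^-nonNeg N (el h≤1)

reciprocal : ∀ {x} → 0ℚ < x → ∃[ y ] 0ℚ < y × x * y ≡ 1ℚ
reciprocal {x} 0<x = ℚ.1/_ x {{x≢0}} , ℚ.positive⁻¹ _ {{ℚ.1/pos⇒pos x {{ℚ.positive 0<x}}}} , ℚ.*-inverseʳ x {{x≢0}}
  where
  x≢0 : ℚ.NonZero x
  x≢0 = ℚ.>-nonZero 0<x

-- For nonnegative a and c the product a c is the least of the four corner products.
*ℝ-lower : ∀ x y {a c p} → Lower x a → Lower y c → 0ℚ ≤ a → 0ℚ ≤ c → p < a * c → Lower (x *ℝ y) p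
*ℝ-lower x y {a} {c} La Lc 0≤a 0≤c p<ac = let b , Ub = upper-inhabited x
                                              d , Ud = upper-inhabited y
                                              a≤b = ℚ.<⇒≤ (lower<upper x La Ub)
                                              c≤d = ℚ.<⇒≤ (lower<upper y Lc Ud)
                                              0≤b = ℚ.≤-trans 0≤a a≤b
  in a , b , c , d , La , Ub , Lc , Ud ,
     <-⊓ (<-⊓ p<ac (ℚ.<-≤-trans p<ac (*-monoˡ 0≤a c≤d)))
         (<-⊓ (ℚ.<-≤-trans p<ac (*-monoʳ 0≤c a≤b)) (ℚ.<-≤-trans p<ac (*-mono 0≤c 0≤b a≤b c≤d)))

*ℝ-upper : ∀ x y {p} → Upper (x *ℝ y) p → ∃[ b ] ∃[ d ] Upper x b × Upper y d × b * d < p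
*ℝ-upper x y (a , b , c , d , _ , Ub , _ , Ud , max<p) = b , d , Ub , Ud ,
  ℚ.≤-<-trans (ℚ.≤-trans (ℚ.p≤q⊔p (b * c) (b * d)) (ℚ.p≤q⊔p ((a * c) ℚ.⊔ (a * d)) ((b * c) ℚ.⊔ (b * d)))) max<p

-- The cut bounds the partial sums only from some index on; as they increase, the bound holds
-- throughout.
expSum≤e : ∀ {p} → Upper e p → ∀ n → expSum 1ℚ n ≤ p
expSum≤e {p} (y , y<p , N , h) n = ℚ.≤-trans
  (ℚ.≤-trans (expSum-monoʳ 0≤1 N n) (h (N ℕ.+ n) (ℕ.m≤m+n N n))) (ℚ.<⇒≤ y<p)

-- (2 r)^r = 2^r r r^m, and r^m = m^m (1 + 1/m)^m ≤ m^m e. This is where the constant 2^r e r of the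
-- theorem is spent.
exp-root-bound : ∀ m′ → let m = suc m′; r = suc m in ∀ {u} → Upper (fromℕ (2 ℕ.^ r) *ℝ e *ℝ fromℕ r) u →
                 fromℕℚ ((2 ℕ.* r) ℕ.^ r) ≤ fromℕℚ m ^ m * u
exp-root-bound m′ {u} Uu =
  let b , d , Ub , r<d , bd<u = *ℝ-upper (fromℕ (2 ℕ.^ suc (suc m′)) *ℝ e) (fromℕ (suc (suc m′))) Uu
      b′ , d′ , 2^r<b′ , Ud′ , b′d′<b = *ℝ-upper (fromℕ (2 ℕ.^ suc (suc m′))) e Ub
  in chain (expSum≤e Ud′) r<d bd<u 2^r<b′ b′d′<b
  where
  open ℚ.≤-Reasoning
  m r : ℕ
  m = suc m′
  r = suc m
  w M R : ℚ
  w = 1/suc m′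
  M = fromℕℚ m
  R = fromℕℚ r
  Mw≡1 : M * w ≡ 1ℚ
  Mw≡1 = 1/suc-inverse m′
  0≤w : 0ℚ ≤ w
  0≤w = ℚ.<⇒≤ (0<1/suc m′)
  R^m≤ : ∀ {e₁} → (∀ n → expSum 1ℚ n ≤ e₁) → R ^ m ≤ M ^ m * e₁
  R^m≤ {e₁} ≤e₁ = begin
    R ^ m                             ≡⟨ cong (_^ m) (trans (fromℕℚ-suc m) (trans (cong (_+ M) (sym Mw≡1)) (solve 2 (λ M w → M :* w :+ M := M :* (con 1ℚ :+ w)) refl M w))) ⟩
    (M * (1ℚ + w)) ^ m                ≡⟨ ^-distrib-* M (1ℚ + w) m ⟩
    M ^ m * (1ℚ + w) ^ m              ≤⟨ *-monoˡ (^-nonNeg m (0≤fromℕℚ m)) (ℚ.≤-trans (^≤expSum 0≤w m)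
                                           (subst (λ x → expSum x (suc m) ≤ e₁) (sym Mw≡1) (≤e₁ (suc m)))) ⟩
    M ^ m * e₁                        ∎
  chain : ∀ {b d b′ e₁} → (∀ n → expSum 1ℚ n ≤ e₁) → R < d → b * d < u → fromℕℚ (2 ℕ.^ r) < b′ → b′ * e₁ < b →
          fromℕℚ ((2 ℕ.* r) ℕ.^ r) ≤ M ^ m * u
  chain {b} {d} {b′} {e₁} ≤e₁ R<d bd<u 2^r<b′ b′e₁<b = begin
    fromℕℚ ((2 ℕ.* r) ℕ.^ r)             ≡⟨ trans (fromℕℚ-^ (2 ℕ.* r) r) (trans (cong (_^ r) (fromℕℚ-* 2 r)) (trans (^-distrib-* (fromℕℚ 2) R r) (cong (_* R ^ r) (sym (fromℕℚ-^ 2 r))))) ⟩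
    t * (R * R ^ m)                      ≤⟨ *-monoˡ (0≤fromℕℚ (2 ℕ.^ r)) (*-monoˡ (0≤fromℕℚ r) (R^m≤ ≤e₁)) ⟩
    t * (R * (M ^ m * e₁))               ≡⟨ solve 4 (λ t R M e → t :* (R :* (M :* e)) := M :* (t :* e :* R)) refl t R (M ^ m) e₁ ⟩
    M ^ m * (t * e₁ * R)                 ≤⟨ *-monoˡ (^-nonNeg m (0≤fromℕℚ m)) (begin
      t * e₁ * R                           ≤⟨ *-monoʳ (0≤fromℕℚ r) te₁≤b ⟩
      b * R                                ≤⟨ *-monoˡ (ℚ.≤-trans (0≤* (0≤fromℕℚ (2 ℕ.^ r)) 0≤e₁) te₁≤b) (ℚ.<⇒≤ R<d) ⟩
      b * d                                ≤⟨ ℚ.<⇒≤ bd<u ⟩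
      u                                    ∎) ⟩
    M ^ m * u                            ∎
    where
    t : ℚ
    t = fromℕℚ (2 ℕ.^ r)
    0≤e₁ : 0ℚ ≤ e₁
    0≤e₁ = ≤e₁ 0
    te₁≤b : t * e₁ ≤ b
    te₁≤b = ℚ.≤-trans (*-monoʳ 0≤e₁ (ℚ.<⇒≤ 2^r<b′)) (ℚ.<⇒≤ b′e₁<b)

-- The contrapositive: for σ < s x^(1/m) some lower bound c of x^(1/m) has σ < q c.
root-bound : ∀ m′ → let m = suc m′ in ∀ x C {q s} σ → 0 ℕ.< σ → Lower C q → 0ℚ < s → s < q →
             C *ℝ root m (fromℚ x) ≤ℝ fromℕ σ → s ^ m * x ≤ fromℕℚ σ ^ m
root-bound m′ x C {q} {s} σ 0<σ Lq 0<s s<q h = ℚ.≮⇒≥ λ S^m<s^m*x →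
  ℚ.<-irrefl refl (h S (*ℝ-lower C (root m (fromℚ x)) Lq (lower-c S^m<s^m*x) (ℚ.<⇒≤ 0<q) (ℚ.<⇒≤ 0<c) σ<qc))
  where
  m : ℕ
  m = suc m′
  S : ℚ
  S = fromℕℚ σ
  0<S : 0ℚ < S
  0<S = 0<fromℕℚ 0<σ
  0<q : 0ℚ < q
  0<q = ℚ.<-trans 0<s s<q
  1/s 1/q : ℚ
  1/s = proj₁ (reciprocal 0<s)
  1/q = proj₁ (reciprocal 0<q)
  0<1/s : 0ℚ < 1/s
  0<1/s = proj₁ (proj₂ (reciprocal 0<s))
  0<1/q : 0ℚ < 1/q
  0<1/q = proj₁ (proj₂ (reciprocal 0<q))
  s/s : s * 1/s ≡ 1ℚ
  s/s = proj₂ (proj₂ (reciprocal 0<s))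
  q/q : q * 1/q ≡ 1ℚ
  q/q = proj₂ (proj₂ (reciprocal 0<q))
  1/q<1/s : 1/q < 1/s
  1/q<1/s = lt≡ (begin
      1/s - 1/q                            ≡⟨ solve 2 (λ i j → i :- j := i :* con 1ℚ :- con 1ℚ :* j) refl 1/s 1/q ⟩
      1/s * 1ℚ - 1ℚ * 1/q                  ≡⟨ cong₂ (λ a b → 1/s * a - b * 1/q) q/q s/s ⟨
      1/s * (q * 1/q) - s * 1/s * 1/q      ≡⟨ solve 4 (λ i q j s → i :* (q :* j) :- s :* i :* j := (q :- s) :* (i :* j)) refl 1/s q 1/q s ⟩
      (q - s) * (1/s * 1/q)                ∎)
    (0<* (tl s<q) (0<* 0<1/s 0<1/q))
    where open ≡-Reasoning
  dense : ∃[ c ] S * 1/q < c × c < S * 1/s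
  dense = ℚ.<-dense (ℚ.*-monoʳ-<-pos S {{ℚ.positive 0<S}} 1/q<1/s)
  c t : ℚ
  c = proj₁ dense
  t = S * 1/s
  0<c : 0ℚ < c
  0<c = ℚ.<-trans (0<* 0<S 0<1/q) (proj₁ (proj₂ dense))
  t^m<x : S ^ m < s ^ m * x → t ^ m < x
  t^m<x S^m<s^m*x = ℚ.*-cancelˡ-<-nonNeg (s ^ m) {{ℚ.nonNegative (^-nonNeg m (ℚ.<⇒≤ 0<s))}} (begin-strict
    s ^ m * t ^ m       ≡⟨ ^-distrib-* s t m ⟨
    (s * t) ^ m         ≡⟨ cong (_^ m) (trans (solve 3 (λ s S i → s :* (S :* i) := S :* (s :* i)) refl s S 1/s) (trans (cong (S *_) s/s) (ℚ.*-identityʳ S))) ⟩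
    S ^ m               <⟨ S^m<s^m*x ⟩
    s ^ m * x           ∎)
    where open ℚ.≤-Reasoning
  lower-c : S ^ m < s ^ m * x → Lower (root m (fromℚ x)) c
  lower-c S^m<s^m*x = inj₂ (t , proj₂ (proj₂ dense) , ℚ.<-dense (t^m<x S^m<s^m*x))
  σ<qc : S < q * c
  σ<qc = begin-strict
    S                   ≡⟨ ℚ.*-identityʳ S ⟨
    S * 1ℚ              ≡⟨ cong (S *_) q/q ⟨
    S * (q * 1/q)       ≡⟨ solve 3 (λ S q i → S :* (q :* i) := q :* (S :* i)) refl S q 1/q ⟩
    q * (S * 1/q)       <⟨ ℚ.*-monoʳ-<-pos q {{ℚ.positive 0<q}} (proj₁ (proj₂ dense)) ⟩
    q * c               ∎
    where open ℚ.≤-Reasoning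

-- The hypothesis on C provides a rational s with 2^r e r < u < s^m and s below C. Then u ≤ s^m
-- combines with s^m Δ ≤ σ^m, and e disappears: an inequality between naturals remains.
degree-bound : ∀ m′ → let m = suc m′; r = suc m in ∀ C → root m (fromℕ (2 ℕ.^ r) *ℝ e *ℝ fromℕ r) <ℝ C →
               ∀ Δ σ → 0 ℕ.< σ → C *ℝ root m (fromℕ Δ) ≤ℝ fromℕ σ → (2 ℕ.* r) ℕ.^ r ℕ.* Δ ℕ.≤ (m ℕ.* σ) ℕ.^ m
degree-bound m′ C (q , (s , 0≤s , s<q , u , Uu , u<s^m) , Lq) Δ σ 0<σ h = fromℕℚ-cancel-≤ (begin
  fromℕℚ ((2 ℕ.* r) ℕ.^ r ℕ.* Δ)          ≡⟨ fromℕℚ-* ((2 ℕ.* r) ℕ.^ r) Δ ⟩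
  fromℕℚ ((2 ℕ.* r) ℕ.^ r) * fromℕℚ Δ     ≤⟨ *-monoʳ (0≤fromℕℚ Δ) (ℚ.≤-trans (exp-root-bound m′ Uu) (*-monoˡ (^-nonNeg m (0≤fromℕℚ m)) (ℚ.<⇒≤ u<s^m))) ⟩
  M ^ m * s ^ m * fromℕℚ Δ                ≡⟨ ℚ.*-assoc (M ^ m) (s ^ m) (fromℕℚ Δ) ⟩
  M ^ m * (s ^ m * fromℕℚ Δ)              ≤⟨ *-monoˡ (^-nonNeg m (0≤fromℕℚ m)) (root-bound m′ (fromℕℚ Δ) C σ 0<σ Lq 0<s s<q h) ⟩
  M ^ m * fromℕℚ σ ^ m                    ≡⟨ ^-distrib-* M (fromℕℚ σ) m ⟨
  (M * fromℕℚ σ) ^ m                      ≡⟨ cong (_^ m) (fromℕℚ-* m σ) ⟨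
  fromℕℚ (m ℕ.* σ) ^ m                    ≡⟨ fromℕℚ-^ (m ℕ.* σ) m ⟨
  fromℕℚ ((m ℕ.* σ) ℕ.^ m)                ∎)
  where
  open ℚ.≤-Reasoning
  m r : ℕ
  m = suc m′
  r = suc m
  M : ℚ
  M = fromℕℚ m
  -- `root-bound` divides by s, but the cut only records 0 ≤ s; strictness comes from s^m > u and
  -- the positivity of (2 r)^r.
  0<s^m : 0ℚ < s ^ m
  0<s^m = ℚ.*-cancelˡ-<-nonNeg (M ^ m) {{ℚ.nonNegative (^-nonNeg m (0≤fromℕℚ m))}} (begin-strict
    M ^ m * 0ℚ                      ≡⟨ ℚ.*-zeroʳ (M ^ m) ⟩
    0ℚ                              <⟨ 0<fromℕℚ (ℕ.m^n>0 (2 ℕ.* r) r) ⟩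
    fromℕℚ ((2 ℕ.* r) ℕ.^ r)        ≤⟨ exp-root-bound m′ Uu ⟩
    M ^ m * u                       ≤⟨ *-monoˡ (^-nonNeg m (0≤fromℕℚ m)) (ℚ.<⇒≤ u<s^m) ⟩
    M ^ m * s ^ m                   ∎)
  0<s : 0ℚ < s
  0<s = ℚ.≰⇒> λ s≤0 → ℚ.<-irrefl refl (subst (0ℚ <_)
    (trans (cong (_^ m) (ℚ.≤-antisym s≤0 0≤s)) (ℚ.*-zeroˡ (0ℚ ^ m′))) 0<s^m)

-- The failure probability

-- The gain per incidence is 9/8 = 2 · 9/16, split as 17/16 · 18/17: the first factor pays for the n
-- vertices, the second for the 2^k subsets. The other constants are inverses, and 3/4 is the square
-- root of 9/16.
17/16 16/17 9/8 8/9 18/17 17/18 9/16 3/4 : ℚ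
17/16 = + 17 ℚ./ 16
16/17 = + 16 ℚ./ 17
9/8   = + 9 ℚ./ 8
8/9   = + 8 ℚ./ 9
18/17 = + 18 ℚ./ 17
17/18 = + 17 ℚ./ 18
9/16  = + 9 ℚ./ 16
3/4   = + 3 ℚ./ 4

^-inverse : ∀ {x y} → x * y ≡ 1ℚ → ∀ n → x ^ n * y ^ n ≡ 1ℚ
^-inverse {x} {y} xy≡1 n = trans (sym (^-distrib-* x y n)) (trans (cong (_^ n) xy≡1) (1^ n))

bernoulli : ∀ {h} → 0ℚ ≤ h → ∀ n → 1ℚ + fromℕℚ n * h ≤ (1ℚ + h) ^ n
bernoulli {h} 0≤h zero    = ℚ.≤-reflexive (trans (cong (λ x → 1ℚ + x) (ℚ.*-zeroˡ h)) (ℚ.+-identityʳ 1ℚ))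
bernoulli {h} 0≤h (suc n) = begin
  1ℚ + fromℕℚ (suc n) * h         ≡⟨ cong (λ x → 1ℚ + x) (suc* n h) ⟩
  1ℚ + (fromℕℚ n * h + h)         ≤⟨ le≡ (solve 2 (λ x h → (con 1ℚ :+ h) :* (con 1ℚ :+ x) :- (con 1ℚ :+ (x :+ h)) := x :* h) refl (fromℕℚ n * h) h)
                                       (0≤* (0≤* (0≤fromℕℚ n) 0≤h) 0≤h) ⟩
  (1ℚ + h) * (1ℚ + fromℕℚ n * h)  ≤⟨ *-monoˡ (0≤+ 0≤1 0≤h) (bernoulli 0≤h n) ⟩
  (1ℚ + h) * (1ℚ + h) ^ n         ∎
  where open ℚ.≤-Reasoning

-- If n exceeded (17/16)^T ≥ exp (T / 17), then log n > T / 17 and A (log n)^(1/r) > k; the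
-- gaps in 20 > 19 > 18 > 17 absorb the passage to strict lower approximations of the reals.
log-bound : ∀ m k n T → let r = suc m in
            fromℕ (20 ℕ.* (4 ℕ.* r)) *ℝ root r (log n) ≤ℝ fromℕ k →
            suc k ℕ.^ r ℕ.≤ (4 ℕ.* r) ℕ.^ r ℕ.* T → fromℕℚ n ≤ 17/16 ^ T
log-bound m k n T h K^r≤ = ℚ.≮⇒≥ λ y<n → ℚ.<-irrefl refl
  (h (fromℕℚ k) (*ℝ-lower (fromℕ (20 ℕ.* (4 ℕ.* r))) (root r (log n)) 19B<A (lower-c y<n)
    (0≤* (ℚ.<⇒≤ (0<fromℕℚ-suc 18)) (ℚ.<⇒≤ 0<B)) (0≤* (ℚ.<⇒≤ 0<κ) (ℚ.<⇒≤ (0<1/suc 18)))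
    (subst (fromℕℚ k <_) (sym 19Bc≡K) (fromℕℚ-mono-< (ℕ.n<1+n k)))))
  where
  open ℚ.≤-Reasoning
  r : ℕ
  r = suc m
  B K T′ : ℚ
  B  = fromℕℚ (4 ℕ.* r)
  K  = fromℕℚ (suc k)
  T′ = fromℕℚ T
  0<B : 0ℚ < B
  0<B = 0<fromℕℚ {4 ℕ.* r} (ℕ.s≤s ℕ.z≤n)
  i κ c c′ s : ℚ
  i  = proj₁ (reciprocal 0<B)
  κ  = K * i
  c  = κ * 1/suc 18
  c′ = κ * 1/suc 17
  s  = T′ * 1/suc 16
  B*i : B * i ≡ 1ℚ
  B*i = proj₂ (proj₂ (reciprocal 0<B))
  0<κ : 0ℚ < κ
  0<κ = 0<* (0<fromℕℚ-suc k) (proj₁ (proj₂ (reciprocal 0<B)))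
  B*κ : B * κ ≡ K
  B*κ = trans (solve 3 (λ B K i → B :* (K :* i) := K :* (B :* i)) refl B K i) (trans (cong (K *_) B*i) (ℚ.*-identityʳ K))
  19Bc≡K : fromℕℚ 19 * B * c ≡ K
  19Bc≡K = trans (solve 4 (λ x B κ y → x :* B :* (κ :* y) := x :* y :* (B :* κ)) refl (fromℕℚ 19) B κ (1/suc 18))
    (trans (cong₂ _*_ (1/suc-inverse 18) B*κ) (ℚ.*-identityˡ K))
  19B<A : fromℕℚ 19 * B < fromℕℚ (20 ℕ.* (4 ℕ.* r))
  19B<A = subst (fromℕℚ 19 * B <_) (sym (fromℕℚ-* 20 (4 ℕ.* r)))
    (ℚ.*-monoˡ-<-pos B {{ℚ.positive 0<B}} (fromℕℚ-mono-< (ℕ.n<1+n 19)))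
  κ^r≤T : κ ^ r ≤ T′
  κ^r≤T = *-cancelˡ (^-positive r 0<B) (begin
    B ^ r * κ ^ r                          ≡⟨ ^-distrib-* B κ r ⟨
    (B * κ) ^ r                            ≡⟨ cong (_^ r) B*κ ⟩
    K ^ r                                  ≡⟨ fromℕℚ-^ (suc k) r ⟨
    fromℕℚ (suc k ℕ.^ r)                   ≤⟨ fromℕℚ-mono K^r≤ ⟩
    fromℕℚ ((4 ℕ.* r) ℕ.^ r ℕ.* T)         ≡⟨ fromℕℚ-* ((4 ℕ.* r) ℕ.^ r) T ⟩
    fromℕℚ ((4 ℕ.* r) ℕ.^ r) * T′          ≡⟨ cong (_* T′) (fromℕℚ-^ (4 ℕ.* r) r) ⟩
    B ^ r * T′                             ∎)
  0<T : 0ℚ < T′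
  0<T = ℚ.<-≤-trans (^-positive r 0<κ) κ^r≤T
  c′^r<s : c′ ^ r < s
  c′^r<s = begin-strict
    c′ ^ r                                 ≡⟨ ^-distrib-* κ (1/suc 17) r ⟩
    κ ^ r * 1/suc 17 ^ r                   ≤⟨ *-mono (^-nonNeg r (ℚ.<⇒≤ (0<1/suc 17))) (ℚ.<⇒≤ 0<T) κ^r≤T
                                                (subst (1/suc 17 ^ r ≤_) (ℚ.*-identityʳ (1/suc 17)) (*-monoˡ (ℚ.<⇒≤ (0<1/suc 17))
                                                  (ℚ.≤-trans (^-monoˡ-≤ m (ℚ.<⇒≤ (0<1/suc 17)) (1/suc≤1 17)) (ℚ.≤-reflexive (1^ m))))) ⟩
    T′ * 1/suc 17                          <⟨ ℚ.*-monoʳ-<-pos T′ {{ℚ.positive 0<T}} (toWitness {a? = 1/suc 17 ℚ.<? 1/suc 16} _) ⟩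
    s                                      ∎
  -- From (1 - 1/17)^T exp (T / 17) ≤ 1, as 16/17 = 1 - 1/17.
  exp-s≤ : ∀ j → expSum s j ≤ 17/16 ^ T
  exp-s≤ j = begin
    expSum s j                               ≡⟨ ℚ.*-identityˡ (expSum s j) ⟨
    1ℚ * expSum s j                          ≡⟨ cong (_* expSum s j) (^-inverse {17/16} {16/17} refl T) ⟨
    17/16 ^ T * 16/17 ^ T * expSum s j       ≡⟨ ℚ.*-assoc (17/16 ^ T) (16/17 ^ T) (expSum s j) ⟩
    17/16 ^ T * (16/17 ^ T * expSum s j)     ≤⟨ *-monoˡ (^-nonNeg T (ℚ.nonNegative⁻¹ 17/16)) (^*expSum≤1 (ℚ.<⇒≤ (0<1/suc 16)) (1/suc≤1 16) T j) ⟩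
    17/16 ^ T * 1ℚ                           ≡⟨ ℚ.*-identityʳ (17/16 ^ T) ⟩
    17/16 ^ T                                ∎
  lower-c : 17/16 ^ T < fromℕℚ n → Lower (root r (log n)) c
  lower-c y<n =
    let u , c′^r<u , u<s = ℚ.<-dense c′^r<s
        w , y<w , w<n    = ℚ.<-dense y<n
    in inj₂ (c′ , ℚ.*-monoʳ-<-pos κ {{ℚ.positive 0<κ}} (toWitness {a? = 1/suc 18 ℚ.<? 1/suc 17} _) ,
         u , c′^r<u , inj₂ (s , u<s , w , (17/16 ^ T , y<w , 0 , λ j _ → exp-s≤ j) , w<n))

-- Choice of parameters and the union bound

inter-mono : ∀ {n σ} (F : Subset n) (G L : ListAssignment n σ) → (∀ u → lookup G u ⊆ lookup L u) → inter F G ⊆ inter F L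
inter-mono []            []      []      G⊆L c∈ = c∈
inter-mono (inside  ∷ F) (g ∷ G) (x ∷ L) G⊆L c∈ = let p , q = x∈p∩q⁻ g (inter F G) c∈ in
  x∈p∩q⁺ (G⊆L zero p , inter-mono F G L (G⊆L ∘ suc) q)
inter-mono (outside ∷ F) (g ∷ G) (x ∷ L) G⊆L c∈ = inter-mono F G L (G⊆L ∘ suc) c∈

multiplicity-mono : ∀ {σ} {A : Set} c (f g : A → Subset σ) → (∀ x → f x ⊆ g x) → ∀ xs →
                    multiplicity c (map f xs) ℕ.≤ multiplicity c (map g xs)
multiplicity-mono c f g f⊆g []       = ℕ.z≤n
multiplicity-mono c f g f⊆g (x ∷ xs) with c ∈? f x | c ∈? g x
... | yes _ | yes _  = ℕ.s≤s (multiplicity-mono c f g f⊆g xs)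
... | yes p | no  c∉ = contradiction (f⊆g x p) c∉
... | no  _ | yes _  = ℕ.m≤n⇒m≤1+n (multiplicity-mono c f g f⊆g xs)
... | no  _ | no  _  = multiplicity-mono c f g f⊆g xs

m≤[1+m/n]*n : ∀ m n .{{_ : NonZero n}} → m ℕ.≤ suc (m ℕ./ n) ℕ.* n
m≤[1+m/n]*n m n = ℕ.≤-trans (ℕ.≤-reflexive (m≡m%n+[m/n]*n m n)) (ℕ.+-monoˡ-≤ (m ℕ./ n ℕ.* n) (ℕ.<⇒≤ (m%n<n m n)))

-- ℓ colours remain at each vertex when fewer than s = k + 1 - ℓ are bad, that is, of degree ≥ M = D + 1.
module Parameters (m′ k : ℕ) (0<k : 0 ℕ.< k) where

  m r ℓ s D M T : ℕ
  m = suc m′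
  r = suc m
  ℓ = ℕ.⌈ k /2⌉
  s = suc ℕ.⌊ k /2⌋
  -- The largest D with r (1 + 1/m)^m D ≤ ℓ^m, the condition for the counting argument. Rounding
  -- down is repaired by M = D + 1, which bounds the quotient from above.
  D = ((m ℕ.* ℓ) ℕ.^ m ℕ./ (r ℕ.^ r)) {{ℕ.m^n≢0 r r}}
  M = suc D
  T = M ℕ.* s

  k̂ m̂ r̂ ℓ̂ ŝ D̂ M̂ : ℚ
  k̂ = fromℕℚ k
  m̂ = fromℕℚ m
  r̂ = fromℕℚ r
  ℓ̂ = fromℕℚ ℓ
  ŝ = fromℕℚ s
  D̂ = fromℕℚ D
  M̂ = fromℕℚ M

  ⌊⌋+⌈⌉ : ℕ.⌊ k /2⌋ ℕ.+ ℓ ≡ k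
  ⌊⌋+⌈⌉ = ℕ.⌊n/2⌋+⌈n/2⌉≡n k

  double : ∀ a {x} → k ℕ.≤ x ℕ.+ x → a ≡ x → k̂ ≤ 2ℚ * fromℕℚ a
  double a {x} k≤ refl = subst (k̂ ≤_) (trans (fromℕℚ-+ a a) (solve 1 (λ a → a :+ a := con 2ℚ :* a) refl (fromℕℚ a))) (fromℕℚ-mono k≤)

  k≤2ℓ : k̂ ≤ 2ℚ * ℓ̂
  k≤2ℓ = double ℓ (ℕ.≤-trans (ℕ.≤-reflexive (sym ⌊⌋+⌈⌉)) (ℕ.+-monoˡ-≤ ℓ (ℕ.⌊n/2⌋≤⌈n/2⌉ k))) refl

  k≤2s : k̂ ≤ 2ℚ * ŝ
  k≤2s = double s (ℕ.≤-trans (ℕ.≤-reflexive (sym ⌊⌋+⌈⌉)) (ℕ.+-mono-≤ (ℕ.n≤1+n ℕ.⌊ k /2⌋) (ℕ.⌊n/2⌋-mono (ℕ.n≤1+n (suc k))))) refl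

  0<ℓ : 0 ℕ.< ℓ
  0<ℓ = ℕ.⌈n/2⌉-mono 0<k

  [mℓ]^m : fromℕℚ ((m ℕ.* ℓ) ℕ.^ m) ≡ (m̂ * ℓ̂) ^ m
  [mℓ]^m = trans (fromℕℚ-^ (m ℕ.* ℓ) m) (cong (_^ m) (fromℕℚ-* m ℓ))

  D-bound : D̂ * r̂ ^ r ≤ (m̂ * ℓ̂) ^ m
  D-bound = subst₂ _≤_ (trans (fromℕℚ-* D (r ℕ.^ r)) (cong (D̂ *_) (fromℕℚ-^ r r))) [mℓ]^m
    (fromℕℚ-mono (m/n*n≤m ((m ℕ.* ℓ) ℕ.^ m) (r ℕ.^ r) {{ℕ.m^n≢0 r r}}))

  M-bound : (m̂ * ℓ̂) ^ m ≤ M̂ * r̂ ^ r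
  M-bound = subst₂ _≤_ [mℓ]^m (trans (fromℕℚ-* M (r ℕ.^ r)) (cong (M̂ *_) (fromℕℚ-^ r r)))
    (fromℕℚ-mono (m≤[1+m/n]*n ((m ℕ.* ℓ) ℕ.^ m) (r ℕ.^ r) {{ℕ.m^n≢0 r r}}))

  0≤2 : 0ℚ ≤ 2ℚ
  0≤2 = 0≤+ 0≤1 0≤1

  -- The factor 2^m is the price of halving the lists. The bound is used twice: to show that T is
  -- large and that the mean colour degree is small.
  [mk]^m≤ : (m̂ * k̂) ^ m ≤ 2ℚ ^ m * (M̂ * r̂ ^ r)
  [mk]^m≤ = begin
    (m̂ * k̂) ^ m                   ≤⟨ ^-monoˡ-≤ m (0≤* (0≤fromℕℚ m) (0≤fromℕℚ k)) (*-monoˡ (0≤fromℕℚ m) k≤2ℓ) ⟩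
    (m̂ * (2ℚ * ℓ̂)) ^ m            ≡⟨ cong (_^ m) (solve 3 (λ m t l → m :* (t :* l) := t :* (m :* l)) refl m̂ 2ℚ ℓ̂) ⟩
    (2ℚ * (m̂ * ℓ̂)) ^ m            ≡⟨ ^-distrib-* 2ℚ (m̂ * ℓ̂) m ⟩
    2ℚ ^ m * (m̂ * ℓ̂) ^ m          ≤⟨ *-monoˡ (^-nonNeg m 0≤2) M-bound ⟩
    2ℚ ^ m * (M̂ * r̂ ^ r)          ∎
    where open ℚ.≤-Reasoning

  [2r]^r : fromℕℚ ((2 ℕ.* r) ℕ.^ r) ≡ 2ℚ ^ r * r̂ ^ r
  [2r]^r = trans (fromℕℚ-^ (2 ℕ.* r) r) (trans (cong (_^ r) (fromℕℚ-* 2 r)) (^-distrib-* 2ℚ r̂ r))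

  -- One factor k is at most 2 s, the other m are absorbed by M through `[mk]^m≤`, using k ≤ m k.
  k^r≤ : k ℕ.^ r ℕ.≤ (2 ℕ.* r) ℕ.^ r ℕ.* T
  k^r≤ = fromℕℚ-cancel-≤ (begin
    fromℕℚ (k ℕ.^ r)                          ≡⟨ fromℕℚ-^ k r ⟩
    k̂ * k̂ ^ m                                 ≤⟨ *-mono (^-nonNeg m (0≤fromℕℚ k)) (0≤* 0≤2 (0≤fromℕℚ s)) k≤2s (^-monoˡ-≤ m (0≤fromℕℚ k)
                                                   (subst (k̂ ≤_) (ℚ.*-comm k̂ m̂) (≤* (0≤fromℕℚ k) (fromℕℚ-mono {1} {m} (ℕ.s≤s ℕ.z≤n))))) ⟩
    2ℚ * ŝ * (m̂ * k̂) ^ m                      ≤⟨ *-monoˡ (0≤* 0≤2 (0≤fromℕℚ s)) [mk]^m≤ ⟩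
    2ℚ * ŝ * (2ℚ ^ m * (M̂ * r̂ ^ r))           ≡⟨ solve 5 (λ t s u M r → t :* s :* (u :* (M :* r)) := t :* u :* r :* (M :* s)) refl 2ℚ ŝ (2ℚ ^ m) M̂ (r̂ ^ r) ⟩
    2ℚ * 2ℚ ^ m * r̂ ^ r * (M̂ * ŝ)             ≡⟨ cong₂ _*_ [2r]^r (fromℕℚ-* M s) ⟨
    fromℕℚ ((2 ℕ.* r) ℕ.^ r) * fromℕℚ T       ≡⟨ fromℕℚ-* ((2 ℕ.* r) ℕ.^ r) T ⟨
    fromℕℚ ((2 ℕ.* r) ℕ.^ r ℕ.* T)            ∎)
    where open ℚ.≤-Reasoning

  -- The expected degree of a colour is at most M / 2.
  expected-degree : ∀ {Δ σ} κ → 0ℚ ≤ κ → κ * fromℕℚ σ ≡ k̂ → (2 ℕ.* r) ℕ.^ r ℕ.* Δ ℕ.≤ (m ℕ.* σ) ℕ.^ m →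
                    fromℕℚ Δ * κ ^ m ≤ fromℕℚ (2 ℕ.* M) * 1/suc 3
  expected-degree {Δ} {σ} κ 0≤κ κσ≡k h = *-cancelˡ (0<* (^-positive r (0<+ 0<1 0≤1)) (^-positive r (0<fromℕℚ-suc m))) (begin
    2ℚ ^ r * r̂ ^ r * (Δ̂ * κ ^ m)              ≡⟨ cong (_* (Δ̂ * κ ^ m)) [2r]^r ⟨
    fromℕℚ ((2 ℕ.* r) ℕ.^ r) * (Δ̂ * κ ^ m)    ≡⟨ ℚ.*-assoc (fromℕℚ ((2 ℕ.* r) ℕ.^ r)) Δ̂ (κ ^ m) ⟨
    fromℕℚ ((2 ℕ.* r) ℕ.^ r) * Δ̂ * κ ^ m      ≡⟨ cong (_* κ ^ m) (fromℕℚ-* ((2 ℕ.* r) ℕ.^ r) Δ) ⟨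
    fromℕℚ ((2 ℕ.* r) ℕ.^ r ℕ.* Δ) * κ ^ m    ≤⟨ *-monoʳ (^-nonNeg m 0≤κ) (fromℕℚ-mono h) ⟩
    fromℕℚ ((m ℕ.* σ) ℕ.^ m) * κ ^ m          ≡⟨ cong (_* κ ^ m) (trans (fromℕℚ-^ (m ℕ.* σ) m) (cong (_^ m) (fromℕℚ-* m σ))) ⟩
    (m̂ * σ̂) ^ m * κ ^ m                       ≡⟨ ^-distrib-* (m̂ * σ̂) κ m ⟨
    (m̂ * σ̂ * κ) ^ m                           ≡⟨ cong (_^ m) (trans (solve 3 (λ m s κ → m :* s :* κ := m :* (κ :* s)) refl m̂ σ̂ κ) (cong (m̂ *_) κσ≡k)) ⟩
    (m̂ * k̂) ^ m                               ≤⟨ [mk]^m≤ ⟩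
    2ℚ ^ m * (M̂ * r̂ ^ r)                      ≡⟨ solve 3 (λ u M r → u :* (M :* r) := con 2ℚ :* u :* r :* (con 2ℚ :* M :* con (1/suc 3))) refl (2ℚ ^ m) M̂ (r̂ ^ r) ⟩
    2ℚ ^ r * r̂ ^ r * (2ℚ * M̂ * 1/suc 3)       ≡⟨ cong (λ x → 2ℚ ^ r * r̂ ^ r * (x * 1/suc 3)) (fromℕℚ-* 2 M) ⟨
    2ℚ ^ r * r̂ ^ r * (fromℕℚ (2 ℕ.* M) * 1/suc 3) ∎)
    where
    open ℚ.≤-Reasoning
    Δ̂ σ̂ : ℚ
    Δ̂ = fromℕℚ Δ
    σ̂ = fromℕℚ σ

  -- q = 1/ℓ and ρ = r/m = 1 + 1/m. In `gap` a given ρ tolerates D q^m up to (ρ - 1) / ρ^(m+1), and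
  -- this is largest at ρ = (m + 1)/m.
  q ρ : ℚ
  q = proj₁ (reciprocal (0<fromℕℚ 0<ℓ))
  ρ = r̂ * 1/suc m′

  0<q : 0ℚ < q
  0<q = proj₁ (proj₂ (reciprocal (0<fromℕℚ 0<ℓ)))

  ℓq : ℓ̂ * q ≡ 1ℚ
  ℓq = proj₂ (proj₂ (reciprocal (0<fromℕℚ 0<ℓ)))

  mρ : m̂ * ρ ≡ r̂
  mρ = trans (solve 3 (λ m r i → m :* (r :* i) := r :* (m :* i)) refl m̂ r̂ (1/suc m′)) (trans (cong (r̂ *_) (1/suc-inverse m′)) (ℚ.*-identityʳ r̂))

  1≤ρ : 1ℚ ≤ ρ
  1≤ρ = *-cancelˡ (0<fromℕℚ-suc m′) (subst₂ _≤_ (sym (ℚ.*-identityʳ m̂)) (sym mρ) (fromℕℚ-mono (ℕ.n≤1+n m)))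

  gap : 1ℚ ≤ ρ * (1ℚ - D̂ * (ρ * q) ^ m)
  gap = *-cancelˡ (0<fromℕℚ-suc m′) (begin
    m̂ * 1ℚ                     ≡⟨ ℚ.*-identityʳ m̂ ⟩
    m̂                          ≤⟨ le≡ (trans (cong (λ x → x - x * ε - m̂) (fromℕℚ-suc m)) (trans
                                     (solve 2 (λ m ε → (con 1ℚ :+ m) :- (con 1ℚ :+ m) :* ε :- m := con 1ℚ :- (con 1ℚ :+ m) :* ε) refl m̂ ε)
                                     (cong (λ x → 1ℚ - x * ε) (sym (fromℕℚ-suc m))))) (el rε≤1) ⟩
    r̂ - r̂ * ε                  ≡⟨ cong (λ x → x - x * ε) mρ ⟨
    m̂ * ρ - m̂ * ρ * ε          ≡⟨ solve 3 (λ m ρ ε → m :* ρ :- m :* ρ :* ε := m :* (ρ :* (con 1ℚ :- ε))) refl m̂ ρ ε ⟩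
    m̂ * (ρ * (1ℚ - ε))         ∎)
    where
    open ℚ.≤-Reasoning
    ε : ℚ
    ε = D̂ * (ρ * q) ^ m
    ρqmℓ : (ρ * q) * (m̂ * ℓ̂) ≡ r̂
    ρqmℓ = trans (solve 4 (λ ρ q m l → (ρ :* q) :* (m :* l) := (m :* ρ) :* (l :* q)) refl ρ q m̂ ℓ̂) (trans (cong₂ _*_ mρ ℓq) (ℚ.*-identityʳ r̂))
    -- Since 1 - 1/ρ = 1/r, `gap` amounts to r ε ≤ 1; as ρ q m ℓ = r, that is `D-bound`.
    rε≤1 : r̂ * ε ≤ 1ℚ
    rε≤1 = *-cancelʳ (^-positive m (0<* (0<fromℕℚ-suc m′) (0<fromℕℚ 0<ℓ))) (begin
      r̂ * ε * (m̂ * ℓ̂) ^ m                            ≡⟨ solve 4 (λ r D x y → r :* (D :* x) :* y := D :* (r :* (x :* y))) refl r̂ D̂ ((ρ * q) ^ m) ((m̂ * ℓ̂) ^ m) ⟩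
      D̂ * (r̂ * ((ρ * q) ^ m * (m̂ * ℓ̂) ^ m))          ≡⟨ cong (λ x → D̂ * (r̂ * x)) (trans (sym (^-distrib-* (ρ * q) (m̂ * ℓ̂) m)) (cong (_^ m) ρqmℓ)) ⟩
      D̂ * r̂ ^ r                                      ≤⟨ D-bound ⟩
      (m̂ * ℓ̂) ^ m                                    ≡⟨ ℚ.*-identityˡ ((m̂ * ℓ̂) ^ m) ⟨
      1ℚ * (m̂ * ℓ̂) ^ m                               ∎)

  0≤q : 0ℚ ≤ q
  0≤q = ℚ.<⇒≤ 0<q

  1/length≤q : ∀ {A : Set} (xs : List A) → ℓ ℕ.≤ length xs → 1/length xs ≤ q
  1/length≤q xs ℓ≤ = *-cancelˡ (0<fromℕℚ (ℕ.≤-trans 0<ℓ ℓ≤)) (begin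
    fromℕℚ (length xs) * 1/length xs    ≡⟨ length*1/length xs (ℕ.≤-trans 0<ℓ ℓ≤) ⟩
    1ℚ                                  ≡⟨ ℓq ⟨
    ℓ̂ * q                               ≤⟨ *-monoʳ 0≤q (fromℕℚ-mono ℓ≤) ⟩
    fromℕℚ (length xs) * q              ∎)
    where open ℚ.≤-Reasoning

  -- G keeps the good colours of L. Shrinking lists can only lower colour degrees, so the bound D
  -- found in L persists in G.
  few-bad⇒colorable : ∀ {n σ} (H : Hypergraph n) → Uniform r H → (L : ListAssignment n σ) → (∀ v → ∣ lookup L v ∣ ≡ k) →
                      (∀ v → ∣ lookup L v ∩ badColors M H L v ∣ ℕ.< s) → Colorable H L
  few-bad⇒colorable {n} {σ} H unif L size few =
    let φ , φ∈G , proper = ColorDegrees.colorable H unif G q ρ 0≤q 1≤ρ gap spread degrees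
    in φ , (λ v → G⊆L v (φ∈G v)) , proper
    where
    good : Fin n → Subset σ
    good v = lookup L v ∩ ∁ (badColors M H L v)
    G : ListAssignment n σ
    G = Vec.tabulate good
    G≡ : ∀ v → lookup G v ≡ good v
    G≡ = lookup∘tabulate good
    G⊆L : ∀ v → lookup G v ⊆ lookup L v
    G⊆L v c∈ = proj₁ (x∈p∩q⁻ (lookup L v) _ (subst (_ ∈_) (G≡ v) c∈))
    ℓ≤∣G∣ : ∀ v → ℓ ℕ.≤ ∣ lookup G v ∣
    -- At most ⌊k/2⌋ of the k colours are bad, which leaves ⌈k/2⌉ = ℓ.
    ℓ≤∣G∣ v = subst (λ S → ℓ ℕ.≤ ∣ S ∣) (sym (G≡ v)) (ℕ.+-cancelˡ-≤ ℕ.⌊ k /2⌋ ℓ ∣ good v ∣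
      (ℕ.≤-trans (ℕ.≤-reflexive (trans ⌊⌋+⌈⌉ (trans (sym (size v)) (sym (∣p∩q∣+∣p∩∁q∣ (lookup L v) (badColors M H L v))))))
        (ℕ.+-monoˡ-≤ ∣ good v ∣ (ℕ.s≤s⁻¹ (few v)))))
    spread : RandomColoring.Spread q 0≤q G
    spread v = ℕ.≤-trans 0<ℓ (ℓ≤∣G∣ v) , 1/length≤q (elements (lookup G v)) (ℕ.≤-trans (ℓ≤∣G∣ v) (ℕ.≤-reflexive (sym (length-elements (lookup G v)))))
    degrees : ∀ v c → c ∈ lookup G v → colorDegree H G v c ℕ.≤ D
    degrees v c c∈ = ℕ.≤-trans (multiplicity-mono c (λ F → inter F G) (λ F → inter F L) (λ F → inter-mono F G L G⊆L) (link H v))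
      (ℕ.s≤s⁻¹ (∉-badColors M H L v c (x∈∁p⇒x∉p (proj₂ (x∈p∩q⁻ (lookup L v) _ (subst (c ∈_) (G≡ v) c∈))))))

  -- As 1 - 1/4 ≤ exp (-1/4), this z = (1 - 1/4)^(2 M) offsets (1 + κ^m)^Δ ≤ exp (Δ κ^m) ≤ exp (M / 2).
  z : ℚ
  z = 9/16 ^ M

  -- Markov's inequality and the union bound in one: without a colouring some vertex has weight at
  -- least (9/8)^T, so for every outcome 1 is at most the indicator of colourability plus (8/9)^T
  -- times the total weight. Averaging replaces each weight by at most 2^k.
  failure-probability : ∀ {n σ} (H : Hypergraph n) → Linear H → Uniform r H → k ℕ.≤ σ →
    (2 ℕ.* r) ℕ.^ r ℕ.* maxDegree H ℕ.≤ (m ℕ.* σ) ℕ.^ m →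
    1ℚ - Pr (colorable? H) (randomListAssignment n k σ) ≤ fromℕℚ n * 2ℚ ^ k * 8/9 ^ T
  failure-probability {n} {zero}   H lin unif k≤0 _ = contradiction (ℕ.≤-trans 0<k k≤0) λ ()
  failure-probability {n} {suc σ′} H lin unif k≤σ h = le≡
    (solve 2 (λ p x → x :- (con 1ℚ :- p) := (p :+ x) :- con 1ℚ) refl (Pr (colorable? H) (randomListAssignment n k σ)) (fromℕℚ n * 2ℚ ^ k * 8/9 ^ T))
    (el (subst (λ p → 1ℚ ≤ p + fromℕℚ n * 2ℚ ^ k * 8/9 ^ T) (sym (Pr-independent n Ω (colorable? H))) union-bound))
    where
    open ℚ.≤-Reasoning
    σ : ℕ
    σ = suc σ′
    κ : ℚ
    κ = k̂ * 1/suc σ′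
    Ω : List (Subset σ)
    Ω = subsetsOfSize σ k
    ΩΠ : Vec (List (Subset σ)) n
    ΩΠ = replicate n Ω
    0≤κ : 0ℚ ≤ κ
    0≤κ = 0≤* (0≤fromℕℚ k) (ℚ.<⇒≤ (0<1/suc σ′))
    κσ≡k : κ * fromℕℚ σ ≡ k̂
    κσ≡k = trans (solve 3 (λ k i s → k :* i :* s := k :* (s :* i)) refl k̂ (1/suc σ′) (fromℕℚ σ))
      (trans (cong (k̂ *_) (1/suc-inverse σ′)) (ℚ.*-identityʳ k̂))
    κ≤1 : κ ≤ 1ℚ
    κ≤1 = *-cancelʳ (0<fromℕℚ-suc σ′) (subst₂ _≤_ (sym κσ≡k) (sym (ℚ.*-identityˡ (fromℕℚ σ))) (fromℕℚ-mono k≤σ))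
    0≤z : 0ℚ ≤ z
    0≤z = ^-nonNeg M (ℚ.nonNegative⁻¹ 9/16)
    small : z * (1ℚ + κ ^ m) ^ maxDegree H ≤ 1ℚ
    small = subst (λ x → x * (1ℚ + κ ^ m) ^ maxDegree H ≤ 1ℚ) (sym (^-assocʳ 3/4 2 M))
      ([1-h]^N*[1+p]^n≤1 {1/suc 3} (ℚ.<⇒≤ (0<1/suc 3)) (1/suc≤1 3) (^-nonNeg m 0≤κ) (2 ℕ.* M) (maxDegree H) (expected-degree κ 0≤κ κσ≡k h))
    weight : Fin n → ListAssignment n σ → ℚ
    weight v = Weight.weight H v z 0≤z
    y≡ : (z * 2ℚ ^ M) ^ s ≡ 9/8 ^ T
    y≡ = trans (cong (_^ s) (sym (^-distrib-* 9/16 2ℚ M))) (^-assocʳ 9/8 M s)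
    1≤z2^M : 1ℚ ≤ z * 2ℚ ^ M
    1≤z2^M = subst (1ℚ ≤_) (^-distrib-* 9/16 2ℚ M) (subst (_≤ 9/8 ^ M) (1^ M) (^-monoˡ-≤ M 0≤1 (toWitness {a? = 1ℚ ℚ.≤? 9/8} _)))
    0≤8/9 : 0ℚ ≤ 8/9 ^ T
    0≤8/9 = ^-nonNeg T (ℚ.nonNegative⁻¹ 8/9)
    0≤∑ : ∀ L → 0ℚ ≤ ∑ (allFin n) (λ v → weight v L)
    0≤∑ L = ∑-nonNeg (allFin n) λ v → Weight.0≤weight H v z 0≤z L

    pointwise : ∀ L → L ∈Π ΩΠ → 1ℚ ≤ ind (colorable? H L) + 8/9 ^ T * ∑ (allFin n) (λ v → weight v L)
    pointwise L L∈ = by (colorable? H L) (Fin.any? λ v → s ℕ.≤? ∣ lookup L v ∩ badColors M H L v ∣)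
      where
      size : ∀ v → ∣ lookup L v ∣ ≡ k
      size v = proj₂ (∈-filter⁻ (λ S → ∣ S ∣ ℕ.≟ k) {xs = subsets σ} (subst (lookup L v ∈ₗ_) (lookup-replicate v Ω) (L∈ v)))
      by : (c? : Dec (Colorable H L)) → Dec (∃[ v ] s ℕ.≤ ∣ lookup L v ∩ badColors M H L v ∣) →
           1ℚ ≤ ind c? + 8/9 ^ T * ∑ (allFin n) (λ v → weight v L)
      by (yes _) _ = le≡ (solve 1 (λ x → con 1ℚ :+ x :- con 1ℚ := x) refl (8/9 ^ T * ∑ (allFin n) (λ v → weight v L))) (0≤* 0≤8/9 (0≤∑ L))
      by (no ¬c) (no none) = contradiction (few-bad⇒colorable H unif L size λ v → ℕ.≰⇒> λ s≤ → none (v , s≤)) ¬c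
      by (no ¬c) (yes (v , s≤)) = begin
        1ℚ                                                    ≡⟨ ^-inverse {8/9} {9/8} refl T ⟨
        8/9 ^ T * 9/8 ^ T                                     ≡⟨ cong (8/9 ^ T *_) y≡ ⟨
        8/9 ^ T * (z * 2ℚ ^ M) ^ s                            ≤⟨ *-monoˡ 0≤8/9 (Weight.weight≥ H v z 0≤z M s L 1≤z2^M s≤) ⟩
        8/9 ^ T * weight v L                                  ≤⟨ *-monoˡ 0≤8/9 (∑-∈ (λ v → weight v L) (λ v → Weight.0≤weight H v z 0≤z L) (∈-allFin v)) ⟩
        8/9 ^ T * ∑ (allFin n) (λ v → weight v L)             ≡⟨ ℚ.+-identityˡ _ ⟨
        0ℚ + 8/9 ^ T * ∑ (allFin n) (λ v → weight v L)        ∎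

    union-bound : 1ℚ ≤ Avg ΩΠ (ind ∘ colorable? H) + fromℕℚ n * 2ℚ ^ k * 8/9 ^ T
    union-bound = begin
      1ℚ                                                                                  ≡⟨ Avg-const ΩΠ (λ v → subst (λ xs → 0 ℕ.< length xs) (sym (lookup-replicate v Ω)) (subsetsOfSize-nonEmpty k≤σ)) 1ℚ ⟨
      Avg ΩΠ (λ _ → 1ℚ)                                                                   ≤⟨ Avg-mono ΩΠ pointwise ⟩
      Avg ΩΠ (λ L → ind (colorable? H L) + 8/9 ^ T * ∑ (allFin n) (λ v → weight v L))     ≡⟨ Avg-+ ΩΠ (ind ∘ colorable? H) (λ L → 8/9 ^ T * ∑ (allFin n) (λ v → weight v L)) ⟩
      P + Avg ΩΠ (λ L → 8/9 ^ T * ∑ (allFin n) (λ v → weight v L))                        ≡⟨ cong (λ x → P + x) (trans (Avg-*ˡ ΩΠ (8/9 ^ T) (λ L → ∑ (allFin n) (λ v → weight v L)))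
                                                                                               (cong (8/9 ^ T *_) (Avg-∑ ΩΠ (allFin n) weight))) ⟩
      P + 8/9 ^ T * ∑ (allFin n) (λ v → Avg ΩΠ (weight v))                                ≤⟨ ℚ.+-monoʳ-≤ P (*-monoˡ 0≤8/9 (∑-mono (allFin n) λ {v} _ →
                                                                                               Weight.Avg-weight H v z 0≤z lin unif k≤σ κ 0≤κ κ≤1 (ℚ.≤-reflexive (sym κσ≡k)) small)) ⟩
      P + 8/9 ^ T * ∑ (allFin n) (λ _ → 2ℚ ^ k)                                           ≡⟨ cong (λ x → P + 8/9 ^ T * x) (trans (∑-const (allFin n) (2ℚ ^ k))
                                                                                               (cong (λ i → fromℕℚ i * 2ℚ ^ k) (List.length-tabulate {n = n} (λ v → v)))) ⟩
      P + 8/9 ^ T * (fromℕℚ n * 2ℚ ^ k)                                                   ≡⟨ cong (λ x → P + x) (ℚ.*-comm (8/9 ^ T) (fromℕℚ n * 2ℚ ^ k)) ⟩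
      P + fromℕℚ n * 2ℚ ^ k * 8/9 ^ T                                                     ∎
      where
      P : ℚ
      P = Avg ΩΠ (ind ∘ colorable? H)

-- Convergence of the probability

Pr≤1 : ∀ {n k σ} {P : ListAssignment n σ → Set} (P? : Decidable P) → k ℕ.≤ σ → Pr P? (randomListAssignment n k σ) ≤ 1ℚ
Pr≤1 {n} {k} {σ} P? k≤σ = begin
  Pr P? (randomListAssignment n k σ)     ≡⟨ Pr-independent n Ω P? ⟩
  Avg (replicate n Ω) (ind ∘ P?)         ≤⟨ Avg-mono (replicate n Ω) (λ L _ → ind≤1 (P? L)) ⟩
  Avg (replicate n Ω) (λ _ → 1ℚ)         ≡⟨ Avg-const (replicate n Ω) (λ v → subst (λ xs → 0 ℕ.< length xs) (sym (lookup-replicate v Ω)) (subsetsOfSize-nonEmpty k≤σ)) 1ℚ ⟩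
  1ℚ                                     ∎
  where
  open ℚ.≤-Reasoning
  Ω : List (Subset σ)
  Ω = subsetsOfSize σ k

-- (18/17)^34 ≥ 4 by Bernoulli's inequality, so 2^k (17/18)^T ≤ 2^-k ≤ 1 / (1 + k).
decay : ∀ n k T → fromℕℚ n ≤ 17/16 ^ T → 34 ℕ.* k ℕ.≤ T → fromℕℚ n * 2ℚ ^ k * 8/9 ^ T * (1ℚ + fromℕℚ k) ≤ 1ℚ
decay n k T n≤ 34k≤T = begin
  fromℕℚ n * b * 8/9 ^ T * (1ℚ + fromℕℚ k)          ≤⟨ *-mono (0≤+ 0≤1 (0≤fromℕℚ k)) (0≤* 0≤b (^-nonNeg T (ℚ.nonNegative⁻¹ 17/18))) n≤′ 1+k≤b ⟩
  b * x * b                                         ≡⟨ solve 2 (λ b x → b :* x :* b := x :* (b :* b)) refl b x ⟩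
  x * (b * b)                                       ≤⟨ *-monoˡ (^-nonNeg T (ℚ.nonNegative⁻¹ 17/18)) b²≤ ⟩
  17/18 ^ T * 18/17 ^ T                             ≡⟨ ^-inverse {17/18} {18/17} refl T ⟩
  1ℚ                                                ∎
  where
  open ℚ.≤-Reasoning
  b x : ℚ
  b = 2ℚ ^ k
  x = 17/18 ^ T
  0≤b : 0ℚ ≤ b
  0≤b = ^-nonNeg k (0≤+ 0≤1 0≤1)
  n≤′ : fromℕℚ n * b * 8/9 ^ T ≤ b * x
  n≤′ = begin
    fromℕℚ n * b * 8/9 ^ T         ≤⟨ *-monoʳ (^-nonNeg T (ℚ.nonNegative⁻¹ 8/9)) (*-monoʳ 0≤b n≤) ⟩
    17/16 ^ T * b * 8/9 ^ T        ≡⟨ solve 3 (λ y b z → y :* b :* z := b :* (y :* z)) refl (17/16 ^ T) b (8/9 ^ T) ⟩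
    b * (17/16 ^ T * 8/9 ^ T)      ≡⟨ cong (b *_) (^-distrib-* 17/16 8/9 T) ⟨
    b * x                          ∎
  1+k≤b : 1ℚ + fromℕℚ k ≤ b
  1+k≤b = subst (λ y → 1ℚ + y ≤ b) (ℚ.*-identityʳ (fromℕℚ k)) (bernoulli 0≤1 k)
  4≤ : 2ℚ * 2ℚ ≤ 18/17 ^ 34
  4≤ = begin
    2ℚ * 2ℚ                        ≤⟨ *-mono (0≤+ 0≤1 0≤1) (^-nonNeg 17 (ℚ.nonNegative⁻¹ 18/17)) 2≤ 2≤ ⟩
    18/17 ^ 17 * 18/17 ^ 17        ≡⟨ ^-homo-* 18/17 17 17 ⟨
    18/17 ^ 34                     ∎
    where
    2≤ : 2ℚ ≤ 18/17 ^ 17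
    2≤ = bernoulli {1/suc 16} (ℚ.<⇒≤ (0<1/suc 16)) 17
  b²≤ : b * b ≤ 18/17 ^ T
  b²≤ = begin
    b * b                          ≡⟨ ^-distrib-* 2ℚ 2ℚ k ⟨
    (2ℚ * 2ℚ) ^ k                  ≤⟨ ^-monoˡ-≤ k (0≤* (0≤+ 0≤1 0≤1) (0≤+ 0≤1 0≤1)) 4≤ ⟩
    (18/17 ^ 34) ^ k               ≡⟨ ^-assocʳ 18/17 34 k ⟩
    18/17 ^ (34 ℕ.* k)             ≤⟨ ^-monoʳ-≤ (toWitness {a? = 1ℚ ℚ.≤? 18/17} _) 34k≤T ⟩
    18/17 ^ T                      ∎

theorem4p1 : (r : ℕ) .{{_ : NonTrivial r}} (C : ℝ) →
    root (ℕ.pred r) {{pred-nonZero r}} (fromℕ (2 ℕ.^ r) *ℝ e *ℝ fromℕ r) <ℝ C →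
    ∃[ A ] 0ℝ <ℝ A ×
    ((H : (n : ℕ) → Hypergraph n) (k σ : ℕ → ℕ) →
    (∀ n → Linear (H n)) →
    (∀ n → Uniform r (H n)) →
    (∀ n → k n ℕ.≤ σ n) →
    (∀ n → A *ℝ root r {{nonTrivial⇒nonZero r}} (log n) ≤ℝ fromℕ (k n)) →
    (∀ n → C *ℝ root (ℕ.pred r) {{pred-nonZero r}} (fromℕ (maxDegree (H n))) ≤ℝ fromℕ (σ n)) →
    (λ n → Pr (colorable? (H n)) (randomListAssignment n (k n) (σ n))) ⟶ 1ℚ)
theorem4p1 (suc (suc m′)) C C-large = fromℕ a , ℚ.<-dense (0<fromℕℚ {a} (ℕ.s≤s ℕ.z≤n)) , limit
  where
  m r a : ℕ
  m = suc m′
  r = suc m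
  -- 4 r because (k + 1)^r ≤ (4 r)^r T; 20 comes from the chain of strict approximations in
  -- `log-bound`.
  a = 20 ℕ.* (4 ℕ.* r)

  limit : (H : (n : ℕ) → Hypergraph n) (k σ : ℕ → ℕ) → (∀ n → Linear (H n)) → (∀ n → Uniform r (H n)) → (∀ n → k n ℕ.≤ σ n) →
          (∀ n → fromℕ a *ℝ root r (log n) ≤ℝ fromℕ (k n)) → (∀ n → C *ℝ root m (fromℕ (maxDegree (H n))) ≤ℝ fromℕ (σ n)) →
          (λ n → Pr (colorable? (H n)) (randomListAssignment n (k n) (σ n))) ⟶ 1ℚ
  limit H k σ lin unif k≤σ k-large σ-large ε 0<ε = N , close
    where
    K₀ K₁ N : ℕ
    K₀ = proj₁ (archimedean 1ℚ 0<ε)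
    -- k ≥ K₀ makes 1 / (1 + k) smaller than ε, the second summand serves `34κ≤T`, and the successor
    -- makes k positive.
    K₁ = suc (K₀ ℕ.+ 34 ℕ.* (2 ℕ.* r) ℕ.^ r)
    N  = suc (proj₁ (above (17/16 ^ (K₁ ℕ.^ r))))

    -- Only k → ∞ is wanted here, so `log-bound` is applied with the crude choice T = (k + 1)^r.
    K₁≤k : ∀ n → N ℕ.≤ n → K₁ ℕ.≤ k n
    K₁≤k n N≤n = ℕ.≮⇒≥ λ k<K₁ → ℚ.<-irrefl refl (begin-strict
      fromℕℚ n                                    ≤⟨ log-bound m (k n) n (suc (k n) ℕ.^ r) (k-large n) (ℕ.m≤n*m (suc (k n) ℕ.^ r) ((4 ℕ.* r) ℕ.^ r) {{ℕ.m^n≢0 (4 ℕ.* r) r}}) ⟩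
      17/16 ^ (suc (k n) ℕ.^ r)                   ≤⟨ ^-monoʳ-≤ (toWitness {a? = 1ℚ ℚ.≤? 17/16} _) (ℕ.^-monoˡ-≤ r k<K₁) ⟩
      17/16 ^ (K₁ ℕ.^ r)                          ≤⟨ proj₂ (above (17/16 ^ (K₁ ℕ.^ r))) ⟩
      fromℕℚ (ℕ.pred N)                           <⟨ fromℕℚ-mono-< N≤n ⟩
      fromℕℚ n                                    ∎)
      where open ℚ.≤-Reasoning

    module _ (n : ℕ) (N≤n : N ℕ.≤ n) where
      κ : ℕ
      κ = k n
      0<κ : 0 ℕ.< κ
      0<κ = ℕ.≤-trans (ℕ.s≤s ℕ.z≤n) (K₁≤k n N≤n)
      K₀≤κ : K₀ ℕ.≤ κ
      K₀≤κ = ℕ.≤-trans (ℕ.m≤n⇒m≤1+n (ℕ.m≤m+n K₀ (34 ℕ.* (2 ℕ.* r) ℕ.^ r))) (K₁≤k n N≤n)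
      34[2r]^r≤κ : 34 ℕ.* (2 ℕ.* r) ℕ.^ r ℕ.≤ κ
      34[2r]^r≤κ = ℕ.≤-trans (ℕ.m≤n⇒m≤1+n (ℕ.m≤n+m (34 ℕ.* (2 ℕ.* r) ℕ.^ r) K₀)) (K₁≤k n N≤n)

      open Parameters m′ κ 0<κ using (T; k^r≤; failure-probability)

      -- k² ≤ k^r because r ≥ 2, and one of the two factors k absorbs 34 (2 r)^r. The number 34 is
      -- the exponent with (18/17)^34 ≥ 4.
      34κ≤T : 34 ℕ.* κ ℕ.≤ T
      34κ≤T = ℕ.*-cancelˡ-≤ ((2 ℕ.* r) ℕ.^ r) {{ℕ.m^n≢0 (2 ℕ.* r) r}} (begin
        (2 ℕ.* r) ℕ.^ r ℕ.* (34 ℕ.* κ)    ≡⟨ trans (sym (ℕ.*-assoc ((2 ℕ.* r) ℕ.^ r) 34 κ)) (cong (ℕ._* κ) (ℕ.*-comm ((2 ℕ.* r) ℕ.^ r) 34)) ⟩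
        34 ℕ.* (2 ℕ.* r) ℕ.^ r ℕ.* κ      ≤⟨ ℕ.*-monoˡ-≤ κ 34[2r]^r≤κ ⟩
        κ ℕ.* κ                           ≤⟨ ℕ.*-monoʳ-≤ κ (ℕ.m≤m*n κ (κ ℕ.^ m′) {{ℕ.m^n≢0 κ m′ {{ℕ.>-nonZero 0<κ}}}}) ⟩
        κ ℕ.^ r                           ≤⟨ k^r≤ ⟩
        (2 ℕ.* r) ℕ.^ r ℕ.* T             ∎)
        where open ℕ.≤-Reasoning

      -- k + 1 ≤ 2 k turns 2 r into 4 r. The successor gives `log-bound` its strict inequality
      -- against k.
      [1+κ]^r≤ : suc κ ℕ.^ r ℕ.≤ (4 ℕ.* r) ℕ.^ r ℕ.* T
      [1+κ]^r≤ = fromℕℚ-cancel-≤ (begin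
        fromℕℚ (suc κ ℕ.^ r)                              ≡⟨ fromℕℚ-^ (suc κ) r ⟩
        fromℕℚ (suc κ) ^ r                                ≤⟨ ^-monoˡ-≤ r (0≤fromℕℚ (suc κ)) (fromℕℚ-mono (subst (suc κ ℕ.≤_) (cong (κ ℕ.+_) (sym (ℕ.+-identityʳ κ))) (ℕ.+-monoˡ-≤ κ 0<κ))) ⟩
        fromℕℚ (2 ℕ.* κ) ^ r                              ≡⟨ cong (_^ r) (fromℕℚ-* 2 κ) ⟩
        (2ℚ * fromℕℚ κ) ^ r                               ≡⟨ ^-distrib-* 2ℚ (fromℕℚ κ) r ⟩
        2ℚ ^ r * fromℕℚ κ ^ r                             ≡⟨ cong (2ℚ ^ r *_) (fromℕℚ-^ κ r) ⟨
        2ℚ ^ r * fromℕℚ (κ ℕ.^ r)                         ≤⟨ *-monoˡ (^-nonNeg r (0≤+ 0≤1 0≤1)) (fromℕℚ-mono k^r≤) ⟩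
        2ℚ ^ r * fromℕℚ ((2 ℕ.* r) ℕ.^ r ℕ.* T)           ≡⟨ cong (2ℚ ^ r *_) (trans (fromℕℚ-* ((2 ℕ.* r) ℕ.^ r) T) (cong (_* fromℕℚ T) (fromℕℚ-^ (2 ℕ.* r) r))) ⟩
        2ℚ ^ r * (fromℕℚ (2 ℕ.* r) ^ r * fromℕℚ T)        ≡⟨ ℚ.*-assoc (2ℚ ^ r) (fromℕℚ (2 ℕ.* r) ^ r) (fromℕℚ T) ⟨
        2ℚ ^ r * fromℕℚ (2 ℕ.* r) ^ r * fromℕℚ T          ≡⟨ cong (_* fromℕℚ T) (trans (sym (^-distrib-* 2ℚ (fromℕℚ (2 ℕ.* r)) r))
                                                               (trans (cong (_^ r) (trans (sym (fromℕℚ-* 2 (2 ℕ.* r))) (cong fromℕℚ (sym (ℕ.*-assoc 2 2 r)))))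
                                                                 (sym (fromℕℚ-^ (4 ℕ.* r) r)))) ⟩
        fromℕℚ ((4 ℕ.* r) ℕ.^ r) * fromℕℚ T               ≡⟨ fromℕℚ-* ((4 ℕ.* r) ℕ.^ r) T ⟨
        fromℕℚ ((4 ℕ.* r) ℕ.^ r ℕ.* T)                    ∎)
        where open ℚ.≤-Reasoning

      P : ℚ
      P = Pr (colorable? (H n)) (randomListAssignment n κ (σ n))

      0≤1-P : 0ℚ ≤ 1ℚ - P
      0≤1-P = el (Pr≤1 (colorable? (H n)) (k≤σ n))

      [1-P][1+κ]≤1 : (1ℚ - P) * (1ℚ + fromℕℚ κ) ≤ 1ℚ
      [1-P][1+κ]≤1 = ℚ.≤-trans
        (*-monoʳ (0≤+ 0≤1 (0≤fromℕℚ κ)) (failure-probability (H n) (lin n) (unif n) (k≤σ n)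
          (degree-bound m′ C C-large (maxDegree (H n)) (σ n) (ℕ.≤-trans 0<κ (k≤σ n)) (σ-large n))))
        (decay n κ T (log-bound m κ n T (k-large n) [1+κ]^r≤) 34κ≤T)

      1-P<ε : 1ℚ - P < ε
      1-P<ε = ℚ.*-cancelʳ-<-nonNeg (1ℚ + fromℕℚ κ) {{ℚ.nonNegative (0≤+ 0≤1 (0≤fromℕℚ κ))}} (begin-strict
        (1ℚ - P) * (1ℚ + fromℕℚ κ)      ≤⟨ [1-P][1+κ]≤1 ⟩
        1ℚ                              ≤⟨ proj₂ (archimedean 1ℚ 0<ε) ⟩
        ε * fromℕℚ K₀                   ≤⟨ *-monoˡ (ℚ.<⇒≤ 0<ε) (fromℕℚ-mono K₀≤κ) ⟩
        ε * fromℕℚ κ                    <⟨ lt≡ (solve 2 (λ ε κ → ε :* (con 1ℚ :+ κ) :- ε :* κ := ε) refl ε (fromℕℚ κ)) 0<ε ⟩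
        ε * (1ℚ + fromℕℚ κ)             ∎)
        where open ℚ.≤-Reasoning

      close : ℚ.∣ P - 1ℚ ∣ < ε
      close = subst (_< ε) (sym (begin
        ℚ.∣ P - 1ℚ ∣          ≡⟨ cong ℚ.∣_∣ (solve 1 (λ p → p :- con 1ℚ := :- (con 1ℚ :- p)) refl P) ⟩
        ℚ.∣ - (1ℚ - P) ∣      ≡⟨ ℚ.∣-p∣≡∣p∣ (1ℚ - P) ⟩
        ℚ.∣ 1ℚ - P ∣          ≡⟨ ℚ.0≤p⇒∣p∣≡p 0≤1-P ⟩
        1ℚ - P                ∎)) 1-P<ε
        where open ≡-Reasoning
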